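{- Let $K \geq 1$ and let $A_1,A_2,A_3,A_4 \subseteq \mathbb{F}_2^n$ be non-empty sets such that $\omega(A_1,A_2,A_3,A_4) \geq \frac{1}{K}$. Then there exist a linear subspace $H \subseteq \mathbb{F}_2^n$ with $|H| \gg K^{ -O(K)}|A_i|$ for each $i = 1,2,3,4$, and elements $x_1,x_2,x_3,x_4 \in \mathbb{F}_2^n$, such that \[ \prod_{i=1}^4 |A_i \cap (x_i + H)|^{1/4} \geq \frac{1}{2K}|H|.\]
   Context: $\mathbb{F}_2^n$ is the $n$-dimensional vector space over the two-element field. For non-empty $A_1,\dots,A_4 \subseteq \mathbb{F}_2^n$ the normalised energy is \[\omega(A_1,A_2,A_3,A_4) := \frac{|\{ (a_1,a_2,a_3,a_4) \in A_1 \times A_2 \times A_3 \times A_4 : a_1 + a_2 + a_3 + a_4 = 0 \}|}{(|A_1| |A_2| |A_3| |A_4|)^{3/4}}.\] The notation $|H| \gg K^{ -O(K)}|A_i|$ means $|H| \geq c K^{ -CK}|A_i|$ for some absolute constants $c,C>0$.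
   Formalization: The parameter K ≥ 1 ranges over rational numbers instead of real numbers. -}

module Defs where

open import Data.Bool using (Bool; true; false; _∧_; _xor_; not; if_then_else_)
open import Data.Nat using (ℕ; zero; suc; _+_; _*_)
open import Data.List using (List; []; _∷_; map; _++_)
open import Data.Nat.ListAction using (sum)
open import Data.Vec using (Vec; []; _∷_; zipWith; replicate)
open import Data.Fin using (Fin; zero; suc)
open import Data.Product using (Σ)
open import Data.Integer using (+_)
open import Data.Rational using (ℚ; _/_; 1ℚ) renaming (_*_ to _*ℚ_)
open import Relation.Binary.PropositionalEquality using (_≡_)

F₂^ : ℕ → Set
F₂^ n = Vec Bool n

infixl 6 _⊕_
_⊕_ : {n : ℕ} → F₂^ n → F₂^ n → F₂^ n
_⊕_ = zipWith _xor_

0v : {n : ℕ} → F₂^ n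
0v {n} = replicate n false

isZero : {n : ℕ} → F₂^ n → Bool
isZero [] = true
isZero (b ∷ v) = not b ∧ isZero v

allVecs : (n : ℕ) → List (F₂^ n)
allVecs zero = [] ∷ []
allVecs (suc n) = map (false ∷_) (allVecs n) ++ map (true ∷_) (allVecs n)

Subset : ℕ → Set
Subset n = F₂^ n → Bool

ind : Bool → ℕ
ind true = 1
ind false = 0

card : {n : ℕ} → Subset n → ℕ
card {n} A = sum (map (λ v → ind (A v)) (allVecs n))

NonEmpty : {n : ℕ} → Subset n → Set
NonEmpty {n} A = Σ (F₂^ n) (λ v → A v ≡ true)

-- H is a linear subspace of F₂ⁿ (over F₂ scalar multiples are trivial)
record IsSubspace {n : ℕ} (H : Subset n) : Set where
  field
    zero∈ : H 0v ≡ true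
    closed+ : ∀ u v → H u ≡ true → H v ≡ true → H (u ⊕ v) ≡ true

-- A ∩ (x + H) : v ∈ x + H iff v + x ∈ H (characteristic 2)
interCoset : {n : ℕ} → Subset n → F₂^ n → Subset n → Subset n
interCoset A x H v = A v ∧ H (v ⊕ x)

energy : {n : ℕ} → (Fin 4 → Subset n) → ℕ
energy {n} A =
  sum (map (λ a₁ → sum (map (λ a₂ → sum (map (λ a₃ → sum (map (λ a₄ →
    ind (A zero a₁ ∧ A (suc zero) a₂ ∧ A (suc (suc zero)) a₃ ∧ A (suc (suc (suc zero))) a₄
         ∧ isZero (a₁ ⊕ a₂ ⊕ a₃ ⊕ a₄)))
    (allVecs n))) (allVecs n))) (allVecs n))) (allVecs n))

prod4 : (Fin 4 → ℕ) → ℕ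
prod4 f = f zero * f (suc zero) * f (suc (suc zero)) * f (suc (suc (suc zero)))

ℕ→ℚ : ℕ → ℚ
ℕ→ℚ m = + m / 1

_^ℚ_ : ℚ → ℕ → ℚ
q ^ℚ zero = 1ℚ
q ^ℚ suc k = q *ℚ (q ^ℚ k)

{-# OPTIONS --safe #-}
module Submission where

-- Write Π = ∏ |Aᵢ| and E for the number of additive quadruples. Cutting every Aᵢ by the hyperplane
-- of a character χ_ξ splits E into the energies of the eight pieces of even parity. For the
-- potential (E K)⁴ / Π³ · Π^(1/m), with m a large multiple of ⌈K⌉, a quantitative form of Young's
-- inequality on ℤ/2 shows that some piece has at least the same potential, unless the four Fourier
-- coefficients at ξ are all O(K^(-1/2)) or all close to 1 (relative to |Aᵢ|). Replacing (Aᵢ) by such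
-- pieces therefore ends in a quadruple that is flat at every ξ, and comparing potentials shows that
-- its sets still have size at least K^(-4m) |Aᵢ|. For a flat quadruple the characters with large
-- coefficients form a subspace W, the other characters contribute at most half of the energy, and
-- so H = W^⊥ carries 2 |{a₁ + a₂ + a₃ + a₄ ∈ H}| ≥ |H| E; by Hölder's inequality on the Fourier side
-- the left-hand count is at most ∏ (Mᵢ |Aᵢ|³)^(1/4) with Mᵢ = max_x |Aᵢ ∩ (x + H)|.

open import Algebra.Bundles using (CommutativeRing)
open import Algebra.Structures using (IsCommutativeRing)
open import Data.Bool using (Bool; true; false; _xor_; _∧_; not)
open import Data.Empty using (⊥; ⊥-elim)
open import Data.Fin using (Fin; zero; suc)
import Data.Fin.Properties as Fin
open import Data.Integer as ℤ using (ℤ; -[1+_]) renaming (+_ to pos)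
import Data.Integer.DivMod as ℤ
import Data.Integer.Properties as ℤ
open import Data.List using (map; _++_)
open import Data.List.Properties using (map-++; map-∘)
open import Data.Maybe using (Maybe; just; nothing)
open import Data.Nat as ℕ using (ℕ; zero; suc)
open import Data.Nat.ListAction using (sum)
open import Data.Nat.ListAction.Properties using (sum-++)
import Data.Nat.Properties as ℕ
open import Data.Product using (Σ; _×_; _,_; proj₁; proj₂; ∃)
import Data.Rational as ℚ
import Data.Rational.Properties as ℚ
open import Data.Rational.Unnormalised as ℚᵘ using (mkℚᵘ)
import Data.Rational.Unnormalised.Properties as ℚᵘ
open import Data.Sum as Sum using (_⊎_; inj₁; inj₂)
open import Data.Vec using ([]; _∷_)
open import Defs using (F₂^; _⊕_; 0v; isZero; Subset; IsSubspace; interCoset; allVecs; ind; card; energy)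
open import Function using (_∘_)
open import Relation.Binary.PropositionalEquality
open import Relation.Binary.Structures using (IsDecTotalOrder)
open import Relation.Nullary using (¬_; Dec; yes; no; does; ¬?)
open import Relation.Nullary.Decidable using (_×-dec_)

-- The exponential loss comes from one inequality on ℤ/2: (u + v)⁴ + (u - v)⁴ ≤ 2 for u, v ≥ 0 with
-- u⁴ = p³, v⁴ = q³ and p + q = 1. With x = pq its deficit is 6x(1 - 2√x), which vanishes only for p
-- = 0, 1/2, 1 and, near p = 1/2, is linear in the squared bias (p - q)². Lowering the exponent 3 to
-- 3 - w, where w = 1/m, spoils the inequality by O(w), so near-equality forces a squared bias that
-- is O(w) or 1 - O(w). The Fourier error term tolerates squared bias 1/(2K), hence m must be of
-- order K. The potential can gain at most a factor K⁴, because E⁴ ≤ Π³ always holds; as it contains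
-- Π only to the power 1/m, Π may drop by K^(4m). Nothing needs real numbers. Statements with
-- exponent 1/m are raised to the power m, weights that are polynomial in p replace p^(3 - w), and
-- their fourth roots are taken approximately, with an error w² that is negligible against O(w). An
-- ordered field with decidable order therefore suffices.

record OrderedField : Set₁ where
  infixl 7 _*_
  infixl 6 _+_
  infix  8 -_
  infix  4 _≤_
  field
    Carrier           : Set
    _+_ _*_           : Carrier → Carrier → Carrier
    -_                : Carrier → Carrier
    0# 1#             : Carrier
    isCommutativeRing : IsCommutativeRing _≡_ _+_ _*_ -_ 0# 1#
    _≤_               : Carrier → Carrier → Set
    isDecTotalOrder   : IsDecTotalOrder _≡_ _≤_
    +-monoˡ-≤         : ∀ z {x y} → x ≤ y → x + z ≤ y + z
    *-nonneg          : ∀ {x y} → 0# ≤ x → 0# ≤ y → 0# ≤ x * y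
    1≰0               : ¬ 1# ≤ 0#
    inverse           : ∀ x → ¬ x ≡ 0# → ∃ λ y → x * y ≡ 1#

-- Arithmetic and order in an abstract ordered field.

module OrderedFieldProperties (F : OrderedField) where

  open OrderedField F public
  open IsDecTotalOrder isDecTotalOrder public using (_≤?_; total; antisym)
    renaming (refl to ≤-refl; trans to ≤-trans; reflexive to ≤-reflexive)

  commutativeRing : CommutativeRing _ _
  commutativeRing = record { isCommutativeRing = isCommutativeRing }

  open CommutativeRing commutativeRing public
    using (+-assoc; +-comm; +-identityˡ; +-identityʳ; -‿inverseʳ; *-assoc; *-comm;
           *-identityˡ; *-identityʳ; distribˡ; distribʳ; zeroˡ; zeroʳ; semiring; ring;
           +-abelianGroup; commutativeSemiring)
  open import Algebra.Properties.Ring ring public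
    using (-‿distribˡ-*; -‿involutive; -0#≈0#)
  open import Algebra.Properties.AbelianGroup +-abelianGroup public using (⁻¹-∙-comm)
  open import Algebra.Properties.Semiring.Mult.TCOptimised semiring
    using (×-homo-+; ×1-homo-*) renaming (_×_ to _·_)
  open import Algebra.Properties.Semiring.Exp semiring public using (_^_; ^-homo-*; ^-assocʳ)
  open import Algebra.Properties.CommutativeSemiring.Exp commutativeSemiring public using (^-distrib-*)

  infixl 6 _-_
  _-_ : Carrier → Carrier → Carrier
  x - y = x + - y

  -- Interprets integer literals, so that the ring solver can work with coefficients in ℤ; the
  -- homomorphism proofs that follow serve this purpose.
  fromℤ : ℤ → Carrier
  fromℤ (pos n)    = n · 1#
  fromℤ -[1+ n ] = - (suc n · 1#)

  # : ℕ → Carrier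
  # n = fromℤ (pos n)

  #-homo-+ : ∀ m n → # (m ℕ.+ n) ≡ # m + # n
  #-homo-+ = ×-homo-+ 1#

  #-homo-* : ∀ m n → # (m ℕ.* n) ≡ # m * # n
  #-homo-* = ×1-homo-*

  private
    cancel-1+ : ∀ x y → x - y ≡ (1# + x) - (1# + y)
    cancel-1+ x y = sym (begin
      (1# + x) + - (1# + y)     ≡⟨ cong ((1# + x) +_) (sym (⁻¹-∙-comm 1# y)) ⟩
      (1# + x) + (- 1# + - y)   ≡⟨ cong (_+ (- 1# + - y)) (+-comm 1# x) ⟩
      (x + 1#) + (- 1# + - y)   ≡⟨ +-assoc x 1# _ ⟩
      x + (1# + (- 1# + - y))   ≡⟨ cong (x +_) (sym (+-assoc 1# (- 1#) (- y))) ⟩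
      x + ((1# + - 1#) + - y)   ≡⟨ cong (λ z → x + (z + - y)) (-‿inverseʳ 1#) ⟩
      x + (0# + - y)            ≡⟨ cong (x +_) (+-identityˡ (- y)) ⟩
      x - y                     ∎)
      where open ≡-Reasoning

    fromℤ-⊖ : ∀ m n → fromℤ (m ℤ.⊖ n) ≡ # m - # n
    fromℤ-⊖ m zero = sym (trans (cong (# m +_) -0#≈0#) (+-identityʳ (# m)))
    fromℤ-⊖ zero (suc n) = sym (+-identityˡ _)
    fromℤ-⊖ (suc m) (suc n) = begin
      fromℤ (suc m ℤ.⊖ suc n)  ≡⟨ cong fromℤ (ℤ.[1+m]⊖[1+n]≡m⊖n m n) ⟩
      fromℤ (m ℤ.⊖ n)          ≡⟨ fromℤ-⊖ m n ⟩
      # m - # n                ≡⟨ cancel-1+ (# m) (# n) ⟩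
      (1# + # m) - (1# + # n)  ≡⟨ cong₂ _-_ (sym (#-homo-+ 1 m)) (sym (#-homo-+ 1 n)) ⟩
      # (suc m) - # (suc n)    ∎
      where open ≡-Reasoning

    fromℤ-homo-neg : ∀ i → fromℤ (ℤ.- i) ≡ - fromℤ i
    fromℤ-homo-neg (pos zero)  = sym -0#≈0#
    fromℤ-homo-neg (pos (suc n)) = refl
    fromℤ-homo-neg -[1+ n ]  = sym (-‿involutive _)

    fromℤ-homo-+ : ∀ i j → fromℤ (i ℤ.+ j) ≡ fromℤ i + fromℤ j
    fromℤ-homo-+ (pos m)    (pos n)    = #-homo-+ m n
    fromℤ-homo-+ (pos m)    -[1+ n ] = fromℤ-⊖ m (suc n)
    fromℤ-homo-+ -[1+ m ] (pos n)    = trans (fromℤ-⊖ n (suc m)) (+-comm _ _)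
    fromℤ-homo-+ -[1+ m ] -[1+ n ] = begin
      - # (suc (suc (m ℕ.+ n)))      ≡⟨ cong (λ k → - # (suc k)) (sym (ℕ.+-suc m n)) ⟩
      - # (suc m ℕ.+ suc n)          ≡⟨ cong -_ (#-homo-+ (suc m) (suc n)) ⟩
      - (# (suc m) + # (suc n))      ≡⟨ sym (⁻¹-∙-comm _ _) ⟩
      - # (suc m) + - # (suc n)      ∎
      where open ≡-Reasoning

    fromℤ-homo-*⁺ : ∀ m j → fromℤ (pos m ℤ.* j) ≡ # m * fromℤ j
    fromℤ-homo-*⁺ m (pos n) = trans (cong fromℤ (sym (ℤ.pos-* m n))) (#-homo-* m n)
    fromℤ-homo-*⁺ m -[1+ n ] = begin
      fromℤ (pos m ℤ.* ℤ.- pos (suc n))     ≡⟨ cong fromℤ (sym (ℤ.neg-distribʳ-* (pos m) (pos (suc n)))) ⟩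
      fromℤ (ℤ.- (pos m ℤ.* pos (suc n)))   ≡⟨ fromℤ-homo-neg (pos m ℤ.* pos (suc n)) ⟩
      - fromℤ (pos m ℤ.* pos (suc n))       ≡⟨ cong -_ (fromℤ-homo-*⁺ m (pos (suc n))) ⟩
      - (# m * # (suc n))             ≡⟨ cong -_ (*-comm _ _) ⟩
      - (# (suc n) * # m)             ≡⟨ -‿distribˡ-* _ _ ⟩
      - # (suc n) * # m               ≡⟨ *-comm _ _ ⟩
      # m * - # (suc n)               ∎
      where open ≡-Reasoning

    fromℤ-homo-* : ∀ i j → fromℤ (i ℤ.* j) ≡ fromℤ i * fromℤ j
    fromℤ-homo-* (pos m) j = fromℤ-homo-*⁺ m j
    fromℤ-homo-* -[1+ m ] j = begin
      fromℤ (ℤ.- pos (suc m) ℤ.* j)     ≡⟨ cong fromℤ (sym (ℤ.neg-distribˡ-* (pos (suc m)) j)) ⟩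
      fromℤ (ℤ.- (pos (suc m) ℤ.* j))   ≡⟨ fromℤ-homo-neg (pos (suc m) ℤ.* j) ⟩
      - fromℤ (pos (suc m) ℤ.* j)       ≡⟨ cong -_ (fromℤ-homo-*⁺ (suc m) j) ⟩
      - (# (suc m) * fromℤ j)       ≡⟨ -‿distribˡ-* _ _ ⟩
      - # (suc m) * fromℤ j         ∎
      where open ≡-Reasoning

  module Solver where
    open import Algebra.Solver.Ring.AlmostCommutativeRing using (fromCommutativeRing; _-Raw-AlmostCommutative⟶_)

    fromℤ-morphism : CommutativeRing.rawRing ℤ.+-*-commutativeRing
                     -Raw-AlmostCommutative⟶ fromCommutativeRing commutativeRing
    fromℤ-morphism = record
      { ⟦_⟧    = fromℤ
      ; +-homo = fromℤ-homo-+
      ; *-homo = fromℤ-homo-*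
      ; -‿homo = fromℤ-homo-neg
      ; 0-homo = refl
      ; 1-homo = refl
      }

    fromℤ-≟ : ∀ i j → Maybe (fromℤ i ≡ fromℤ j)
    fromℤ-≟ i j with i ℤ.≟ j
    ... | yes i≡j = just (cong fromℤ i≡j)
    ... | no  _   = nothing

    open import Algebra.Solver.Ring
      (CommutativeRing.rawRing ℤ.+-*-commutativeRing) (fromCommutativeRing commutativeRing)
      fromℤ-morphism fromℤ-≟ public

    ⟨_⟩ : ∀ {m} → ℕ → Polynomial m
    ⟨ n ⟩ = con (pos n)

  open Solver public using (solve; _:+_; _:*_; _:-_; :-_; _:^_; _:=_; ⟨_⟩)

  -- The certificate format for most polynomial estimates below: d is a sum of products of
  -- quantities already known to be nonnegative, and the ring solver checks the identity.
  ≤-of-diff : ∀ {x y d} → 0# ≤ d → y ≡ d + x → x ≤ y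
  ≤-of-diff {x} {y} 0≤d y≡ =
    subst₂ _≤_ (+-identityˡ x) (sym y≡) (+-monoˡ-≤ x 0≤d)

  diff-nonneg : ∀ {x y} → x ≤ y → 0# ≤ y - x
  diff-nonneg {x} {y} x≤y = subst (_≤ y - x) (-‿inverseʳ x) (+-monoˡ-≤ (- x) x≤y)

  infixl 6 _⟨+⟩_
  infixl 7 _⟨*⟩_

  _⟨+⟩_ : ∀ {x y} → 0# ≤ x → 0# ≤ y → 0# ≤ x + y
  _⟨+⟩_ {x} {y} 0≤x 0≤y =
    ≤-trans 0≤y (subst (_≤ x + y) (+-identityˡ y) (+-monoˡ-≤ y 0≤x))

  +-mono-≤ : ∀ {x y u v} → x ≤ y → u ≤ v → x + u ≤ y + v
  +-mono-≤ {x} {y} {u} {v} x≤y u≤v =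
    ≤-of-diff (diff-nonneg x≤y ⟨+⟩ diff-nonneg u≤v)
      (solve 4 (λ x y u v → y :+ v := ((y :- x) :+ (v :- u)) :+ (x :+ u)) refl x y u v)

  _⟨*⟩_ : ∀ {x y} → 0# ≤ x → 0# ≤ y → 0# ≤ x * y
  _⟨*⟩_ = *-nonneg

  square-nonneg : ∀ x → 0# ≤ x * x
  square-nonneg x with total 0# x
  ... | inj₁ 0≤x = *-nonneg 0≤x 0≤x
  ... | inj₂ x≤0 = subst (0# ≤_) (solve 1 (λ x → (⟨ 0 ⟩ :- x) :* (⟨ 0 ⟩ :- x) := x :* x) refl x)
                     (*-nonneg (diff-nonneg x≤0) (diff-nonneg x≤0))

  #-nonneg : ∀ n → 0# ≤ # n
  #-nonneg zero    = ≤-refl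
  #-nonneg (suc n) = subst (0# ≤_) (sym (#-homo-+ 1 n))
    (subst (0# ≤_) (*-identityˡ 1#) (square-nonneg 1#) ⟨+⟩ #-nonneg n)

  -- In a total order this is 0 < x; in this form the `no` branch of `x ≤? 0#` is already a proof of
  -- it.
  Positive : Carrier → Set
  Positive x = ¬ x ≤ 0#

  positive⇒nonneg : ∀ {x} → Positive x → 0# ≤ x
  positive⇒nonneg {x} x>0 with total 0# x
  ... | inj₁ 0≤x = 0≤x
  ... | inj₂ x≤0 = ⊥-elim (x>0 x≤0)

  positive-≤ : ∀ {x y} → Positive x → x ≤ y → Positive y
  positive-≤ x>0 x≤y y≤0 = x>0 (≤-trans x≤y y≤0)

  #-positive : ∀ n → Positive (# (suc n))
  #-positive n = positive-≤ 1≰0 (≤-of-diff (#-nonneg n) (trans (#-homo-+ 1 n) (+-comm _ _)))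

  *-positive : ∀ {x y} → Positive x → Positive y → Positive (x * y)
  *-positive {x} {y} x>0 y>0 xy≤0 = y>0 (≤-reflexive y≡0)
    where
    xy≡0 : x * y ≡ 0#
    xy≡0 = antisym xy≤0 (*-nonneg (positive⇒nonneg x>0) (positive⇒nonneg y>0))
    x⁻¹ = inverse x (λ x≡0 → x>0 (≤-reflexive x≡0))
    y≡0 : y ≡ 0#
    y≡0 = begin
      y                       ≡⟨ sym (*-identityˡ y) ⟩
      1# * y                  ≡⟨ cong (_* y) (sym (proj₂ x⁻¹)) ⟩
      (x * proj₁ x⁻¹) * y     ≡⟨ solve 3 (λ x z y → (x :* z) :* y := z :* (x :* y)) refl x (proj₁ x⁻¹) y ⟩
      proj₁ x⁻¹ * (x * y)     ≡⟨ cong (proj₁ x⁻¹ *_) xy≡0 ⟩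
      proj₁ x⁻¹ * 0#          ≡⟨ zeroʳ _ ⟩
      0#                      ∎
      where open ≡-Reasoning

  *-monoˡ-≤ : ∀ {z x y} → 0# ≤ z → x ≤ y → z * x ≤ z * y
  *-monoˡ-≤ {z} {x} {y} 0≤z x≤y = ≤-of-diff (*-nonneg 0≤z (diff-nonneg x≤y))
    (solve 3 (λ z x y → z :* y := z :* (y :- x) :+ z :* x) refl z x y)

  *-mono-≤ : ∀ {x y u v} → 0# ≤ x → 0# ≤ v → x ≤ y → u ≤ v → x * u ≤ y * v
  *-mono-≤ {x} {y} {u} {v} 0≤x 0≤v x≤y u≤v =
    ≤-trans (*-monoˡ-≤ 0≤x u≤v) (subst₂ _≤_ (*-comm v x) (*-comm v y) (*-monoˡ-≤ 0≤v x≤y))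

  <⇒diff-positive : ∀ {x y} → ¬ y ≤ x → Positive (y - x)
  <⇒diff-positive {x} {y} x<y d≤0 =
    x<y (≤-of-diff (diff-nonneg d≤0)
      (solve 2 (λ x y → x := (⟨ 0 ⟩ :- (y :- x)) :+ y) refl x y))

  *-cancelˡ-≤ : ∀ {z x y} → Positive z → z * x ≤ z * y → x ≤ y
  *-cancelˡ-≤ {z} {x} {y} z>0 zx≤zy with x ≤? y
  ... | yes x≤y = x≤y
  ... | no  x≰y = ⊥-elim (*-positive z>0 (<⇒diff-positive x≰y)
                    (≤-of-diff (diff-nonneg zx≤zy)
                      (solve 3 (λ z x y → ⟨ 0 ⟩ := (z :* y :- z :* x) :+ z :* (x :- y)) refl z x y)))

  ≰⇒≥ : ∀ {x y} → ¬ x ≤ y → y ≤ x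
  ≰⇒≥ {x} {y} x≰y with total x y
  ... | inj₁ x≤y = ⊥-elim (x≰y x≤y)
  ... | inj₂ y≤x = y≤x

  +-positiveˡ : ∀ {x y} → Positive x → 0# ≤ y → Positive (x + y)
  +-positiveˡ {x} {y} x>0 0≤y = positive-≤ x>0 (≤-of-diff 0≤y (+-comm x y))

  ^-nonneg : ∀ {x} n → 0# ≤ x → 0# ≤ x ^ n
  ^-nonneg zero    0≤x = #-nonneg 1
  ^-nonneg (suc n) 0≤x = *-nonneg 0≤x (^-nonneg n 0≤x)

  ^-positive : ∀ {x} n → Positive x → Positive (x ^ n)
  ^-positive zero    x>0 = 1≰0
  ^-positive (suc n) x>0 = *-positive x>0 (^-positive n x>0)

  ^-mono-≤ : ∀ {x y} n → 0# ≤ x → x ≤ y → x ^ n ≤ y ^ n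
  ^-mono-≤ zero    0≤x x≤y = ≤-refl
  ^-mono-≤ (suc n) 0≤x x≤y =
    *-mono-≤ 0≤x (^-nonneg n (≤-trans 0≤x x≤y)) x≤y (^-mono-≤ n 0≤x x≤y)

  -- Takes the place of root extraction: if x > y ≥ 0, then x is positive and its power is strictly
  -- larger than that of y.
  ^-cancel-≤ : ∀ {x y} n → 0# ≤ y → x ^ suc n ≤ y ^ suc n → x ≤ y
  ^-cancel-≤ {x} {y} n 0≤y xⁿ≤yⁿ with x ≤? y
  ... | yes x≤y = x≤y
  ... | no  x≰y = ⊥-elim (+-positiveˡ gap>0 (*-nonneg 0≤y (diff-nonneg (^-mono-≤ n 0≤y (≰⇒≥ x≰y))))
    (≤-of-diff (diff-nonneg xⁿ≤yⁿ)
      (solve 4 (λ x y a b → ⟨ 0 ⟩ := (y :* b :- x :* a) :+ ((x :- y) :* a :+ y :* (a :- b)))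
        refl x y (x ^ n) (y ^ n))))
    where
    x>0 : Positive x
    x>0 x≤0 = x≰y (≤-trans x≤0 0≤y)
    gap>0 : Positive ((x - y) * x ^ n)
    gap>0 = *-positive (<⇒diff-positive x≰y) (^-positive n x>0)

-- Stability of Young's inequality on ℤ/2.

module KeyInequality (F : OrderedField) where

  open OrderedFieldProperties F

  ∏ : (Fin 4 → Carrier) → Carrier
  ∏ f = f zero * f (suc zero) * f (suc (suc zero)) * f (suc (suc (suc zero)))

  -- p³ · (1 + w (1/p − 1)), an upper bound for p^(3 − w) when 1/w is an integer.
  weight : Carrier → Carrier → Carrier
  weight w p = p * p * (p + (1# - p) * w)

  bias² : Carrier → Carrier
  bias² p = (p - (1# - p)) * (p - (1# - p))

  -- u and v play the role of p^((3 - w)/4) and (1 - p)^((3 - w)/4). Exact fourth roots need not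
  -- exist in the field, hence the tolerance w².
  record ApproxRoots (w p u v : Carrier) : Set where
    field
      p≥0 : 0# ≤ p
      q≥0 : 0# ≤ 1# - p
      u≥0 : 0# ≤ u
      v≥0 : 0# ≤ v
      u-lower : weight w p ≤ u ^ 4
      v-lower : weight w (1# - p) ≤ v ^ 4
      u-upper : u ^ 4 ≤ weight w p + w * w
      v-upper : v ^ 4 ≤ weight w (1# - p) + w * w

  -- With 40000 w ≤ 1 the possible values of (u + v)² for p close to 1/2 and for p close to 0 or 1 stay apart.
  module OneVariable {w p u v : Carrier} (w≥0 : 0# ≤ w) (w-small : # 40000 * w ≤ 1#)
                     (approx : ApproxRoots w p u v) where

    open ApproxRoots approx

    q x s² : Carrier
    q = 1# - p
    x = p * q
    s² = (u + v) * (u + v)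

    x≥0 : 0# ≤ x
    x≥0 = p≥0 ⟨*⟩ q≥0

    w≤1 : 0# ≤ 1# - w
    w≤1 = diff-nonneg (≤-of-diff (diff-nonneg w-small ⟨+⟩ #-nonneg 39999 ⟨*⟩ w≥0)
      (solve 1 (λ w → ⟨ 1 ⟩ := ((⟨ 1 ⟩ :- ⟨ 40000 ⟩ :* w) :+ ⟨ 39999 ⟩ :* w) :+ w) refl w))

    bias²≡ : 1# - bias² p ≡ # 4 * x
    bias²≡ = solve 1 (λ p → ⟨ 1 ⟩ :- (p :- (⟨ 1 ⟩ :- p)) :* (p :- (⟨ 1 ⟩ :- p)) := ⟨ 4 ⟩
        :* (p :* (⟨ 1 ⟩ :- p))) refl p

    4x≤1 : 0# ≤ 1# - # 4 * x
    4x≤1 = subst (0# ≤_) (solve 1 (λ p → (p :- (⟨ 1 ⟩ :- p)) :* (p :- (⟨ 1 ⟩ :- p)) := ⟨ 1 ⟩ :- ⟨ 4 ⟩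
        :* (p :* (⟨ 1 ⟩ :- p))) refl p)
           (square-nonneg (p - q))

    weight-sum : weight w p + weight w q ≡ 1# - # 3 * x + x * w
    weight-sum = solve 2 (λ p w → let q = ⟨ 1 ⟩ :- p in
        p :* p :* (p :+ q :* w) :+ q :* q :* (q :+ (⟨ 1 ⟩ :- q) :* w)
        := ⟨ 1 ⟩ :- ⟨ 3 ⟩ :* (p :* q) :+ (p :* q) :* w) refl p w

    weight-product : weight w p * weight w q ≡ x * x * (x * ((1# - w) * (1# - w)) + w)
    weight-product = solve 2 (λ p w → let q = ⟨ 1 ⟩ :- p ; x = p :* q in
        p :* p :* (p :+ q :* w) :* (q :* q :* (q :+ (⟨ 1 ⟩ :- q) :* w))
        := x :* x :* (x :* ((⟨ 1 ⟩ :- w) :* (⟨ 1 ⟩ :- w)) :+ w)) refl p w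

    -- 4B bounds 4 √((weight w p + w²)(weight w q + w²)): under the root, √(x + w) is at most x + w + 1/4.
    4B : Carrier
    4B = x * (# 4 * x + # 4 * w + 1#) + # 8 * w

    4B≥0 : 0# ≤ 4B
    4B≥0 = x≥0 ⟨*⟩ (#-nonneg 4 ⟨*⟩ x≥0 ⟨+⟩ #-nonneg 4 ⟨*⟩ w≥0 ⟨+⟩ #-nonneg 1) ⟨+⟩ #-nonneg 8 ⟨*⟩ w≥0

    weight≥0 : ∀ {p} → 0# ≤ p → 0# ≤ 1# - p → 0# ≤ weight w p
    weight≥0 p≥0 q≥0 = p≥0 ⟨*⟩ p≥0 ⟨*⟩ (p≥0 ⟨+⟩ q≥0 ⟨*⟩ w≥0)

    cross-term : # 4 * (u * u * (v * v)) ≤ 4B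
    cross-term = ^-cancel-≤ 1 4B≥0 (≤-trans (subst (_≤ # 16 * ((weight w p + w * w) * (weight w q + w * w)))
        (solve 2 (λ u v → ⟨ 16 ⟩ :* (u :^ 4 :* v :^ 4) := (⟨ 4 ⟩ :* (u :* u :* (v :* v))) :^ 2) refl u v)
        (*-monoˡ-≤ (#-nonneg 16)
          (*-mono-≤ (^-nonneg 4 u≥0)
            (≤-trans (^-nonneg 4 v≥0) v-upper) u-upper v-upper)))
      (subst (_≤ 4B ^ 2) (sym expand)
        (≤-of-diff (x≥0 ⟨*⟩ x≥0 ⟨*⟩ (square-nonneg (# 4 * x + # 4 * w - 1#) ⟨+⟩ #-nonneg 16 ⟨*⟩ x≥0 ⟨*⟩ w≥0
            ⟨*⟩ (w≤1 ⟨+⟩ #-nonneg 1))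
            ⟨+⟩ #-nonneg 16 ⟨*⟩ w≥0 ⟨*⟩ x≥0 ⟨*⟩ (#-nonneg 4 ⟨*⟩ x≥0 ⟨+⟩ #-nonneg 4 ⟨*⟩ w≥0 ⟨+⟩ #-nonneg 1)
            ⟨+⟩ #-nonneg 16 ⟨*⟩ (w≥0 ⟨*⟩ w≥0) ⟨*⟩ (w≤1 ⟨*⟩ (#-nonneg 1 ⟨+⟩ w≥0) ⟨+⟩ #-nonneg 2 ⟨+⟩ x≥0 ⟨*⟩ w≤1
                ⟨+⟩ #-nonneg 2 ⟨*⟩ x≥0))
          (solve 2 (λ x w → let c = ⟨ 1 ⟩ :- w ; l = ⟨ 4 ⟩ :* x :+ ⟨ 4 ⟩ :* w in
             (x :* (l :+ ⟨ 1 ⟩) :+ ⟨ 8 ⟩ :* w) :^ 2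
             := (x :* x :* ((l :- ⟨ 1 ⟩) :* (l :- ⟨ 1 ⟩) :+ ⟨ 16 ⟩ :* x :* w :* (c :+ ⟨ 1 ⟩))
                :+ ⟨ 16 ⟩ :* w :* x :* (l :+ ⟨ 1 ⟩)
                :+ ⟨ 16 ⟩ :* (w :* w) :* (c :* (⟨ 1 ⟩ :+ w) :+ ⟨ 2 ⟩ :+ x :* c :+ ⟨ 2 ⟩ :* x))
                :+ ⟨ 16 ⟩ :* (x :* x :* (x :* (c :* c) :+ w) :+ w :* w :* (⟨ 1 ⟩ :- ⟨ 3 ⟩ :* x :+ x :* w) :+ w
                    :* w :* (w :* w)))
             refl x w))))
      where
      expand : # 16 * ((weight w p + w * w) * (weight w q + w * w))
               ≡ # 16 * (x * x * (x * ((1# - w) * (1# - w)) + w) + w * w * (1# - # 3 * x + x * w) + w * w * (w * w))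
      expand = trans
        (solve 3 (λ P Q W → ⟨ 16 ⟩ :* ((P :+ W) :* (Q :+ W)) := ⟨ 16 ⟩ :* (P :* Q :+ W :* (P :+ Q) :+ W :* W)) refl
          (weight w p) (weight w q) (w * w))
        (cong₂ (λ y z → # 16 * (y + w * w * z + w * w * (w * w))) weight-product weight-sum)

    g : Carrier
    g = u ^ 4 + # 6 * (u * u * (v * v)) + v ^ 4

    fourth-powers : u ^ 4 + v ^ 4 ≤ 1# - # 3 * x + x * w + # 2 * (w * w)
    fourth-powers = subst (u ^ 4 + v ^ 4 ≤_)
      (trans (solve 3 (λ P Q W → P :+ W :+ (Q :+ W) := P :+ Q :+ ⟨ 2 ⟩ :* W) refl (weight w p) (weight w q) (w * w))
             (cong (_+ # 2 * (w * w)) weight-sum))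
      (+-mono-≤ u-upper v-upper)

    -- Here 2g = (u + v)⁴ + (u - v)⁴. For w = 0 and exact roots, 2 - 2g is 6x(1 - 2√x), which is at
    -- least 3x(1 - 4x) because 1 + 2√x ≤ 2. The term 32 w absorbs the perturbed exponent and the
    -- inexact roots, using x ≤ 1/4 and w ≤ 1.
    g-bound : # 2 * g + # 3 * x * (1# - # 4 * x) ≤ # 2 + # 32 * w
    g-bound = ≤-of-diff
      (#-nonneg 2 ⟨*⟩ diff-nonneg fourth-powers ⟨+⟩ #-nonneg 3 ⟨*⟩ diff-nonneg cross-term
        ⟨+⟩ #-nonneg 4 ⟨*⟩ w≥0 ⟨*⟩ 4x≤1 ⟨+⟩ #-nonneg 2 ⟨*⟩ x≥0 ⟨*⟩ w≥0 ⟨+⟩ #-nonneg 4 ⟨*⟩ w≥0 ⟨*⟩ w≤1)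
      (solve 5 (λ x w a b m →
          ⟨ 2 ⟩ :+ ⟨ 32 ⟩ :* w :=
          (⟨ 2 ⟩ :* (⟨ 1 ⟩ :- ⟨ 3 ⟩ :* x :+ x :* w :+ ⟨ 2 ⟩ :* (w :* w) :- (a :+ b))
           :+ ⟨ 3 ⟩ :* (x :* (⟨ 4 ⟩ :* x :+ ⟨ 4 ⟩ :* w :+ ⟨ 1 ⟩) :+ ⟨ 8 ⟩ :* w :- ⟨ 4 ⟩ :* m)
           :+ ⟨ 4 ⟩ :* w :* (⟨ 1 ⟩ :- ⟨ 4 ⟩ :* x) :+ ⟨ 2 ⟩ :* x :* w :+ ⟨ 4 ⟩ :* w :* (⟨ 1 ⟩ :- w))
          :+ (⟨ 2 ⟩ :* (a :+ ⟨ 6 ⟩ :* m :+ b) :+ ⟨ 3 ⟩ :* x :* (⟨ 1 ⟩ :- ⟨ 4 ⟩ :* x)))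
        refl x w (u ^ 4) (v ^ 4) (u * u * (v * v)))

    -- Since (u + v)² ≥ 4uv and (uv)⁴ ≥ x³, it is enough that 81 x³ ≥ 1, and this holds for x ≥
    -- 15/64. At p = 1/2 the ideal value of uv for w = 0 is 8^(-1/2) > 1/3.
    s²-lower : # 16 * bias² p ≤ # 1 → # 4 ≤ # 3 * s²
    s²-lower small = ≤-of-diff
      (#-nonneg 4 ⟨*⟩ diff-nonneg 3uv≥1 ⟨+⟩ #-nonneg 3 ⟨*⟩ square-nonneg (u - v))
      (solve 2 (λ u v → ⟨ 3 ⟩ :* ((u :+ v) :* (u :+ v)) :=
          (⟨ 4 ⟩ :* (⟨ 3 ⟩ :* (u :* v) :- ⟨ 1 ⟩) :+ ⟨ 3 ⟩ :* ((u :- v) :* (u :- v))) :+ ⟨ 4 ⟩) refl u v)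
      where
      x-lower : # 15 ≤ # 64 * x
      x-lower = ≤-of-diff (diff-nonneg small)
        (solve 1 (λ p → let q = ⟨ 1 ⟩ :- p in ⟨ 64 ⟩ :* (p :* q) := (⟨ 1 ⟩ :- ⟨ 16 ⟩ :* ((p :- q) :* (p :- q))) :+ ⟨ 15 ⟩) refl p)
      y : Carrier
      y = # 64 * x - # 15
      y≥0 = diff-nonneg x-lower
      product-lower : x * x * x ≤ u ^ 4 * v ^ 4
      product-lower = ≤-trans
        (subst (x * x * x ≤_) (sym weight-product)
          (≤-of-diff (x≥0 ⟨*⟩ x≥0 ⟨*⟩ (w≥0 ⟨*⟩ (4x≤1 ⟨+⟩ #-nonneg 2 ⟨*⟩ x≥0 ⟨+⟩ x≥0 ⟨*⟩ w≥0)))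
            (solve 2 (λ x w → let c = ⟨ 1 ⟩ :- w in x :* x :* (x :* (c :* c) :+ w)
               := x :* x :* (w :* (⟨ 1 ⟩ :- ⟨ 4 ⟩ :* x :+ ⟨ 2 ⟩ :* x :+ x :* w)) :+ x :* x :* x) refl x w)))
        (*-mono-≤ (weight≥0 p≥0 q≥0) (^-nonneg 4 v≥0) u-lower v-lower)
      3uv≥1 : 1# ≤ # 3 * (u * v)
      -- Everything is scaled by 64³ = 262144. With y = 64x - 15 the surplus is 81 · 15³ - 64³ =
      -- 11231, and 21233664 = 81 · 64³.
      3uv≥1 = ^-cancel-≤ 3 (#-nonneg 3 ⟨*⟩ (u≥0 ⟨*⟩ v≥0))
        (*-cancelˡ-≤ (#-positive 262143)
          (≤-of-diff (#-nonneg 11231 ⟨+⟩ #-nonneg 81 ⟨*⟩ (y≥0 ⟨*⟩ y≥0 ⟨*⟩ y≥0 ⟨+⟩ #-nonneg 45 ⟨*⟩ (y≥0 ⟨*⟩ y≥0)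
              ⟨+⟩ #-nonneg 675 ⟨*⟩ y≥0)
              ⟨+⟩ #-nonneg 21233664 ⟨*⟩ diff-nonneg product-lower)
            (solve 3 (λ x u v → let y = ⟨ 64 ⟩ :* x :- ⟨ 15 ⟩ in
              ⟨ 262144 ⟩ :* ((⟨ 3 ⟩ :* (u :* v)) :^ 4) :=
              (⟨ 11231 ⟩ :+ ⟨ 81 ⟩ :* (y :* y :* y :+ ⟨ 45 ⟩ :* (y :* y) :+ ⟨ 675 ⟩ :* y)
               :+ ⟨ 21233664 ⟩ :* (u :^ 4 :* v :^ 4 :- x :* x :* x)) :+ ⟨ 262144 ⟩ :* (⟨ 1 ⟩ :^ 4)) refl x u v)))

    -- Near p = 0 or p = 1 one root is small: u² + v² ≤ 1.01 and uv ≤ 1/20 give (u + v)² ≤ 1.11,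
    -- well below the 4/3 of `s²-lower`.
    s²-upper : # 3 * (1# - bias² p) ≤ # 1024 * w → # 100 * s² ≤ # 111
    s²-upper large = ≤-of-diff
      (diff-nonneg squares-upper ⟨+⟩ #-nonneg 10 ⟨*⟩ diff-nonneg 20uv≤1)
      (solve 2 (λ u v → ⟨ 111 ⟩ :=
        (⟨ 101 ⟩ :- ⟨ 100 ⟩ :* (u :* u :+ v :* v) :+ ⟨ 10 ⟩ :* (⟨ 1 ⟩ :- ⟨ 20 ⟩ :* (u :* v))) :+ ⟨ 100 ⟩
            :* ((u :+ v) :* (u :+ v))) refl u v)
      where
      x-upper : 0# ≤ # 256 * w - # 3 * x
      x-upper = diff-nonneg (*-cancelˡ-≤ (#-positive 3) (subst₂ _≤_
        (trans (cong (# 3 *_) bias²≡) (solve 1 (λ x → ⟨ 3 ⟩ :* (⟨ 4 ⟩ :* x) := ⟨ 4 ⟩ :* (⟨ 3 ⟩ :* x)) refl x))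
        (solve 1 (λ w → ⟨ 1024 ⟩ :* w := ⟨ 4 ⟩ :* (⟨ 256 ⟩ :* w)) refl w) large))
      4w≤1 : 0# ≤ 1# - # 4 * w
      4w≤1 = subst (0# ≤_) (solve 1 (λ w → (⟨ 1 ⟩ :- ⟨ 40000 ⟩ :* w) :+ ⟨ 39996 ⟩ :* w := ⟨ 1 ⟩ :- ⟨ 4 ⟩ :* w) refl w)
        (diff-nonneg w-small ⟨+⟩ #-nonneg 39996 ⟨*⟩ w≥0)
      uv-upper : u * u * (v * v) ≤ # 66 * w
      uv-upper = *-cancelˡ-≤ (#-positive 3) (≤-of-diff
        (diff-nonneg cross-term ⟨+⟩ x-upper ⟨+⟩ x≥0 ⟨*⟩ 4x≤1 ⟨+⟩ x≥0 ⟨*⟩ 4w≤1)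
        (solve 3 (λ x w m → ⟨ 4 ⟩ :* (⟨ 66 ⟩ :* w) :=
           (x :* (⟨ 4 ⟩ :* x :+ ⟨ 4 ⟩ :* w :+ ⟨ 1 ⟩) :+ ⟨ 8 ⟩ :* w :- ⟨ 4 ⟩ :* m
            :+ (⟨ 256 ⟩ :* w :- ⟨ 3 ⟩ :* x) :+ x :* (⟨ 1 ⟩ :- ⟨ 4 ⟩ :* x)
            :+ x :* (⟨ 1 ⟩ :- ⟨ 4 ⟩ :* w)) :+ ⟨ 4 ⟩ :* m) refl x w (u * u * (v * v))))
      -- From u²v² ≤ 66 w this asks for 400 · 66 w = 26400 w ≤ 1, the tightest demand that these
      -- estimates make on w.
      20uv≤1 : # 20 * (u * v) ≤ 1#
      20uv≤1 = ^-cancel-≤ 1 (#-nonneg 1) (≤-of-diff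
        (#-nonneg 400 ⟨*⟩ diff-nonneg uv-upper ⟨+⟩ diff-nonneg w-small ⟨+⟩ #-nonneg 13600 ⟨*⟩ w≥0)
        (solve 3 (λ u v w → ⟨ 1 ⟩ :^ 2 := (⟨ 400 ⟩ :* (⟨ 66 ⟩ :* w :- u :* u :* (v :* v))
            :+ (⟨ 1 ⟩ :- ⟨ 40000 ⟩ :* w) :+ ⟨ 13600 ⟩ :* w) :+ (⟨ 20 ⟩ :* (u :* v)) :^ 2) refl u v w))
      squares-upper : # 100 * (u * u + v * v) ≤ # 101
      squares-upper = ^-cancel-≤ 1 (#-nonneg 101) (≤-of-diff
        (#-nonneg 10000 ⟨*⟩ diff-nonneg fourth-powers ⟨+⟩ #-nonneg 20000 ⟨*⟩ diff-nonneg uv-upper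
          ⟨+⟩ #-nonneg 201 ⟨*⟩ diff-nonneg w-small ⟨+⟩ #-nonneg 20000 ⟨*⟩ (w≥0 ⟨*⟩ w≤1)
          ⟨+⟩ #-nonneg 10000 ⟨*⟩ (x≥0 ⟨*⟩ (#-nonneg 2 ⟨+⟩ w≤1)) ⟨+⟩ #-nonneg 6700000 ⟨*⟩ w≥0)
        (solve 4 (λ u v x w → ⟨ 101 ⟩ :^ 2 :=
          (⟨ 10000 ⟩ :* (⟨ 1 ⟩ :- ⟨ 3 ⟩ :* x :+ x :* w :+ ⟨ 2 ⟩ :* (w :* w) :- (u :^ 4 :+ v :^ 4))
           :+ ⟨ 20000 ⟩ :* (⟨ 66 ⟩ :* w :- u :* u :* (v :* v))
           :+ ⟨ 201 ⟩ :* (⟨ 1 ⟩ :- ⟨ 40000 ⟩ :* w) :+ ⟨ 20000 ⟩ :* (w :* (⟨ 1 ⟩ :- w))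
           :+ ⟨ 10000 ⟩ :* (x :* (⟨ 2 ⟩ :+ (⟨ 1 ⟩ :- w))) :+ ⟨ 6700000 ⟩ :* w)
          :+ (⟨ 100 ⟩ :* (u :* u :+ v :* v)) :^ 2) refl u v x w))

  sumBool : (Bool → Carrier) → Carrier
  sumBool g = g false + g true

  evenChoice : Bool → Bool → Bool → Fin 4 → Bool
  evenChoice b₁ b₂ b₃ zero                   = b₁
  evenChoice b₁ b₂ b₃ (suc zero)             = b₂
  evenChoice b₁ b₂ b₃ (suc (suc zero))       = b₃
  evenChoice b₁ b₂ b₃ (suc (suc (suc zero))) = b₁ xor b₂ xor b₃

  evenSum : (Fin 4 → Bool → Carrier) → Carrier
  evenSum r = sumBool λ b₁ → sumBool λ b₂ → sumBool λ b₃ → ∏ (λ i → r i (evenChoice b₁ b₂ b₃ i))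

  -- Fourier inversion on ℤ/2: the indicator of even parity is half of 1 plus the sign of the
  -- parity, and both terms factor over the four coordinates.
  evenSum-splits : ∀ r → # 2 * evenSum r ≡ ∏ (λ i → r i false + r i true) + ∏ (λ i → r i false - r i true)
  evenSum-splits r = begin
    # 2 * evenSum r
      ≡⟨ cong (# 2 *_) (cong₂ _+_ (cong₂ _+_ (factor (a * b)) (factor (a * b′)))
          (cong₂ _+_ (factor (a′ * b)) (factor (a′ * b′)))) ⟩
    # 2 * ((a * b * even + a * b′ * odd) + (a′ * b * odd + a′ * b′ * even))
      ≡⟨ solve 6 (λ a a′ b b′ e o → ⟨ 2 ⟩ :* ((a :* b :* e :+ a :* b′ :* o) :+ (a′ :* b :* o :+ a′ :* b′ :* e))
           := (a :+ a′) :* (b :+ b′) :* (e :+ o) :+ (a :- a′) :* (b :- b′) :* (e :- o)) refl a a′ b b′ even odd ⟩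
    (a + a′) * (b + b′) * (even + odd) + (a - a′) * (b - b′) * (even - odd)
      ≡⟨ cong₂ (λ y z → (a + a′) * (b + b′) * y + (a - a′) * (b - b′) * z)
           (solve 4 (λ c c′ d d′ → (c :* d :+ c′ :* d′) :+ (c :* d′ :+ c′ :* d) := (c :+ c′) :* (d :+ d′))
               refl c c′ d d′)
           (solve 4 (λ c c′ d d′ → (c :* d :+ c′ :* d′) :- (c :* d′ :+ c′ :* d) := (c :- c′) :* (d :- d′))
               refl c c′ d d′) ⟩
    (a + a′) * (b + b′) * ((c + c′) * (d + d′)) + (a - a′) * (b - b′) * ((c - c′) * (d - d′))
      ≡⟨ cong₂ _+_ (sym (*-assoc _ _ _)) (sym (*-assoc _ _ _)) ⟩
    ∏ (λ i → r i false + r i true) + ∏ (λ i → r i false - r i true) ∎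
    where
    open ≡-Reasoning
    a = r zero false
    a′ = r zero true
    b = r (suc zero) false
    b′ = r (suc zero) true
    c = r (suc (suc zero)) false
    c′ = r (suc (suc zero)) true
    d = r (suc (suc (suc zero))) false
    d′ = r (suc (suc (suc zero))) true
    even = c * d + c′ * d′
    odd = c * d′ + c′ * d
    factor : ∀ x {c c′ d d′} → x * c * d + x * c′ * d′ ≡ x * (c * d + c′ * d′)
    factor x = solve 5 (λ x c c′ d d′ → x :* c :* d :+ x :* c′ :* d′ := x :* (c :* d :+ c′ :* d′)) refl x _ _ _ _

  ∑ : (Fin 4 → Carrier) → Carrier
  ∑ f = f zero + f (suc zero) + f (suc (suc zero)) + f (suc (suc (suc zero)))

  ∑-mono : ∀ {f g} → (∀ i → f i ≤ g i) → ∑ f ≤ ∑ g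
  ∑-mono f≤g = +-mono-≤ (+-mono-≤ (+-mono-≤ (f≤g _) (f≤g _)) (f≤g _)) (f≤g _)

  ∑-+ : ∀ f g → ∑ (λ i → f i + g i) ≡ ∑ f + ∑ g
  ∑-+ f g = solve 8 (λ a b c d a′ b′ c′ d′ →
      (a :+ a′) :+ (b :+ b′) :+ (c :+ c′) :+ (d :+ d′) := (a :+ b :+ c :+ d) :+ (a′ :+ b′ :+ c′ :+ d′)) refl
      (f zero) (f (suc zero)) (f (suc (suc zero))) (f (suc (suc (suc zero))))
      (g zero) (g (suc zero)) (g (suc (suc zero))) (g (suc (suc (suc zero))))

  term≤∑ : ∀ {f} → (∀ i → 0# ≤ f i) → ∀ i → f i ≤ ∑ f
  term≤∑ {f} f≥0 i = ≤-of-diff (rest≥0 i) (rest≡ i)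
    where
    a = f zero
    b = f (suc zero)
    c = f (suc (suc zero))
    d = f (suc (suc (suc zero)))
    rest : Fin 4 → Carrier
    rest zero                   = b + c + d
    rest (suc zero)             = a + c + d
    rest (suc (suc zero))       = a + b + d
    rest (suc (suc (suc zero))) = a + b + c
    rest≥0 : ∀ i → 0# ≤ rest i
    rest≥0 zero                   = f≥0 _ ⟨+⟩ f≥0 _ ⟨+⟩ f≥0 _
    rest≥0 (suc zero)             = f≥0 _ ⟨+⟩ f≥0 _ ⟨+⟩ f≥0 _
    rest≥0 (suc (suc zero))       = f≥0 _ ⟨+⟩ f≥0 _ ⟨+⟩ f≥0 _
    rest≥0 (suc (suc (suc zero))) = f≥0 _ ⟨+⟩ f≥0 _ ⟨+⟩ f≥0 _
    rest≡ : ∀ i → ∑ f ≡ rest i + f i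
    rest≡ zero                   = solve 4 (λ a b c d → a :+ b :+ c :+ d := (b :+ c :+ d) :+ a) refl a b c d
    rest≡ (suc zero)             = solve 4 (λ a b c d → a :+ b :+ c :+ d := (a :+ c :+ d) :+ b) refl a b c d
    rest≡ (suc (suc zero))       = solve 4 (λ a b c d → a :+ b :+ c :+ d := (a :+ b :+ d) :+ c) refl a b c d
    rest≡ (suc (suc (suc zero))) = refl

  gap : Carrier → Carrier → Carrier
  gap a b = (a * a - b * b) * (a * a - b * b)

  -- The remaining difference is (c² - d²)² + 2(ab - cd)². The square retained on the left measures
  -- how far a and b are from the equality case.
  AM-GM-with-gap : ∀ a b c d → # 4 * (a * b * c * d) + gap a b ≤ a ^ 4 + b ^ 4 + c ^ 4 + d ^ 4
  AM-GM-with-gap a b c d = ≤-of-diff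
    (square-nonneg (c * c - d * d) ⟨+⟩ #-nonneg 2 ⟨*⟩ square-nonneg (a * b - c * d))
    (solve 4 (λ a b c d → a :^ 4 :+ b :^ 4 :+ c :^ 4 :+ d :^ 4 :=
       ((c :* c :- d :* d) :* (c :* c :- d :* d) :+ ⟨ 2 ⟩ :* ((a :* b :- c :* d) :* (a :* b :- c :* d)))
       :+ (⟨ 4 ⟩ :* (a :* b :* c :* d) :+ (a :* a :- b :* b) :* (a :* a :- b :* b))) refl a b c d)

  ∏-AM-GM-with-gap : ∀ f j → # 4 * ∏ f + gap (f zero) (f j) ≤ ∑ (λ i → f i ^ 4)
  ∏-AM-GM-with-gap f zero = ≤-of-diff (diff-nonneg (AM-GM-with-gap a b c d) ⟨+⟩ square-nonneg (a * a - b * b))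
    (solve 4 (λ A P s g → s := (s :- (⟨ 4 ⟩ :* P :+ g) :+ g) :+ (⟨ 4 ⟩ :* P :+ (A :- A) :* (A :- A)))
      refl (a * a) (∏ f) (∑ (λ i → f i ^ 4)) (gap a b))
    where
    a = f zero
    b = f (suc zero)
    c = f (suc (suc zero))
    d = f (suc (suc (suc zero)))
  ∏-AM-GM-with-gap f (suc zero) = AM-GM-with-gap _ _ _ _
  ∏-AM-GM-with-gap f (suc (suc zero)) = subst₂ _≤_
    (cong (λ z → # 4 * z + gap a c) (solve 4 (λ a b c d → a :* c :* b :* d := a :* b :* c :* d) refl a b c d))
    (solve 4 (λ a b c d → a :+ c :+ b :+ d := a :+ b :+ c :+ d) refl (a ^ 4) (b ^ 4) (c ^ 4) (d ^ 4))
    (AM-GM-with-gap a c b d)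
    where
    a = f zero
    b = f (suc zero)
    c = f (suc (suc zero))
    d = f (suc (suc (suc zero)))
  ∏-AM-GM-with-gap f (suc (suc (suc zero))) = subst₂ _≤_
    (cong (λ z → # 4 * z + gap a d) (solve 4 (λ a b c d → a :* d :* c :* b := a :* b :* c :* d) refl a b c d))
    (solve 4 (λ a b c d → a :+ d :+ c :+ b := a :+ b :+ c :+ d) refl (a ^ 4) (b ^ 4) (c ^ 4) (d ^ 4))
    (AM-GM-with-gap a d c b)
    where
    a = f zero
    b = f (suc zero)
    c = f (suc (suc zero))
    d = f (suc (suc (suc zero)))

  -- The larger of τ and 1 - τ is at least 1/2, so the other one is at most twice the bound on the
  -- product.
  near-0-or-near-1 : ∀ {w} τ → # 3 * (1# - τ) * τ ≤ # 512 * w → 0# ≤ τ → 0# ≤ 1# - τ →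
                 # 3 * τ ≤ # 1024 * w ⊎ # 3 * (1# - τ) ≤ # 1024 * w
  near-0-or-near-1 {w} τ bound τ≥0 τ≤1 with total τ (1# - τ)
  ... | inj₁ τ≤1-τ = inj₁ (≤-of-diff
          (#-nonneg 2 ⟨*⟩ diff-nonneg bound ⟨+⟩ #-nonneg 3 ⟨*⟩ τ≥0 ⟨*⟩ diff-nonneg τ≤1-τ)
          (solve 2 (λ τ w → ⟨ 1024 ⟩ :* w := (⟨ 2 ⟩ :* (⟨ 512 ⟩ :* w :- ⟨ 3 ⟩ :* (⟨ 1 ⟩ :- τ) :* τ)
             :+ ⟨ 3 ⟩ :* τ :* (⟨ 1 ⟩ :- τ :- τ)) :+ ⟨ 3 ⟩ :* τ) refl τ w))
  ... | inj₂ 1-τ≤τ = inj₂ (≤-of-diff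
          (#-nonneg 2 ⟨*⟩ diff-nonneg bound ⟨+⟩ #-nonneg 3 ⟨*⟩ τ≤1 ⟨*⟩ diff-nonneg 1-τ≤τ)
          (solve 2 (λ τ w → ⟨ 1024 ⟩ :* w := (⟨ 2 ⟩ :* (⟨ 512 ⟩ :* w :- ⟨ 3 ⟩ :* (⟨ 1 ⟩ :- τ) :* τ)
             :+ ⟨ 3 ⟩ :* (⟨ 1 ⟩ :- τ) :* (τ :- (⟨ 1 ⟩ :- τ))) :+ ⟨ 3 ⟩ :* (⟨ 1 ⟩ :- τ)) refl τ w))

  -- The two AM-GM inequalities consume 4(a + b) ≥ 8 of the available 8 + 128 w, so the gap g and
  -- the losses L have to fit into 128 w.
  gap-budget : ∀ {w a b g h A B L} → # 2 * 1# ≤ a + b → # 4 * a + g ≤ A → # 4 * b + h ≤ B → 0# ≤ h →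
            A + B + L ≤ # 8 + # 128 * w → g + L ≤ # 128 * w
  gap-budget {w} {a} {b} {g} {h} {A} {B} {L} 2≤a+b h₁ h₂ h≥0 h₃ = ≤-of-diff
    (#-nonneg 4 ⟨*⟩ diff-nonneg 2≤a+b ⟨+⟩ diff-nonneg (+-mono-≤ h₁ h₂) ⟨+⟩ h≥0 ⟨+⟩ diff-nonneg h₃)
    (solve 8 (λ w a b g h A B L →
        ⟨ 128 ⟩ :* w := (⟨ 4 ⟩ :* (a :+ b :- ⟨ 2 ⟩ :* ⟨ 1 ⟩) :+ (A :+ B :- (⟨ 4 ⟩ :* a :+ g :+ (⟨ 4 ⟩ :* b :+ h)))
          :+ h :+ (⟨ 8 ⟩ :+ ⟨ 128 ⟩ :* w :- (A :+ B :+ L))) :+ (g :+ L)) refl w a b g h A B L)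

  -- The squares s₀² − sⱼ² discarded in the AM-GM inequality for ∏ s are what forces the four biases to agree.
  module FourVariables {w : Carrier} (w≥0 : 0# ≤ w) (w-small : # 40000 * w ≤ 1#)
                       {p : Fin 4 → Carrier} {r : Fin 4 → Bool → Carrier}
                       (approx : ∀ i → ApproxRoots w (p i) (r i false) (r i true))
                       (1≤evenSum : 1# ≤ evenSum r) where

    module One i = OneVariable w≥0 w-small (approx i)

    s d : Fin 4 → Carrier
    s i = r i false + r i true
    d i = r i false - r i true

    loss : Fin 4 → Carrier
    loss i = # 3 * One.x i * (1# - # 4 * One.x i)

    loss≥0 : ∀ i → 0# ≤ loss i
    loss≥0 i = #-nonneg 3 ⟨*⟩ One.x≥0 i ⟨*⟩ One.4x≤1 i

    fourth-powers≤ : ∀ i → s i ^ 4 + d i ^ 4 + loss i ≤ # 2 + # 32 * w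
    fourth-powers≤ i = subst (λ z → z + loss i ≤ # 2 + # 32 * w)
      (solve 2 (λ u v → ⟨ 2 ⟩ :* (u :^ 4 :+ ⟨ 6 ⟩ :* (u :* u :* (v :* v)) :+ v :^ 4) := (u :+ v) :^ 4
          :+ (u :- v) :^ 4)
        refl (r i false) (r i true))
      (One.g-bound i)

    total-fourth-powers≤ : ∑ (λ i → s i ^ 4) + ∑ (λ i → d i ^ 4) + ∑ loss ≤ # 8 + # 128 * w
    total-fourth-powers≤ = subst₂ _≤_
      (trans (∑-+ (λ i → s i ^ 4 + d i ^ 4) loss) (cong (_+ ∑ loss) (∑-+ (λ i → s i ^ 4) (λ i → d i ^ 4))))
      (solve 1 (λ w → let c = ⟨ 2 ⟩ :+ ⟨ 32 ⟩ :* w in c :+ c :+ c :+ c := ⟨ 8 ⟩ :+ ⟨ 128 ⟩ :* w) refl w)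
      (∑-mono fourth-powers≤)

    2≤∏s+∏d : # 2 * 1# ≤ ∏ s + ∏ d
    2≤∏s+∏d = subst (# 2 * 1# ≤_) (evenSum-splits r) (*-monoˡ-≤ (#-nonneg 2) 1≤evenSum)

    gap+loss : ∀ j → gap (s zero) (s j) + ∑ loss ≤ # 128 * w
    gap+loss j = gap-budget {a = ∏ s} {b = ∏ d} {g = gap (s zero) (s j)} {h = gap (d zero) (d (suc zero))}
        {L = ∑ loss} 2≤∏s+∏d (∏-AM-GM-with-gap s j) (∏-AM-GM-with-gap d (suc zero)) (square-nonneg _)
        total-fourth-powers≤

    gap≤ : ∀ j → gap (s zero) (s j) ≤ # 128 * w
    gap≤ j = ≤-trans (≤-of-diff (≤-trans (loss≥0 zero) (term≤∑ loss≥0 zero)) (+-comm _ _)) (gap+loss j)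

    loss≤ : ∀ i → loss i ≤ # 128 * w
    loss≤ i = ≤-trans (term≤∑ loss≥0 i)
      (≤-trans (≤-of-diff (square-nonneg (s zero * s zero - s zero * s zero)) refl) (gap+loss zero))

    τ : Fin 4 → Carrier
    τ i = bias² (p i)

    Small Large : Fin 4 → Set
    Small i = # 3 * τ i ≤ # 1024 * w
    Large i = # 3 * (1# - τ i) ≤ # 1024 * w

    small-or-large : ∀ i → Small i ⊎ Large i
    small-or-large i = near-0-or-near-1 (τ i)
      -- With 4x = 1 - τ, four times the loss is 3(1 - τ)τ.
      (subst (_≤ # 512 * w) (trans
          (solve 1 (λ x → ⟨ 4 ⟩ :* (⟨ 3 ⟩ :* x :* (⟨ 1 ⟩ :- ⟨ 4 ⟩ :* x)) := ⟨ 3 ⟩ :* (⟨ 4 ⟩ :* x)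
              :* (⟨ 1 ⟩ :- ⟨ 4 ⟩ :* x)) refl (One.x i))
          (trans (cong (λ y → # 3 * y * (1# - y)) (sym (One.bias²≡ i)))
            (solve 1 (λ τ → ⟨ 3 ⟩ :* (⟨ 1 ⟩ :- τ) :* (⟨ 1 ⟩ :- (⟨ 1 ⟩ :- τ)) := ⟨ 3 ⟩ :* (⟨ 1 ⟩ :- τ) :* τ)
                refl (τ i))))
        (subst (# 4 * loss i ≤_) (solve 1 (λ w → ⟨ 4 ⟩ :* (⟨ 128 ⟩ :* w) := ⟨ 512 ⟩ :* w) refl w)
          (*-monoˡ-≤ (#-nonneg 4) (loss≤ i))))
      (square-nonneg _)
      (subst (0# ≤_) (sym (One.bias²≡ i)) (#-nonneg 4 ⟨*⟩ One.x≥0 i))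

    small⇒16τ≤1 : ∀ {τ} → # 3 * τ ≤ # 1024 * w → # 16 * τ ≤ 1#
    small⇒16τ≤1 {τ} small = *-cancelˡ-≤ (#-positive 2)
      (≤-of-diff (#-nonneg 16 ⟨*⟩ diff-nonneg small ⟨+⟩ diff-nonneg w-small ⟨+⟩ #-nonneg 2 ⟨+⟩ #-nonneg 23616 ⟨*⟩ w≥0)
        (solve 2 (λ τ w → ⟨ 3 ⟩ :* ⟨ 1 ⟩ := (⟨ 16 ⟩ :* (⟨ 1024 ⟩ :* w :- ⟨ 3 ⟩ :* τ)
            :+ (⟨ 1 ⟩ :- ⟨ 40000 ⟩ :* w) :+ ⟨ 2 ⟩
          :+ ⟨ 23616 ⟩ :* w) :+ ⟨ 3 ⟩ :* (⟨ 16 ⟩ :* τ)) refl τ w))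

    -- The bounds give a² - b² ≥ 4/3 - 111/100 > 1/5, so the gap is at least 1/25, whereas 128 w ≤
    -- 128/40000.
    separated : ∀ {a b} → gap a b ≤ # 128 * w → # 4 ≤ # 3 * (a * a) → # 100 * (b * b) ≤ # 111 → ⊥
    separated {a} {b} gap≤ a-lower b-upper = #-positive 22 (≤-of-diff
        (#-nonneg 625 ⟨*⟩ diff-nonneg gap≤ ⟨+⟩ #-nonneg 2 ⟨*⟩ diff-nonneg w-small
          ⟨+⟩ #-nonneg 25 ⟨*⟩ (e≥0 ⟨*⟩ (e≥0 ⟨+⟩ #-nonneg 2)))
        (solve 3 (λ A B w → let e = ⟨ 5 ⟩ :* (A :- B) :- ⟨ 1 ⟩ in
          ⟨ 0 ⟩ := (⟨ 625 ⟩ :* (⟨ 128 ⟩ :* w :- (A :- B) :* (A :- B)) :+ ⟨ 2 ⟩ :* (⟨ 1 ⟩ :- ⟨ 40000 ⟩ :* w)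
             :+ ⟨ 25 ⟩ :* (e :* (e :+ ⟨ 2 ⟩))) :+ ⟨ 23 ⟩) refl (a * a) (b * b) w))
      where
      e≥0 : 0# ≤ # 5 * (a * a - b * b) - 1#
      e≥0 = *-cancelˡ-≤ (#-positive 299) (≤-of-diff
        (#-nonneg 500 ⟨*⟩ diff-nonneg a-lower ⟨+⟩ #-nonneg 15 ⟨*⟩ diff-nonneg b-upper ⟨+⟩ #-nonneg 35)
        (solve 2 (λ A B → ⟨ 300 ⟩ :* (⟨ 5 ⟩ :* (A :- B) :- ⟨ 1 ⟩) :=
          (⟨ 500 ⟩ :* (⟨ 3 ⟩ :* A :- ⟨ 4 ⟩) :+ ⟨ 15 ⟩ :* (⟨ 111 ⟩ :- ⟨ 100 ⟩ :* B) :+ ⟨ 35 ⟩) :+ ⟨ 300 ⟩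
              :* ⟨ 0 ⟩) refl (a * a) (b * b)))

    all-small : Small zero → ∀ i → Small i ⊎ Large i → Small i
    all-small small₀ i (inj₁ small) = small
    all-small small₀ i (inj₂ large) = ⊥-elim (separated {s zero} {s i} (gap≤ i)
      (One.s²-lower zero (small⇒16τ≤1 small₀)) (One.s²-upper i large))

    all-large : Large zero → ∀ i → Small i ⊎ Large i → Large i
    all-large large₀ i (inj₂ large) = large
    all-large large₀ i (inj₁ small) = ⊥-elim (separated {s i} {s zero}
      (subst (_≤ # 128 * w) (solve 2 (λ A B → (A :- B) :* (A :- B) := (B :- A) :* (B :- A))
          refl (s zero * s zero) (s i * s i)) (gap≤ i))
      (One.s²-lower i (small⇒16τ≤1 small)) (One.s²-upper zero large₀))

    coherent : (∀ i → Small i) ⊎ (∀ i → Large i)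
    coherent = Sum.map (λ small₀ i → all-small small₀ i (small-or-large i))
                       (λ large₀ i → all-large large₀ i (small-or-large i)) (small-or-large zero)

-- Approximate roots and the dichotomy for the proportions of the pieces.

module Dichotomy (F : OrderedField) where

  open OrderedFieldProperties F
  open KeyInequality F

  ∏-* : ∀ f g → ∏ (λ i → f i * g i) ≡ ∏ f * ∏ g
  ∏-* f g = solve 8 (λ a b c d a′ b′ c′ d′ →
      (a :* a′) :* (b :* b′) :* (c :* c′) :* (d :* d′) := (a :* b :* c :* d) :* (a′ :* b′ :* c′ :* d′)) refl
      (f zero) (f (suc zero)) (f (suc (suc zero))) (f (suc (suc (suc zero))))
      (g zero) (g (suc zero)) (g (suc (suc zero))) (g (suc (suc (suc zero))))

  ∏-^ : ∀ f n → ∏ (λ i → f i ^ n) ≡ ∏ f ^ n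
  ∏-^ f zero    = solve 0 (⟨ 1 ⟩ :* ⟨ 1 ⟩ :* ⟨ 1 ⟩ :* ⟨ 1 ⟩ := ⟨ 1 ⟩) refl
  ∏-^ f (suc n) = trans (∏-* f (λ i → f i ^ n)) (cong (∏ f *_) (∏-^ f n))

  ∏-nonneg : ∀ {f} → (∀ i → 0# ≤ f i) → 0# ≤ ∏ f
  ∏-nonneg f≥0 = f≥0 _ ⟨*⟩ f≥0 _ ⟨*⟩ f≥0 _ ⟨*⟩ f≥0 _

  ∏-positive : ∀ {f} → (∀ i → Positive (f i)) → Positive (∏ f)
  ∏-positive f>0 = *-positive (*-positive (*-positive (f>0 _) (f>0 _)) (f>0 _)) (f>0 _)

  ∏-mono : ∀ {f g} → (∀ i → 0# ≤ f i) → (∀ i → f i ≤ g i) → ∏ f ≤ ∏ g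
  ∏-mono {f} {g} f≥0 f≤g =
    *-mono-≤ (f≥0 _ ⟨*⟩ f≥0 _ ⟨*⟩ f≥0 _) (g≥0 _)
      (*-mono-≤ (f≥0 _ ⟨*⟩ f≥0 _) (g≥0 _) (*-mono-≤ (f≥0 _) (g≥0 _) (f≤g _) (f≤g _)) (f≤g _)) (f≤g _)
    where
    g≥0 : ∀ i → 0# ≤ g i
    g≥0 i = ≤-trans (f≥0 i) (f≤g i)

  -- Bernoulli's inequality cleared of denominators. For x = p, y = (1 - p) w and (n + 1) w = 1 it
  -- reads p^n ≤ (p + (1 - p) w)^(n + 1), which is the source of `weight^m-lower`.
  bernoulli : ∀ {x y} n → 0# ≤ x → 0# ≤ y → x ^ n * (x + # (suc n) * y) ≤ (x + y) ^ suc n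
  bernoulli {x} {y} zero x≥0 y≥0 = ≤-reflexive
    (solve 2 (λ x y → ⟨ 1 ⟩ :* (x :+ ⟨ 1 ⟩ :* y) := (x :+ y) :* ⟨ 1 ⟩) refl x y)
  bernoulli {x} {y} (suc n) x≥0 y≥0 = ≤-trans
    (≤-of-diff (^-nonneg n x≥0 ⟨*⟩ (#-nonneg (suc n) ⟨*⟩ (y≥0 ⟨*⟩ y≥0)))
      (trans (solve 4 (λ x y a N → (x :+ y) :* (a :* (x :+ N :* y)) :=
                 a :* (N :* (y :* y)) :+ x :* a :* (x :+ (⟨ 1 ⟩ :+ N) :* y)) refl x y (x ^ n) (# (suc n)))
             (cong (λ N → x ^ n * (# (suc n) * (y * y)) + x * x ^ n * (x + N * y)) (sym (#-homo-+ 1 (suc n))))))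
    (*-monoˡ-≤ (x≥0 ⟨+⟩ y≥0) (bernoulli n x≥0 y≥0))

  part : Carrier → Bool → Carrier
  part p false = p
  part p true  = 1# - p

  module _ {w : Carrier} {m′ : ℕ} (mw≡1 : # (suc m′) * w ≡ 1#) where

    m : ℕ
    m = suc m′

    w-positive : Positive w
    w-positive w≤0 = 1≰0 (subst (_≤ 0#) mw≡1
      (≤-trans (*-monoˡ-≤ (#-nonneg m) w≤0) (≤-reflexive (zeroʳ _))))

    w≥0 : 0# ≤ w
    w≥0 = positive⇒nonneg w-positive

    -- Descends through the multiples of δ until the next lower one, u, fails x ≤ u⁴. Then u ≤ 1, so
    -- one step of size δ raises the fourth power by at most (4 + 6 + 4 + 1) δ = 15δ ≤ w².
    fourth-root-search : ∀ {x δ} → 0# ≤ x → x ≤ 1# → 0# ≤ δ → δ ≤ 1# → # 15 * δ ≤ w * w →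
      ∀ N → x ≤ (# N * δ) ^ 4 → ∃ λ u → 0# ≤ u × x ≤ u ^ 4 × u ^ 4 ≤ x + w * w
    fourth-root-search {x} {δ} x≥0 x≤1 δ≥0 δ≤1 15δ≤w² zero x≤ = 0# , ≤-refl ,
      subst (x ≤_) (solve 1 (λ δ → (⟨ 0 ⟩ :* δ) :^ 4 := ⟨ 0 ⟩ :^ 4) refl δ) x≤ ,
      ≤-of-diff (x≥0 ⟨+⟩ w≥0 ⟨*⟩ w≥0) (solve 1 (λ z → z := z :+ ⟨ 0 ⟩ :^ 4) refl (x + w * w))
    fourth-root-search {x} {δ} x≥0 x≤1 δ≥0 δ≤1 15δ≤w² (suc N) x≤ with x ≤? (# N * δ) ^ 4
    ... | yes x≤′ = fourth-root-search x≥0 x≤1 δ≥0 δ≤1 15δ≤w² N x≤′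
    ... | no  x≰  = # (suc N) * δ , #-nonneg (suc N) ⟨*⟩ δ≥0 , x≤ ,
      subst (λ z → z ^ 4 ≤ x + w * w) (sym step)
        (≤-of-diff
          (diff-nonneg (≰⇒≥ x≰) ⟨+⟩ diff-nonneg 15δ≤w²
            ⟨+⟩ δ≥0 ⟨*⟩ (#-nonneg 4 ⟨*⟩ diff-nonneg u³≤1 ⟨+⟩ #-nonneg 6 ⟨*⟩ diff-nonneg u²δ≤1
                         ⟨+⟩ #-nonneg 4 ⟨*⟩ diff-nonneg uδ²≤1 ⟨+⟩ diff-nonneg δ³≤1))
          (solve 4 (λ x u δ w → x :+ w :* w :=
              (x :- u :^ 4 :+ (w :* w :- ⟨ 15 ⟩ :* δ)
               :+ δ :* (⟨ 4 ⟩ :* (⟨ 1 ⟩ :* ⟨ 1 ⟩ :* ⟨ 1 ⟩ :- u :* u :* u) :+ ⟨ 6 ⟩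
                   :* (⟨ 1 ⟩ :* ⟨ 1 ⟩ :* ⟨ 1 ⟩ :- u :* u :* δ)
                        :+ ⟨ 4 ⟩ :* (⟨ 1 ⟩ :* ⟨ 1 ⟩ :* ⟨ 1 ⟩ :- u :* δ :* δ)
                            :+ (⟨ 1 ⟩ :* ⟨ 1 ⟩ :* ⟨ 1 ⟩ :- δ :* δ :* δ)))
              :+ (δ :+ u) :^ 4) refl x u δ w))
      where
      u : Carrier
      u = # N * δ
      u≥0 : 0# ≤ u
      u≥0 = #-nonneg N ⟨*⟩ δ≥0
      step : # (suc N) * δ ≡ δ + u
      step = trans (cong (_* δ) (#-homo-+ 1 N))
        (solve 2 (λ N δ → (⟨ 1 ⟩ :+ N) :* δ := δ :+ N :* δ) refl (# N) δ)
      u≤1 : u ≤ 1#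
      u≤1 = ^-cancel-≤ 3 (#-nonneg 1) (≤-trans (≰⇒≥ x≰)
        (subst (x ≤_) (solve 0 (⟨ 1 ⟩ := ⟨ 1 ⟩ :^ 4) refl) x≤1))
      triple≤1 : ∀ {a b c} → 0# ≤ a → 0# ≤ b → 0# ≤ c → a ≤ 1# → b ≤ 1# → c ≤ 1# → a * b * c ≤ 1# * 1# * 1#
      triple≤1 a≥0 b≥0 c≥0 a≤1 b≤1 c≤1 =
        *-mono-≤ (a≥0 ⟨*⟩ b≥0) (#-nonneg 1) (*-mono-≤ a≥0 (#-nonneg 1) a≤1 b≤1) c≤1
      u³≤1 = triple≤1 u≥0 u≥0 u≥0 u≤1 u≤1 u≤1
      u²δ≤1 = triple≤1 u≥0 u≥0 δ≥0 u≤1 u≤1 δ≤1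
      uδ²≤1 = triple≤1 u≥0 δ≥0 δ≥0 u≤1 δ≤1 δ≤1
      δ³≤1 = triple≤1 δ≥0 δ≥0 δ≥0 δ≤1 δ≤1 δ≤1

    approximate-fourth-root : ∀ {x} → 0# ≤ x → x ≤ 1# → ∃ λ u → 0# ≤ u × x ≤ u ^ 4 × u ^ 4 ≤ x + w * w
    approximate-fourth-root {x} x≥0 x≤1 =
      fourth-root-search x≥0 x≤1 δ≥0 δ≤1 (≤-reflexive 15δ≡w²) (suc N′)
        (subst (λ z → x ≤ z ^ 4) (sym Nδ≡1) (≤-trans x≤1 (≤-reflexive (solve 0 (⟨ 1 ⟩ := ⟨ 1 ⟩ :^ 4) refl))))
      where
      N′ : ℕ
      -- A grid of 15m² steps from 0 to 1: then δ = 1/(15m²), and 15δ is exactly w².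
      N′ = ℕ.pred (15 ℕ.* (m ℕ.* m))
      inv : ∃ λ y → # (suc N′) * y ≡ 1#
      inv = inverse (# (suc N′)) (λ N≡0 → #-positive N′ (≤-reflexive N≡0))
      δ : Carrier
      δ = proj₁ inv
      Nδ≡1 : # (suc N′) * δ ≡ 1#
      Nδ≡1 = proj₂ inv
      δ≥0 : 0# ≤ δ
      δ≥0 = *-cancelˡ-≤ (#-positive N′) (subst₂ _≤_ (sym (zeroʳ _)) (sym Nδ≡1) (#-nonneg 1))
      δ≤1 : δ ≤ 1#
      δ≤1 = subst (δ ≤_) Nδ≡1 (≤-of-diff (#-nonneg N′ ⟨*⟩ δ≥0)
        (trans (cong (_* δ) (#-homo-+ 1 N′)) (solve 2 (λ N δ → (⟨ 1 ⟩ :+ N) :* δ := N :* δ :+ δ) refl (# N′) δ)))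
      15δ≡w² : # 15 * δ ≡ w * w
      15δ≡w² = begin
        # 15 * δ                                     ≡⟨ solve 1
            (λ δ → ⟨ 15 ⟩ :* δ := ⟨ 1 ⟩ :* ⟨ 1 ⟩ :* (⟨ 15 ⟩ :* δ)) refl δ ⟩
        1# * 1# * (# 15 * δ)                         ≡⟨ cong (λ z → z * z * (# 15 * δ)) (sym mw≡1) ⟩
        (# m * w) * (# m * w) * (# 15 * δ)           ≡⟨ solve 3
            (λ M w δ → (M :* w) :* (M :* w) :* (⟨ 15 ⟩ :* δ) := w :* w :* ((⟨ 15 ⟩ :* (M :* M)) :* δ))
            refl (# m) w δ ⟩
        w * w * ((# 15 * (# m * # m)) * δ)           ≡⟨ cong (λ z → w * w * (z * δ))
            (sym (trans (#-homo-* 15 (m ℕ.* m)) (cong (# 15 *_) (#-homo-* m m)))) ⟩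
        w * w * (# (15 ℕ.* (m ℕ.* m)) * δ)           ≡⟨ cong (w * w *_) Nδ≡1 ⟩
        w * w * 1#                                   ≡⟨ *-identityʳ _ ⟩
        w * w                                        ∎
        where open ≡-Reasoning

    weight≥0 : ∀ {p} → 0# ≤ p → 0# ≤ 1# - p → 0# ≤ weight w p
    weight≥0 p≥0 q≥0 = p≥0 ⟨*⟩ p≥0 ⟨*⟩ (p≥0 ⟨+⟩ q≥0 ⟨*⟩ w≥0)

    w≤1 : w ≤ 1#
    w≤1 = subst (w ≤_) mw≡1 (≤-of-diff (#-nonneg m′ ⟨*⟩ w≥0)
        (trans (cong (_* w) (#-homo-+ 1 m′)) (solve 2 (λ N δ → (⟨ 1 ⟩ :+ N) :* δ := N :* δ :+ δ) refl (# m′) w)))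

    weight≤1 : ∀ {p} → 0# ≤ p → 0# ≤ 1# - p → weight w p ≤ 1#
    weight≤1 {p} p≥0 q≥0 = ≤-of-diff
      (p≥0 ⟨*⟩ p≥0 ⟨*⟩ (q≥0 ⟨*⟩ diff-nonneg w≤1) ⟨+⟩ q≥0 ⟨*⟩ (#-nonneg 1 ⟨+⟩ p≥0))
      (solve 2 (λ p w → ⟨ 1 ⟩ := (p :* p :* ((⟨ 1 ⟩ :- p) :* (⟨ 1 ⟩ :- w)) :+ (⟨ 1 ⟩ :- p) :* (⟨ 1 ⟩ :+ p))
         :+ p :* p :* (p :+ (⟨ 1 ⟩ :- p) :* w)) refl p w)

    -- The m-th power of p^(3 - w) ≤ `weight w p`: as mw = 1, the exponent 3m - 1 is 2m + m′.
    weight^m-lower : ∀ {p} → 0# ≤ p → 0# ≤ 1# - p → p ^ (2 ℕ.* m ℕ.+ m′) ≤ weight w p ^ m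
    weight^m-lower {p} p≥0 q≥0 = subst₂ _≤_ lhs rhs
      (*-monoˡ-≤ (^-nonneg (2 ℕ.* m) p≥0) (bernoulli m′ p≥0 (q≥0 ⟨*⟩ w≥0)))
      where
      open ≡-Reasoning
      lhs : p ^ (2 ℕ.* m) * (p ^ m′ * (p + # m * ((1# - p) * w))) ≡ p ^ (2 ℕ.* m ℕ.+ m′)
      lhs = begin
        p ^ (2 ℕ.* m) * (p ^ m′ * (p + # m * ((1# - p) * w)))
          ≡⟨ solve 5 (λ A B p w M → A :* (B :* (p :+ M :* ((⟨ 1 ⟩ :- p) :* w))) := A :* B
              :* (p :+ (M :* w) :* (⟨ 1 ⟩ :- p))) refl (p ^ (2 ℕ.* m)) (p ^ m′) p w (# m) ⟩
        p ^ (2 ℕ.* m) * p ^ m′ * (p + (# m * w) * (1# - p))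
          ≡⟨ cong (λ z → p ^ (2 ℕ.* m) * p ^ m′ * (p + z * (1# - p))) mw≡1 ⟩
        p ^ (2 ℕ.* m) * p ^ m′ * (p + 1# * (1# - p))
          ≡⟨ solve 3 (λ A B p → A :* B :* (p :+ ⟨ 1 ⟩ :* (⟨ 1 ⟩ :- p)) := A :* B) refl (p ^ (2 ℕ.* m)) (p ^ m′) p ⟩
        p ^ (2 ℕ.* m) * p ^ m′
          ≡⟨ sym (^-homo-* p (2 ℕ.* m) m′) ⟩
        p ^ (2 ℕ.* m ℕ.+ m′) ∎
      rhs : p ^ (2 ℕ.* m) * (p + (1# - p) * w) ^ m ≡ weight w p ^ m
      rhs = begin
        p ^ (2 ℕ.* m) * (p + (1# - p) * w) ^ m  ≡⟨ cong (_* (p + (1# - p) * w) ^ m) (sym (^-assocʳ p 2 m)) ⟩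
        (p ^ 2) ^ m * (p + (1# - p) * w) ^ m    ≡⟨ cong (λ z → z ^ m * (p + (1# - p) * w) ^ m)
            (solve 1 (λ p → p :^ 2 := p :* p) refl p) ⟩
        (p * p) ^ m * (p + (1# - p) * w) ^ m    ≡⟨ sym (^-distrib-* (p * p) (p + (1# - p) * w) m) ⟩
        weight w p ^ m                          ∎

    module _ {p : Fin 4 → Carrier} (p≥0 : ∀ i → 0# ≤ p i) (q≥0 : ∀ i → 0# ≤ 1# - p i) where

      part≥0 : ∀ i b → 0# ≤ part (p i) b
      part≥0 i false = p≥0 i
      part≥0 i true  = q≥0 i

      part-complement≥0 : ∀ i b → 0# ≤ 1# - part (p i) b
      part-complement≥0 i false = q≥0 i
      part-complement≥0 i true  = subst (0# ≤_) (solve 1 (λ p → p := ⟨ 1 ⟩ :- (⟨ 1 ⟩ :- p)) refl (p i)) (p≥0 i)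

      abstract

        approxRoot : ∀ i b → ∃ λ u → 0# ≤ u × weight w (part (p i) b) ≤ u ^ 4 × u ^ 4 ≤ weight w (part (p i) b)
            + w * w
        approxRoot i b = approximate-fourth-root (weight≥0 (part≥0 i b) (part-complement≥0 i b))
            (weight≤1 (part≥0 i b) (part-complement≥0 i b))

      root : Fin 4 → Bool → Carrier
      root i b = proj₁ (approxRoot i b)

      root≥0 : ∀ i b → 0# ≤ root i b
      root≥0 i b = proj₁ (proj₂ (approxRoot i b))

      approxRoots : ∀ i → ApproxRoots w (p i) (root i false) (root i true)
      approxRoots i = record
        { p≥0 = p≥0 i
        ; q≥0 = q≥0 i
        ; u≥0 = root≥0 i false
        ; v≥0 = root≥0 i true
        ; u-lower = proj₁ (proj₂ (proj₂ (approxRoot i false)))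
        ; v-lower = proj₁ (proj₂ (proj₂ (approxRoot i true)))
        ; u-upper = proj₂ (proj₂ (proj₂ (approxRoot i false)))
        ; v-upper = proj₂ (proj₂ (proj₂ (approxRoot i true)))
        }

      partial-weight : (Fin 4 → Bool) → Fin 4 → Carrier
      partial-weight β i = weight w (part (p i) (β i))

      partial-weight≥0 : ∀ β i → 0# ≤ partial-weight β i
      partial-weight≥0 β i = weight≥0 (part≥0 i (β i)) (part-complement≥0 i (β i))

      ∏-part^≤ : ∀ β → ∏ (λ i → part (p i) (β i)) ^ (2 ℕ.* m ℕ.+ m′) ≤ ∏ (partial-weight β) ^ m
      ∏-part^≤ β = subst₂ _≤_ (∏-^ (λ i → part (p i) (β i)) (2 ℕ.* m ℕ.+ m′)) (∏-^ (partial-weight β) m)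
        (∏-mono (λ i → ^-nonneg (2 ℕ.* m ℕ.+ m′) (part≥0 i (β i)))
          (λ i → weight^m-lower (part≥0 i (β i)) (part-complement≥0 i (β i))))

      ∏-partial-weight≤ : ∀ β → ∏ (partial-weight β) ≤ ∏ (λ i → root i (β i)) ^ 4
      ∏-partial-weight≤ β = subst (∏ (partial-weight β) ≤_) (∏-^ (λ i → root i (β i)) 4)
        (∏-mono (partial-weight≥0 β) (λ i → proj₁ (proj₂ (proj₂ (approxRoot i (β i))))))

      -- The hypothesis is the 4m-th power of e ≤ ∏ p^((3 - w)/4), where p stands for the chosen
      -- parts. Passing to the weights and then to the roots, first the power m and then the power 4
      -- cancel.
      ≤-∏-root : ∀ {e} (β : Fin 4 → Bool) → (e ^ 4) ^ m ≤ ∏ (λ i → part (p i) (β i)) ^ (2 ℕ.* m ℕ.+ m′) →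
                 e ≤ ∏ (λ i → root i (β i))
      ≤-∏-root {e} β bound = ^-cancel-≤ 3 (∏-nonneg {λ i → root i (β i)} (λ i → root≥0 i (β i)))
        (≤-trans (^-cancel-≤ {e ^ 4} m′ (∏-nonneg (partial-weight≥0 β)) (≤-trans bound (∏-part^≤ β)))
          (∏-partial-weight≤ β))

      sumBool-mono : ∀ {f g} → (∀ b → f b ≤ g b) → sumBool f ≤ sumBool g
      sumBool-mono f≤g = +-mono-≤ (f≤g false) (f≤g true)

      ≤-evenSum : ∀ {e : Bool → Bool → Bool → Carrier} (r : Fin 4 → Bool → Carrier) →
        (∀ b₁ b₂ b₃ → e b₁ b₂ b₃ ≤ ∏ (λ i → r i (evenChoice b₁ b₂ b₃ i))) →
        sumBool (λ b₁ → sumBool λ b₂ → sumBool λ b₃ → e b₁ b₂ b₃) ≤ evenSum r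
      ≤-evenSum r e≤ = sumBool-mono λ b₁ → sumBool-mono λ b₂ → sumBool-mono λ b₃ → e≤ b₁ b₂ b₃

      1≤evenSum-root : (e : Bool → Bool → Bool → Carrier) →
        sumBool (λ b₁ → sumBool λ b₂ → sumBool λ b₃ → e b₁ b₂ b₃) ≡ 1# →
        (∀ b₁ b₂ b₃ → (e b₁ b₂ b₃ ^ 4) ^ m ≤ ∏ (λ i → part (p i) (evenChoice b₁ b₂ b₃ i)) ^ (2 ℕ.* m ℕ.+ m′)) →
        1# ≤ evenSum root
      1≤evenSum-root e ∑e≡1 bound = subst (_≤ evenSum root) ∑e≡1
          (≤-evenSum {e} root λ b₁ b₂ b₃ → ≤-∏-root {e b₁ b₂ b₃} (evenChoice b₁ b₂ b₃) (bound b₁ b₂ b₃))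

      -- The eight values e sum to 1 and each is at most the matching product of roots, so the even
      -- sum of the roots is at least 1. Young's inequality is then almost attained, which leaves
      -- only the two coherent configurations.
      parts-coherent : # 40000 * w ≤ 1# → (e : Bool → Bool → Bool → Carrier) →
        sumBool (λ b₁ → sumBool λ b₂ → sumBool λ b₃ → e b₁ b₂ b₃) ≡ 1# →
        (∀ b₁ b₂ b₃ → (e b₁ b₂ b₃ ^ 4) ^ m ≤ ∏ (λ i → part (p i) (evenChoice b₁ b₂ b₃ i)) ^ (2 ℕ.* m ℕ.+ m′)) →
        (∀ i → # 3 * bias² (p i) ≤ # 1024 * w) ⊎ (∀ i → # 3 * (1# - bias² (p i)) ≤ # 1024 * w)
      parts-coherent w-small e ∑e≡1 bound = FourVariables.coherent w≥0 w-small {p} {root} approxRoots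
        (1≤evenSum-root e ∑e≡1 bound)

-- The bilinear form on F₂ⁿ.

dot : ∀ {n} → F₂^ n → F₂^ n → Bool
dot []      []      = false
dot (a ∷ u) (b ∷ v) = (a ∧ b) xor dot u v

⊕-comm : ∀ {n} (u v : F₂^ n) → u ⊕ v ≡ v ⊕ u
⊕-comm []          []          = refl
⊕-comm (false ∷ u) (false ∷ v) = cong (false ∷_) (⊕-comm u v)
⊕-comm (false ∷ u) (true ∷ v)  = cong (true ∷_) (⊕-comm u v)
⊕-comm (true ∷ u)  (false ∷ v) = cong (true ∷_) (⊕-comm u v)
⊕-comm (true ∷ u)  (true ∷ v)  = cong (false ∷_) (⊕-comm u v)

⊕-identityʳ : ∀ {n} (v : F₂^ n) → v ⊕ 0v ≡ v
⊕-identityʳ []          = refl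
⊕-identityʳ (false ∷ v) = cong (false ∷_) (⊕-identityʳ v)
⊕-identityʳ (true ∷ v)  = cong (true ∷_) (⊕-identityʳ v)

⊕-cancelʳ : ∀ {n} (u v : F₂^ n) → (u ⊕ v) ⊕ v ≡ u
⊕-cancelʳ []          []          = refl
⊕-cancelʳ (false ∷ u) (false ∷ v) = cong (false ∷_) (⊕-cancelʳ u v)
⊕-cancelʳ (false ∷ u) (true ∷ v)  = cong (false ∷_) (⊕-cancelʳ u v)
⊕-cancelʳ (true ∷ u)  (false ∷ v) = cong (true ∷_) (⊕-cancelʳ u v)
⊕-cancelʳ (true ∷ u)  (true ∷ v)  = cong (true ∷_) (⊕-cancelʳ u v)

xor-interchange : ∀ a b c d → (a xor b) xor (c xor d) ≡ (a xor c) xor (b xor d)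
xor-interchange false false c     d     = refl
xor-interchange false true  false d     = refl
xor-interchange false true  true  false = refl
xor-interchange false true  true  true  = refl
xor-interchange true  false false d     = refl
xor-interchange true  false true  false = refl
xor-interchange true  false true  true  = refl
xor-interchange true  true  false false = refl
xor-interchange true  true  false true  = refl
xor-interchange true  true  true  d     = refl

dot-⊕ʳ : ∀ {n} (ξ u v : F₂^ n) → dot ξ (u ⊕ v) ≡ dot ξ u xor dot ξ v
dot-⊕ʳ []          []      []      = refl
dot-⊕ʳ (false ∷ ξ) (a ∷ u) (b ∷ v) = dot-⊕ʳ ξ u v
dot-⊕ʳ (true ∷ ξ)  (a ∷ u) (b ∷ v) =
  trans (cong ((a xor b) xor_) (dot-⊕ʳ ξ u v)) (xor-interchange a b (dot ξ u) (dot ξ v))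

dot-comm : ∀ {n} (u v : F₂^ n) → dot u v ≡ dot v u
dot-comm []          []          = refl
dot-comm (false ∷ u) (false ∷ v) = dot-comm u v
dot-comm (false ∷ u) (true ∷ v)  = dot-comm u v
dot-comm (true ∷ u)  (false ∷ v) = dot-comm u v
dot-comm (true ∷ u)  (true ∷ v)  = cong (true xor_) (dot-comm u v)

dot-⊕ˡ : ∀ {n} (ξ η v : F₂^ n) → dot (ξ ⊕ η) v ≡ dot ξ v xor dot η v
dot-⊕ˡ ξ η v = trans (dot-comm (ξ ⊕ η) v)
  (trans (dot-⊕ʳ v ξ η) (cong₂ _xor_ (dot-comm v ξ) (dot-comm v η)))

dot-zeroʳ : ∀ {n} (v : F₂^ n) → dot v 0v ≡ false
dot-zeroʳ []          = refl
dot-zeroʳ (false ∷ v) = dot-zeroʳ v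
dot-zeroʳ (true ∷ v)  = dot-zeroʳ v

isZero⇒≡0v : ∀ {n} (v : F₂^ n) → isZero v ≡ true → v ≡ 0v
isZero⇒≡0v []          _  = refl
isZero⇒≡0v (false ∷ v) v≡0 = cong (false ∷_) (isZero⇒≡0v v v≡0)

-- Sums, characters, and Fourier analysis on F₂ⁿ.

module Fourier (F : OrderedField) where

  open OrderedFieldProperties F
  open KeyInequality F using (∏)
  open Dichotomy F using (∏-*)

  𝟙 : Bool → Carrier
  𝟙 true  = 1#
  𝟙 false = 0#

  𝟙-nonneg : ∀ b → 0# ≤ 𝟙 b
  𝟙-nonneg true  = #-nonneg 1
  𝟙-nonneg false = ≤-refl

  abstract

    -- Recursion on the first coordinate, instead of a sum over `allVecs`, makes translation
    -- invariance, exchange of sums and Cauchy-Schwarz direct inductions on n; `sum-allVecs`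
    -- connects the two.
    S : ∀ {n} → (F₂^ n → Carrier) → Carrier
    S {zero}  f = f []
    S {suc n} f = S (λ v → f (false ∷ v)) + S (λ v → f (true ∷ v))

    S-[] : ∀ (f : F₂^ zero → Carrier) → S f ≡ f []
    S-[] f = refl

    S-∷ : ∀ {n} (f : F₂^ (suc n) → Carrier) → S f ≡ S (λ v → f (false ∷ v)) + S (λ v → f (true ∷ v))
    S-∷ f = refl

    S-cong : ∀ {n} {f g : F₂^ n → Carrier} → (∀ v → f v ≡ g v) → S f ≡ S g
    S-cong {zero}  f≡g = f≡g []
    S-cong {suc n} f≡g = cong₂ _+_ (S-cong (λ v → f≡g (false ∷ v))) (S-cong (λ v → f≡g (true ∷ v)))

    S-+ : ∀ {n} (f g : F₂^ n → Carrier) → S (λ v → f v + g v) ≡ S f + S g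
    S-+ {zero}  f g = refl
    S-+ {suc n} f g = trans (cong₂ _+_ (S-+ {n} _ _) (S-+ {n} _ _))
      (solve 4 (λ a b c d → (a :+ b) :+ (c :+ d) := (a :+ c) :+ (b :+ d)) refl _ _ _ _)

    S-*ˡ : ∀ {n} c (f : F₂^ n → Carrier) → S (λ v → c * f v) ≡ c * S f
    S-*ˡ {zero}  c f = refl
    S-*ˡ {suc n} c f = trans (cong₂ _+_ (S-*ˡ {n} c _) (S-*ˡ {n} c _)) (sym (distribˡ c _ _))

    S-*ʳ : ∀ {n} c (f : F₂^ n → Carrier) → S (λ v → f v * c) ≡ S f * c
    S-*ʳ c f = trans (S-cong (λ v → *-comm (f v) c)) (trans (S-*ˡ c f) (*-comm c _))

    S-mono : ∀ {n} {f g : F₂^ n → Carrier} → (∀ v → f v ≤ g v) → S f ≤ S g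
    S-mono {zero}  f≤g = f≤g []
    S-mono {suc n} f≤g = +-mono-≤ (S-mono (λ v → f≤g (false ∷ v))) (S-mono (λ v → f≤g (true ∷ v)))

    S-nonneg : ∀ {n} {f : F₂^ n → Carrier} → (∀ v → 0# ≤ f v) → 0# ≤ S f
    S-nonneg {zero}  f≥0 = f≥0 []
    S-nonneg {suc n} f≥0 = S-nonneg (λ v → f≥0 (false ∷ v)) ⟨+⟩ S-nonneg (λ v → f≥0 (true ∷ v))

    S-swap : ∀ {m n} (f : F₂^ m → F₂^ n → Carrier) → S (λ u → S (λ v → f u v)) ≡ S (λ v → S (λ u → f u v))
    S-swap {zero}  f = refl
    S-swap {suc m} {n} f = trans (cong₂ _+_ (S-swap (λ u → f (false ∷ u))) (S-swap (λ u → f (true ∷ u))))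
        (sym (S-+ {n} _ _))

    S-shift : ∀ {n} (f : F₂^ n → Carrier) x → S (λ v → f (v ⊕ x)) ≡ S f
    S-shift {zero}  f []          = refl
    S-shift {suc n} f (false ∷ x) = cong₂ _+_ (S-shift (λ v → f (false ∷ v)) x) (S-shift (λ v → f (true ∷ v)) x)
    S-shift {suc n} f (true ∷ x)  = trans (+-comm _ _)
      (cong₂ _+_ (S-shift (λ v → f (false ∷ v)) x) (S-shift (λ v → f (true ∷ v)) x))

    S-zero : ∀ {n} → S {n} (λ _ → 0#) ≡ 0#
    S-zero {zero}  = refl
    S-zero {suc n} = trans (cong₂ _+_ (S-zero {n}) (S-zero {n})) (+-identityˡ 0#)

    S-δ : ∀ {n} (f : F₂^ n → Carrier) a → S (λ b → f b * 𝟙 (isZero (a ⊕ b))) ≡ f a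
    S-δ {zero}  f []          = *-identityʳ _
    S-δ {suc n} f (false ∷ a) = trans
      (cong₂ _+_ (S-δ (λ v → f (false ∷ v)) a) (trans (S-cong {n} (λ v → zeroʳ (f (true ∷ v)))) (S-zero {n})))
          (+-identityʳ _)
    S-δ {suc n} f (true ∷ a)  = trans
      (cong₂ _+_ (trans (S-cong {n} (λ v → zeroʳ (f (false ∷ v)))) (S-zero {n})) (S-δ (λ v → f (true ∷ v)) a))
          (+-identityˡ _)

    S-term : ∀ {n} {f : F₂^ n → Carrier} → (∀ v → 0# ≤ f v) → ∀ v → f v ≤ S f
    S-term f≥0 []          = ≤-refl
    S-term f≥0 (false ∷ v) = ≤-trans (S-term (λ v → f≥0 (false ∷ v)) v)
      (≤-of-diff (S-nonneg (λ v → f≥0 (true ∷ v))) (+-comm _ _))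
    S-term f≥0 (true ∷ v)  = ≤-trans (S-term (λ v → f≥0 (true ∷ v)) v)
      (≤-of-diff (S-nonneg (λ v → f≥0 (false ∷ v))) refl)

  sgn : Bool → Carrier
  sgn false = 1#
  sgn true  = - 1#

  sgn-xor : ∀ a b → sgn (a xor b) ≡ sgn a * sgn b
  sgn-xor false b     = sym (*-identityˡ _)
  sgn-xor true  false = sym (*-identityʳ _)
  sgn-xor true  true  = solve 0 (⟨ 1 ⟩ := :- ⟨ 1 ⟩ :* :- ⟨ 1 ⟩) refl

  χ : ∀ {n} → F₂^ n → F₂^ n → Carrier
  χ ξ v = sgn (dot ξ v)

  χ-⊕ʳ : ∀ {n} (ξ u v : F₂^ n) → χ ξ (u ⊕ v) ≡ χ ξ u * χ ξ v
  χ-⊕ʳ ξ u v = trans (cong sgn (dot-⊕ʳ ξ u v)) (sgn-xor (dot ξ u) (dot ξ v))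

  χ-⊕ˡ : ∀ {n} (ξ η v : F₂^ n) → χ (ξ ⊕ η) v ≡ χ ξ v * χ η v
  χ-⊕ˡ ξ η v = trans (cong sgn (dot-⊕ˡ ξ η v)) (sgn-xor (dot ξ v) (dot η v))

  N : ℕ → Carrier
  N n = S {n} (λ _ → 1#)

  abstract

    orthogonality : ∀ {n} (v : F₂^ n) → S (λ ξ → χ ξ v) ≡ N n * 𝟙 (isZero v)
    orthogonality []          = sym (*-identityʳ 1#)
    orthogonality (false ∷ v) = trans (cong₂ _+_ (orthogonality v) (orthogonality v)) (sym (distribʳ _ _ _))
    -- Flipping the first bit of ξ reverses the sign of the character at v, so the two halves
    -- cancel.
    orthogonality {suc n} (true ∷ v)  = trans
      (cong (S (λ ξ → χ ξ v) +_) (trans (S-cong (λ ξ → sgn-xor true (dot ξ v))) (S-*ˡ {n} (- 1#) (λ ξ → χ ξ v))))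
      (solve 2 (λ s n → s :+ :- ⟨ 1 ⟩ :* s := n :* ⟨ 0 ⟩) refl _ _)

  infix 9 _̂_
  _̂_ : ∀ {n} → (F₂^ n → Carrier) → F₂^ n → Carrier
  f ̂ ξ = S (λ v → f v * χ ξ v)

  parseval : ∀ {n} (f : F₂^ n → Carrier) → S (λ ξ → f ̂ ξ * f ̂ ξ) ≡ N n * S (λ v → f v * f v)
  parseval {n} f = begin
    S (λ ξ → f ̂ ξ * f ̂ ξ)
      ≡⟨ S-cong (λ ξ → sym (S-*ʳ (f ̂ ξ) (λ a → f a * χ ξ a))) ⟩
    S (λ ξ → S (λ a → f a * χ ξ a * f ̂ ξ))
      ≡⟨ S-swap (λ ξ a → f a * χ ξ a * f ̂ ξ) ⟩
    S (λ a → S (λ ξ → f a * χ ξ a * f ̂ ξ))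
      ≡⟨ S-cong (λ a → trans (S-cong (λ ξ → sym (S-*ˡ _ (λ b → f b * χ ξ b))))
          (S-swap (λ ξ b → f a * χ ξ a * (f b * χ ξ b)))) ⟩
    S (λ a → S (λ b → S (λ ξ → f a * χ ξ a * (f b * χ ξ b))))
      ≡⟨ S-cong (λ a → trans (S-cong (λ b → inner a b)) (S-*ˡ _ _)) ⟩
    S (λ a → N n * f a * S (λ b → f b * 𝟙 (isZero (a ⊕ b))))
      ≡⟨ S-cong (λ a → trans (cong (N n * f a *_) (S-δ f a)) (*-assoc _ _ _)) ⟩
    S (λ a → N n * (f a * f a))
      ≡⟨ S-*ˡ _ _ ⟩
    N n * S (λ v → f v * f v) ∎
    where
    open ≡-Reasoning
    inner : ∀ a b → S (λ ξ → f a * χ ξ a * (f b * χ ξ b)) ≡ N n * f a * (f b * 𝟙 (isZero (a ⊕ b)))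
    inner a b = begin
      S (λ ξ → f a * χ ξ a * (f b * χ ξ b))
        ≡⟨ S-cong (λ ξ → trans (solve 4 (λ x s y t → x :* s :* (y :* t) := x :* y :* (s :* t)) refl (f a)
            (χ ξ a) (f b) (χ ξ b))
                               (cong (f a * f b *_) (sym (χ-⊕ʳ ξ a b)))) ⟩
      S (λ ξ → f a * f b * χ ξ (a ⊕ b))
        ≡⟨ trans (S-*ˡ _ _) (cong (f a * f b *_) (orthogonality (a ⊕ b))) ⟩
      f a * f b * (N n * 𝟙 (isZero (a ⊕ b)))
        ≡⟨ solve 4 (λ x y n z → x :* y :* (n :* z) := n :* x :* (y :* z)) refl _ _ _ _ ⟩
      N n * f a * (f b * 𝟙 (isZero (a ⊕ b))) ∎

  S₄ : ∀ {n} → (F₂^ n → F₂^ n → F₂^ n → F₂^ n → Carrier) → Carrier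
  S₄ h = S λ a → S λ b → S λ c → S λ d → h a b c d

  S₄-cong : ∀ {n} {h k : F₂^ n → F₂^ n → F₂^ n → F₂^ n → Carrier} → (∀ a b c d → h a b c d ≡ k a b c d) → S₄ h ≡ S₄ k
  S₄-cong h≡k = S-cong λ a → S-cong λ b → S-cong λ c → S-cong λ d → h≡k a b c d

  S₄-*ˡ : ∀ {n} x (h : F₂^ n → F₂^ n → F₂^ n → F₂^ n → Carrier) → S₄ (λ a b c d → x * h a b c d) ≡ x * S₄ h
  S₄-*ˡ x h = trans (S-cong λ a → trans (S-cong λ b → trans (S-cong λ c → S-*ˡ x _) (S-*ˡ x _)) (S-*ˡ x _)) (S-*ˡ x _)

  S₄-+ : ∀ {n} (h k : F₂^ n → F₂^ n → F₂^ n → F₂^ n → Carrier) → S₄ (λ a b c d → h a b c d + k a b c d) ≡ S₄ h + S₄ k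
  S₄-+ h k = trans (S-cong λ a → trans (S-cong λ b → trans (S-cong λ c → S-+ _ _) (S-+ _ _)) (S-+ _ _)) (S-+ _ _)

  S₄-swap : ∀ {m n} (h : F₂^ m → F₂^ n → F₂^ n → F₂^ n → F₂^ n → Carrier) →
            S (λ ξ → S₄ (h ξ)) ≡ S₄ (λ a b c d → S (λ ξ → h ξ a b c d))
  S₄-swap h = trans (S-swap _) (S-cong λ a → trans (S-swap _) (S-cong λ b → trans (S-swap _) (S-cong λ c → S-swap _)))

  S₄-product : ∀ {n} (f : Fin 4 → F₂^ n → Carrier) →
    S₄ (λ a b c d → f zero a * f (suc zero) b * f (suc (suc zero)) c * f (suc (suc (suc zero))) d) ≡ ∏ (λ i → S (f i))
  S₄-product f =
    trans (S-cong λ a → trans (S-cong λ b → trans (S-cong λ c → S-*ˡ _ _)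
        (trans (S-*ʳ S₃ _) (cong (_* S₃) (S-*ˡ _ _))))
      (trans (S-*ʳ S₃ _) (cong (_* S₃) (trans (S-*ʳ S₂ _) (cong (_* S₂) (S-*ˡ _ _))))))
    (trans (S-*ʳ S₃ _) (cong (_* S₃) (trans (S-*ʳ S₂ _) (cong (_* S₂) (S-*ʳ _ _)))))
    where
    S₂ = S (f (suc (suc zero)))
    S₃ = S (f (suc (suc (suc zero))))

  -- One form for both counts: with g the indicator of 0 it is the energy, with g the indicator of H
  -- it counts the quadruples whose sum lies in H.
  T : ∀ {n} → (F₂^ n → Carrier) → (Fin 4 → F₂^ n → Carrier) → Carrier
  T g f = S₄ (λ a b c d → f zero a * f (suc zero) b * f (suc (suc zero)) c * f (suc (suc (suc zero))) d * g
      (a ⊕ b ⊕ c ⊕ d))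

  T-χ : ∀ {n} (ξ : F₂^ n) f → T (χ ξ) f ≡ ∏ (λ i → f i ̂ ξ)
  T-χ ξ f = trans (S₄-cong (λ a b c d → trans
      (cong (_ *_) (trans (χ-⊕ʳ ξ (a ⊕ b ⊕ c) d)
          (cong (_* χ ξ d) (trans (χ-⊕ʳ ξ (a ⊕ b) c) (cong (_* χ ξ c) (χ-⊕ʳ ξ a b))))))
      (solve 8 (λ x y z t a b c d → x :* y :* z :* t :* (a :* b :* c :* d) := (x :* a) :* (y :* b) :* (z :* c)
          :* (t :* d)) refl
        _ _ _ _ (χ ξ a) (χ ξ b) (χ ξ c) (χ ξ d))))
    (S₄-product (λ i v → f i v * χ ξ v))

  -- Functions with nonnegative Fourier coefficients, that is, positive definite ones; `scale`
  -- avoids a division. The sign is what allows Hölder's inequality with `coeff` as the weight.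
  record FourierExpansion {n} (g : F₂^ n → Carrier) : Set where
    field
      scale       : Carrier
      scale>0     : Positive scale
      coeff       : F₂^ n → Carrier
      coeff≥0     : ∀ ξ → 0# ≤ coeff ξ
      expansion   : ∀ v → scale * g v ≡ S (λ ξ → coeff ξ * χ ξ v)

  module _ {n : ℕ} {g : F₂^ n → Carrier} (G : FourierExpansion g) where

    open FourierExpansion G

    T-expansion : ∀ f → scale * T g f ≡ S (λ ξ → coeff ξ * ∏ (λ i → f i ̂ ξ))
    T-expansion f = begin
      scale * T g f
        ≡⟨ sym (S₄-*ˡ scale _) ⟩
      S₄ (λ a b c d → scale * (X a b c d * g (a ⊕ b ⊕ c ⊕ d)))
        ≡⟨ S₄-cong (λ a b c d → trans (swapˡ scale (X a b c d) _)
            (trans (cong (X a b c d *_) (expansion _)) (sym (S-*ˡ _ _)))) ⟩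
      S₄ (λ a b c d → S (λ ξ → X a b c d * (coeff ξ * χ ξ (a ⊕ b ⊕ c ⊕ d))))
        ≡⟨ sym (S₄-swap _) ⟩
      S (λ ξ → S₄ (λ a b c d → X a b c d * (coeff ξ * χ ξ (a ⊕ b ⊕ c ⊕ d))))
        ≡⟨ S-cong (λ ξ → trans (S₄-cong (λ a b c d → swapˡ (X a b c d) (coeff ξ) _))
            (trans (S₄-*ˡ _ _) (cong (coeff ξ *_) (T-χ ξ f)))) ⟩
      S (λ ξ → coeff ξ * ∏ (λ i → f i ̂ ξ)) ∎
      where
      open ≡-Reasoning
      X : F₂^ n → F₂^ n → F₂^ n → F₂^ n → Carrier
      X a b c d = f zero a * f (suc zero) b * f (suc (suc zero)) c * f (suc (suc (suc zero))) d
      swapˡ : ∀ x y z → x * (y * z) ≡ y * (x * z)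
      swapˡ = solve 3 (λ x y z → x :* (y :* z) := y :* (x :* z)) refl

  abstract

    cauchy-schwarz : ∀ {n} (c f g : F₂^ n → Carrier) → (∀ v → 0# ≤ c v) →
      S (λ v → c v * (f v * g v)) ^ 2 ≤ S (λ v → c v * (f v * f v)) * S (λ v → c v * (g v * g v))
    cauchy-schwarz {zero} c f g c≥0 = ≤-reflexive
      (solve 3 (λ c f g → (c :* (f :* g)) :^ 2 := (c :* (f :* f)) :* (c :* (g :* g))) refl (c []) (f []) (g []))
    cauchy-schwarz {suc n} c f g c≥0 = combine
        (sq≥0 _ _ (λ v → c≥0 (false ∷ v))) (sq≥0 _ _ (λ v → c≥0 (true ∷ v))) (sq≥0 _ _ (λ v → c≥0 (false ∷ v)))
            (sq≥0 _ _ (λ v → c≥0 (true ∷ v)))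
        (cauchy-schwarz {n} _ _ _ (λ v → c≥0 (false ∷ v))) (cauchy-schwarz {n} _ _ _ (λ v → c≥0 (true ∷ v)))
      where
      sq≥0 : ∀ (c f : F₂^ n → Carrier) → (∀ v → 0# ≤ c v) → 0# ≤ S (λ v → c v * (f v * f v))
      sq≥0 c f c≥0 = S-nonneg (λ v → c≥0 v ⟨*⟩ square-nonneg (f v))
      combine : ∀ {a₁ a₂ b₁ b₂ c₁ c₂} → 0# ≤ b₁ → 0# ≤ b₂ → 0# ≤ c₁ → 0# ≤ c₂ →
                a₁ ^ 2 ≤ b₁ * c₁ → a₂ ^ 2 ≤ b₂ * c₂ → (a₁ + a₂) ^ 2 ≤ (b₁ + b₂) * (c₁ + c₂)
      combine {a₁} {a₂} {b₁} {b₂} {c₁} {c₂} b₁≥0 b₂≥0 c₁≥0 c₂≥0 h₁ h₂ = ≤-of-diff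
        (diff-nonneg h₁ ⟨+⟩ diff-nonneg h₂ ⟨+⟩ diff-nonneg cross)
        (solve 6 (λ a₁ a₂ b₁ b₂ c₁ c₂ → (b₁ :+ b₂) :* (c₁ :+ c₂) :=
          (b₁ :* c₁ :- a₁ :^ 2 :+ (b₂ :* c₂ :- a₂ :^ 2) :+ (b₁ :* c₂ :+ b₂ :* c₁ :- ⟨ 2 ⟩ :* (a₁ :* a₂)))
              :+ (a₁ :+ a₂) :^ 2)
          refl a₁ a₂ b₁ b₂ c₁ c₂)
        where
        -- 2a₁a₂ ≤ 2√(b₁c₂ · b₂c₁) ≤ b₁c₂ + b₂c₁, with both sides squared; AM-GM appears as the
        -- square of b₁c₂ - b₂c₁.
        cross : # 2 * (a₁ * a₂) ≤ b₁ * c₂ + b₂ * c₁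
        cross = ^-cancel-≤ 1 (b₁≥0 ⟨*⟩ c₂≥0 ⟨+⟩ b₂≥0 ⟨*⟩ c₁≥0) (≤-of-diff
          (square-nonneg (b₁ * c₂ - b₂ * c₁) ⟨+⟩ #-nonneg 4 ⟨*⟩ diff-nonneg
            (*-mono-≤ (^-nonneg-even a₁) (b₂≥0 ⟨*⟩ c₂≥0) h₁ h₂))
          (solve 6 (λ a₁ a₂ b₁ b₂ c₁ c₂ → (b₁ :* c₂ :+ b₂ :* c₁) :^ 2 :=
            ((b₁ :* c₂ :- b₂ :* c₁) :* (b₁ :* c₂ :- b₂ :* c₁) :+ ⟨ 4 ⟩
                :* ((b₁ :* c₁) :* (b₂ :* c₂) :- a₁ :^ 2 :* a₂ :^ 2))
            :+ (⟨ 2 ⟩ :* (a₁ :* a₂)) :^ 2) refl a₁ a₂ b₁ b₂ c₁ c₂))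
          where
          ^-nonneg-even : ∀ x → 0# ≤ x ^ 2
          ^-nonneg-even x = subst (0# ≤_) (solve 1 (λ x → x :* x := x :^ 2) refl x) (square-nonneg x)

  -- Cauchy-Schwarz twice: first for the products f₀f₁ and f₂f₃, then inside each of these two
  -- pairs.
  hölder : ∀ {n} (c : F₂^ n → Carrier) (f : Fin 4 → F₂^ n → Carrier) → (∀ v → 0# ≤ c v) →
    S (λ v → c v * ∏ (λ i → f i v)) ^ 4 ≤ ∏ (λ i → S (λ v → c v * f i v ^ 4))
  hölder {n} c f c≥0 = subst₂ _≤_
    (trans (^-assocʳ X 2 2) (cong (_^ 4) (S-cong (λ v → cong (c v *_) (sym (*-assoc _ _ _))))))
    (*-assoc′ _ _ _ _)
    (≤-trans (^-mono-≤ 2 (subst (0# ≤_) (square X) (square-nonneg X)) (cauchy-schwarz c _ _ c≥0))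
      (subst (_≤ fourth-moment zero * fourth-moment (suc zero)
          * (fourth-moment (suc (suc zero)) * fourth-moment (suc (suc (suc zero))))) (sym (^-distrib-* _ _ 2))
        (*-mono-≤ (subst (0# ≤_) (square _) (square-nonneg _)) (fourth≥0 _ ⟨*⟩ fourth≥0 _) (half _ _) (half _ _))))
    where
    X : Carrier
    X = S (λ v → c v * (f zero v * f (suc zero) v * (f (suc (suc zero)) v * f (suc (suc (suc zero))) v)))
    square : ∀ x → x * x ≡ x ^ 2
    square = solve 1 (λ x → x :* x := x :^ 2) refl
    *-assoc′ : ∀ a b c d → (a * b) * (c * d) ≡ a * b * c * d
    *-assoc′ = solve 4 (λ a b c d → (a :* b) :* (c :* d) := a :* b :* c :* d) refl
    fourth-moment : Fin 4 → Carrier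
    fourth-moment i = S (λ v → c v * f i v ^ 4)
    fourth≥0 : ∀ i → 0# ≤ fourth-moment i
    fourth≥0 i = S-nonneg (λ v → c≥0 v ⟨*⟩ subst (0# ≤_) (solve 1 (λ x → (x :* x) :* (x :* x) := x :^ 4)
        refl (f i v)) (square-nonneg _))
    half : ∀ i j → S (λ v → c v * ((f i v * f j v) * (f i v * f j v))) ^ 2 ≤ S (λ v → c v * f i v ^ 4) * S
        (λ v → c v * f j v ^ 4)
    half i j = subst₂ _≤_
      (cong (_^ 2) (S-cong (λ v → cong (c v *_) (solve 2 (λ x y → (x :* x) :* (y :* y) := (x :* y) :* (x :* y))
          refl (f i v) (f j v)))))
      (cong₂ _*_ (S-cong (λ v → cong (c v *_) (fourth (f i v)))) (S-cong (λ v → cong (c v *_) (fourth (f j v)))))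
      (cauchy-schwarz c (λ v → f i v * f i v) (λ v → f j v * f j v) c≥0)
      where
      fourth : ∀ x → (x * x) * (x * x) ≡ x ^ 4
      fourth = solve 1 (λ x → (x :* x) :* (x :* x) := x :^ 4) refl

  -- On the Fourier side T is a weighted sum of products of four transforms. Hölder separates them,
  -- and each resulting fourth moment is again a form T, with four equal functions.
  T-hölder : ∀ {n} {g : F₂^ n → Carrier} → FourierExpansion g → ∀ f → T g f ^ 4 ≤ ∏ (λ i → T g (λ _ → f i))
  T-hölder {n} {g} G f = *-cancelˡ-≤ (^-positive 4 scale>0) (subst₂ _≤_
    (trans (cong (_^ 4) (sym (T-expansion G f))) (^-distrib-* scale (T g f) 4))
    (trans (∏-cong (λ i → trans (S-cong (λ ξ → cong (coeff ξ *_) (fourth (f i ̂ ξ))))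
        (sym (T-expansion G (λ _ → f i)))))
      (trans (∏-* (λ _ → scale) (λ i → T g (λ _ → f i))) (cong (_* ∏ (λ i → T g (λ _ → f i))) (sym (fourth scale)))))
    (hölder coeff (λ i ξ → f i ̂ ξ) coeff≥0))
    where
    open FourierExpansion G
    fourth : ∀ x → x ^ 4 ≡ x * x * x * x
    fourth = solve 1 (λ x → x :^ 4 := x :* x :* x :* x) refl
    ∏-cong : ∀ {f g : Fin 4 → Carrier} → (∀ i → f i ≡ g i) → ∏ f ≡ ∏ g
    ∏-cong f≡g = cong₂ _*_ (cong₂ _*_ (cong₂ _*_ (f≡g _) (f≡g _)) (f≡g _)) (f≡g _)

  -- Three variables are summed freely; once they are fixed, the last one contributes at most M.
  T-trivial-bound : ∀ {n} {g f : F₂^ n → Carrier} {M} → (∀ v → 0# ≤ f v) →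
    (∀ x → S (λ d → f d * g (x ⊕ d)) ≤ M) → T g (λ _ → f) ≤ M * S f ^ 3
  T-trivial-bound {n} {g} {f} {M} f≥0 bound = subst (T g (λ _ → f) ≤_) factored
    (S-mono λ a → S-mono λ b → S-mono λ c → subst (_≤ f a * f b * f c * M)
      (trans (sym (S-*ˡ _ _)) (S-cong (λ d → sym (*-assoc _ _ _))))
      (*-monoˡ-≤ (f≥0 a ⟨*⟩ f≥0 b ⟨*⟩ f≥0 c) (bound (a ⊕ b ⊕ c))))
    where
    factored : S (λ a → S λ b → S λ c → f a * f b * f c * M) ≡ M * S f ^ 3
    factored = trans (S-cong λ a → trans (S-cong λ b → trans (S-*ʳ _ _) (cong (_* M) (S-*ˡ _ _)))
                     (trans (S-*ʳ _ _) (cong (_* M) (trans (S-*ʳ _ _) (cong (_* S f) (S-*ˡ _ _))))))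
            (trans (S-*ʳ _ _) (trans (cong (_* M) (trans (S-*ʳ _ _) (cong (_* S f) (S-*ʳ _ _))))
              (solve 2 (λ s m → s :* s :* s :* m := m :* s :^ 3) refl (S f) M)))

-- Annihilators as decidable subspaces.

allV : ∀ {n} → (F₂^ n → Bool) → Bool
allV {zero}  P = P []
allV {suc n} P = allV (λ v → P (false ∷ v)) ∧ allV (λ v → P (true ∷ v))

∧-true : ∀ {a b} → a ∧ b ≡ true → a ≡ true × b ≡ true
∧-true {true} b≡true = refl , b≡true

allV-elim : ∀ {n} (P : F₂^ n → Bool) → allV P ≡ true → ∀ v → P v ≡ true
allV-elim P all []          = all
allV-elim P all (false ∷ v) = allV-elim (λ v → P (false ∷ v)) (proj₁ (∧-true all)) v
allV-elim P all (true ∷ v)  = allV-elim (λ v → P (true ∷ v)) (proj₂ (∧-true all)) v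

allV-intro : ∀ {n} (P : F₂^ n → Bool) → (∀ v → P v ≡ true) → allV P ≡ true
allV-intro {zero}  P all = all []
allV-intro {suc n} P all = cong₂ _∧_ (allV-intro _ (λ v → all (false ∷ v))) (allV-intro _ (λ v → all (true ∷ v)))

allV-false : ∀ {n} (P : F₂^ n → Bool) → allV P ≡ false → ∃ λ v → P v ≡ false
allV-false {zero}  P none = [] , none
allV-false {suc n} P none with allV (λ v → P (false ∷ v)) in eq
... | false = let v , Pv = allV-false _ eq in (false ∷ v) , Pv
... | true  = let v , Pv = allV-false _ none in (true ∷ v) , Pv

annihilator : ∀ {n} → Subset n → Subset n
annihilator W v = allV (λ ξ → not (W ξ ∧ dot ξ v))

annihilator-elim : ∀ {n} (W : Subset n) {v} → annihilator W v ≡ true → ∀ ξ → W ξ ≡ true → dot ξ v ≡ false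
annihilator-elim W {v} Hv ξ Wξ with allV-elim (λ ξ → not (W ξ ∧ dot ξ v)) Hv ξ
... | eq rewrite Wξ with dot ξ v
... | false = refl

annihilator-intro : ∀ {n} (W : Subset n) {v} → (∀ ξ → W ξ ≡ true → dot ξ v ≡ false) → annihilator W v ≡ true
annihilator-intro W {v} ⊥v = allV-intro _ λ ξ → lemma ξ (⊥v ξ)
  where
  lemma : ∀ ξ → (W ξ ≡ true → dot ξ v ≡ false) → not (W ξ ∧ dot ξ v) ≡ true
  lemma ξ h with W ξ
  ... | false = refl
  ... | true rewrite h refl = refl

annihilator-isSubspace : ∀ {n} (W : Subset n) → IsSubspace (annihilator W)
annihilator-isSubspace W = record
  { zero∈   = annihilator-intro W (λ ξ _ → dot-zeroʳ ξ)
  ; closed+ = λ u v Hu Hv → annihilator-intro W λ ξ Wξ → trans (dot-⊕ʳ ξ u v)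
      (cong₂ _xor_ (annihilator-elim W Hu ξ Wξ) (annihilator-elim W Hv ξ Wξ))
  }

-- The subspace determined by a flat quadruple.

module Structure (F : OrderedField) where

  open OrderedFieldProperties F
  open KeyInequality F using (∏)
  open Dichotomy F using (∏-*; ∏-^; ∏-nonneg; ∏-mono; ∏-positive)
  open Fourier F

  size : ∀ {n} → Subset n → Carrier
  size A = S (λ v → 𝟙 (A v))

  size-nonneg : ∀ {n} (A : Subset n) → 0# ≤ size A
  size-nonneg A = S-nonneg (λ v → 𝟙-nonneg (A v))

  size-positive : ∀ {n} (A : Subset n) v → A v ≡ true → Positive (size A)
  size-positive A v Av = positive-≤ 1≰0
    (subst (λ b → 𝟙 b ≤ size A) Av (S-term {f = λ v → 𝟙 (A v)} (λ v → 𝟙-nonneg (A v)) v))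

  argmax : ∀ {n} (f : F₂^ n → Carrier) → ∃ λ x → ∀ y → f y ≤ f x
  argmax {zero}  f = [] , λ { [] → ≤-refl }
  argmax {suc n} f with argmax (λ v → f (false ∷ v)) | argmax (λ v → f (true ∷ v))
  ... | x , max-x | y , max-y with total (f (false ∷ x)) (f (true ∷ y))
  ... | inj₁ x≤y = (true ∷ y) , λ { (false ∷ v) → ≤-trans (max-x v) x≤y ; (true ∷ v) → max-y v }
  ... | inj₂ y≤x = (false ∷ x) , λ { (false ∷ v) → max-x v ; (true ∷ v) → ≤-trans (max-y v) y≤x }

  𝟙-∧ : ∀ a b → 𝟙 (a ∧ b) ≡ 𝟙 a * 𝟙 b
  𝟙-∧ true  b = sym (*-identityˡ _)
  𝟙-∧ false b = sym (zeroˡ _)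

  module Annihilator {n : ℕ} (W : Subset n) (0∈W : W 0v ≡ true)
                     (W-closed : ∀ ξ η → W ξ ≡ true → W η ≡ true → W (ξ ⊕ η) ≡ true) where

    H : Subset n
    H = annihilator W

    W-shift : ∀ ξ η → W η ≡ true → W (ξ ⊕ η) ≡ W ξ
    W-shift ξ η Wη with W ξ in Wξ | W (ξ ⊕ η) in Wξη
    ... | true  | true  = refl
    ... | false | false = refl
    ... | true  | false = trans (sym Wξη) (W-closed ξ η Wξ Wη)
    ... | false | true  = trans (sym (trans (sym (cong W (⊕-cancelʳ ξ η))) (W-closed (ξ ⊕ η) η Wξη Wη))) Wξ

    -- For v in H every character in W equals 1 at v. Otherwise some η in W has χ_η(v) = -1;
    -- translation by η preserves W and reverses the sign of the sum, which therefore vanishes.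
    annihilator-expansion : ∀ v → size W * 𝟙 (H v) ≡ S (λ ξ → 𝟙 (W ξ) * χ ξ v)
    annihilator-expansion v with H v in Hv
    ... | true = trans (*-identityʳ _) (S-cong λ ξ → lemma ξ (annihilator-elim W Hv ξ))
      where
      lemma : ∀ ξ → (W ξ ≡ true → dot ξ v ≡ false) → 𝟙 (W ξ) ≡ 𝟙 (W ξ) * χ ξ v
      lemma ξ h with W ξ
      ... | true  = sym (trans (*-identityˡ _) (cong sgn (h refl)))
      ... | false = sym (zeroˡ _)
    ... | false = trans (zeroʳ _) (sym X≡0)
      where
      X : Carrier
      X = S (λ ξ → 𝟙 (W ξ) * χ ξ v)
      witness = allV-false (λ ξ → not (W ξ ∧ dot ξ v)) Hv
      η = proj₁ witness
      W∧dot : W η ∧ dot η v ≡ true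
      W∧dot with W η ∧ dot η v | proj₂ witness
      ... | true | _ = refl
      Wη = proj₁ (∧-true {W η} W∧dot)
      X≡-X : X ≡ - 1# * X
      X≡-X = trans (sym (S-shift (λ ξ → 𝟙 (W ξ) * χ ξ v) η)) (trans
        (S-cong (λ ξ → trans
          (cong₂ _*_ (cong 𝟙 (W-shift ξ η Wη)) (trans (χ-⊕ˡ ξ η v)
              (cong (λ b → χ ξ v * sgn b) (proj₂ (∧-true {W η} W∧dot)))))
          (solve 2 (λ a x → a :* (x :* :- ⟨ 1 ⟩) := :- ⟨ 1 ⟩ :* (a :* x)) refl (𝟙 (W ξ)) (χ ξ v))))
        (S-*ˡ (- 1#) _))
      2X≡0 : # 2 * X ≡ # 2 * 0#
      2X≡0 = trans (solve 1 (λ x → ⟨ 2 ⟩ :* x := x :+ x) refl X)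
        (trans (cong (X +_) X≡-X) (solve 1 (λ x → x :+ :- ⟨ 1 ⟩ :* x := ⟨ 2 ⟩ :* ⟨ 0 ⟩) refl X))
      X≡0 : X ≡ 0#
      X≡0 = antisym (*-cancelˡ-≤ (#-positive 1) (≤-reflexive 2X≡0))
          (*-cancelˡ-≤ (#-positive 1) (≤-reflexive (sym 2X≡0)))

    W-positive : Positive (size W)
    W-positive = size-positive W 0v 0∈W

    H-expansion : FourierExpansion (λ v → 𝟙 (H v))
    H-expansion = record
      { scale = size W ; scale>0 = W-positive
      ; coeff = λ ξ → 𝟙 (W ξ) ; coeff≥0 = λ ξ → 𝟙-nonneg (W ξ)
      ; expansion = annihilator-expansion }

    -- Summing `annihilator-expansion` over v leaves only the trivial character, by orthogonality.
    size-duality : size W * size H ≡ N n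
    size-duality = begin
      size W * size H                                   ≡⟨ sym (S-*ˡ (size W) _) ⟩
      S (λ v → size W * 𝟙 (H v))                        ≡⟨ S-cong annihilator-expansion ⟩
      S (λ v → S (λ ξ → 𝟙 (W ξ) * χ ξ v))              ≡⟨ S-swap _ ⟩
      S (λ ξ → S (λ v → 𝟙 (W ξ) * χ ξ v))              ≡⟨ S-cong
          (λ ξ → trans (S-*ˡ _ _) (cong (𝟙 (W ξ) *_) (χ-sum ξ))) ⟩
      S (λ ξ → 𝟙 (W ξ) * (N n * 𝟙 (isZero (0v ⊕ ξ)))) ≡⟨ S-cong (λ ξ → sym (*-assoc _ _ _)) ⟩
      S (λ ξ → 𝟙 (W ξ) * N n * 𝟙 (isZero (0v ⊕ ξ)))   ≡⟨ S-δ (λ ξ → 𝟙 (W ξ) * N n) 0v ⟩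
      𝟙 (W 0v) * N n                                    ≡⟨ cong (λ b → 𝟙 b * N n) 0∈W ⟩
      1# * N n                                          ≡⟨ *-identityˡ _ ⟩
      N n                                               ∎
      where
      open ≡-Reasoning
      χ-sum : ∀ ξ → S (λ v → χ ξ v) ≡ N n * 𝟙 (isZero (0v ⊕ ξ))
      χ-sum ξ = trans (S-cong (λ v → cong sgn (dot-comm ξ v)))
        (trans (orthogonality ξ) (cong (λ z → N n * 𝟙 (isZero z)) (sym (trans (⊕-comm 0v ξ) (⊕-identityʳ ξ)))))

  zero-expansion : ∀ {n} → FourierExpansion {n} (λ v → 𝟙 (isZero v))
  zero-expansion {n} = record
    { scale = N n ; scale>0 = size-positive {n} (λ _ → true) 0v refl
    ; coeff = λ _ → 1# ; coeff≥0 = λ _ → #-nonneg 1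
    ; expansion = λ v → trans (sym (orthogonality v)) (S-cong (λ ξ → sym (*-identityˡ _))) }

  indicator : ∀ {n} → (Fin 4 → Subset n) → Fin 4 → F₂^ n → Carrier
  indicator A i v = 𝟙 (A i v)

  E : ∀ {n} → (Fin 4 → Subset n) → Carrier
  E A = T (λ v → 𝟙 (isZero v)) (indicator A)

  T-nonneg : ∀ {n} {g : F₂^ n → Carrier} {f} → (∀ v → 0# ≤ g v) → (∀ i v → 0# ≤ f i v) → 0# ≤ T g f
  T-nonneg g≥0 f≥0 = S-nonneg λ a → S-nonneg λ b → S-nonneg λ c → S-nonneg λ d →
    f≥0 _ a ⟨*⟩ f≥0 _ b ⟨*⟩ f≥0 _ c ⟨*⟩ f≥0 _ d ⟨*⟩ g≥0 _

  E-nonneg : ∀ {n} (A : Fin 4 → Subset n) → 0# ≤ E A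
  E-nonneg A = T-nonneg (λ v → 𝟙-nonneg (isZero v)) (λ i v → 𝟙-nonneg (A i v))

  T-bound : ∀ {n} {g : F₂^ n → Carrier} → FourierExpansion g → (∀ v → 0# ≤ g v) → ∀ (A : Fin 4 → Subset n)
      (M : Fin 4 → Carrier) →
    (∀ i x → S (λ d → 𝟙 (A i d) * g (x ⊕ d)) ≤ M i) →
    T g (indicator A) ^ 4 ≤ ∏ M * ∏ (λ i → size (A i)) ^ 3
  T-bound {g = g} G g≥0 A M bound = ≤-trans (T-hölder G (indicator A))
    (subst (∏ (λ i → T g (λ _ → indicator A i)) ≤_)
        (trans (∏-* M (λ i → size (A i) ^ 3)) (cong (∏ M *_) (∏-^ (λ i → size (A i)) 3)))
      (∏-mono (λ i → T-nonneg g≥0 (λ _ v → 𝟙-nonneg (A i v)))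
        (λ i → T-trivial-bound {g = g} {f = indicator A i} {M i} (λ v → 𝟙-nonneg (A i v)) (bound i))))

  𝟙-≤1 : ∀ b → 𝟙 b ≤ 1#
  𝟙-≤1 true  = ≤-refl
  𝟙-≤1 false = #-nonneg 1

  -- With g the indicator of 0 the last variable is determined by the others, so every Mᵢ can be 1.
  -- This caps the potential, and thereby the shrinking of the sets.
  E-bound : ∀ {n} (A : Fin 4 → Subset n) → E A ^ 4 ≤ ∏ (λ i → size (A i)) ^ 3
  E-bound A = subst (E A ^ 4 ≤_) (trans (cong (_* P)
      (solve 0 (⟨ 1 ⟩ :* ⟨ 1 ⟩ :* ⟨ 1 ⟩ :* ⟨ 1 ⟩ := ⟨ 1 ⟩) refl)) (*-identityˡ P))
    (T-bound zero-expansion (λ v → 𝟙-nonneg (isZero v)) A (λ _ → 1#)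
      (λ i x → subst (_≤ 1#) (sym (S-δ (λ d → 𝟙 (A i d)) x)) (𝟙-≤1 (A i x))))
    where P = ∏ (λ i → size (A i)) ^ 3

  sign : ∀ x → ∃ λ s → 0# ≤ sgn s * x
  sign x with total 0# x
  ... | inj₁ x≥0 = false , subst (0# ≤_) (sym (*-identityˡ x)) x≥0
  ... | inj₂ x≤0 = true , subst (0# ≤_) (solve 1 (λ x → ⟨ 0 ⟩ :- x := :- ⟨ 1 ⟩ :* x) refl x) (diff-nonneg x≤0)

  sgn-square : ∀ s → sgn s * sgn s ≡ 1#
  sgn-square false = *-identityˡ 1#
  sgn-square true  = solve 0 (:- ⟨ 1 ⟩ :* :- ⟨ 1 ⟩ := ⟨ 1 ⟩) refl

  1-sgn≥0 : ∀ s b → 0# ≤ 1# - sgn s * sgn b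
  1-sgn≥0 s b = subst (λ z → 0# ≤ 1# - z) (sgn-xor s b) (lemma (s xor b))
    where
    lemma : ∀ b → 0# ≤ 1# - sgn b
    lemma false = ≤-reflexive (sym (-‿inverseʳ 1#))
    lemma true  = subst (0# ≤_) (solve 0 (⟨ 2 ⟩ := ⟨ 1 ⟩ :- :- ⟨ 1 ⟩) refl) (#-nonneg 2)

  -- Since (1 − σ χ_ξ)(1 − τ χ_η) ≥ 0 for all signs σ and τ, near-maximal coefficients at ξ and η force a large one at ξ ⊕ η.
  large-⊕ : ∀ {n} (A : Subset n) (ξ η : F₂^ n) → let f = λ v → 𝟙 (A v) ; a = size A in Positive a →
    # 15 * (a * a) ≤ # 16 * (f ̂ ξ * f ̂ ξ) → # 15 * (a * a) ≤ # 16 * (f ̂ η * f ̂ η) →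
    # 16 * (f ̂ (ξ ⊕ η) * f ̂ (ξ ⊕ η)) ≤ a * a → ⊥
  large-⊕ {n} A ξ η a>0 large-ξ large-η small = *-positive (#-positive 179) (*-positive a>0 a>0)
    (≤-of-diff (#-nonneg 16 ⟨*⟩ diff-nonneg (subst (λ z → # 16 * z ≤ a * a) (sym t²≡) small) ⟨+⟩ t-excess
        ⟨*⟩ (t-excess ⟨+⟩ #-nonneg 28 ⟨*⟩ a≥0))
      (solve 2 (λ a t → ⟨ 0 ⟩ := (⟨ 16 ⟩ :* (a :* a :- ⟨ 16 ⟩ :* (t :* t)) :+ (⟨ 16 ⟩ :* t :- ⟨ 14 ⟩ :* a)
          :* ((⟨ 16 ⟩ :* t :- ⟨ 14 ⟩ :* a) :+ ⟨ 28 ⟩ :* a)) :+ ⟨ 180 ⟩ :* (a :* a)) refl a t))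
    where
    f : F₂^ n → Carrier
    f v = 𝟙 (A v)
    a y z t σ τ : Carrier
    a = size A
    σ = sgn (proj₁ (sign (f ̂ ξ)))
    τ = sgn (proj₁ (sign (f ̂ η)))
    y = σ * f ̂ ξ
    z = τ * f ̂ η
    t = σ * τ * f ̂ (ξ ⊕ η)
    a≥0 = positive⇒nonneg a>0
    σ²≡1 = sgn-square (proj₁ (sign (f ̂ ξ)))
    τ²≡1 = sgn-square (proj₁ (sign (f ̂ η)))
    large-abs : ∀ {s x} → s * s ≡ 1# → 0# ≤ s * x → # 15 * (a * a) ≤ # 16 * (x * x) → # 15 * a ≤ # 16 * (s * x)
    large-abs {s} {x} s²≡1 sx≥0 large = ^-cancel-≤ 1 (#-nonneg 16 ⟨*⟩ sx≥0)
      (subst ((# 15 * a) ^ 2 ≤_) (trans (cong (λ w → # 256 * (w * (x * x))) (sym s²≡1))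
          (solve 2 (λ s x → ⟨ 256 ⟩ :* (s :* s :* (x :* x)) := (⟨ 16 ⟩ :* (s :* x)) :^ 2) refl s x))
        (≤-of-diff (#-nonneg 16 ⟨*⟩ diff-nonneg large ⟨+⟩ #-nonneg 15 ⟨*⟩ (a≥0 ⟨*⟩ a≥0))
          (solve 2 (λ a x → ⟨ 256 ⟩ :* (⟨ 1 ⟩ :* (x :* x))
              := (⟨ 16 ⟩ :* (⟨ 16 ⟩ :* (x :* x) :- ⟨ 15 ⟩ :* (a :* a)) :+ ⟨ 15 ⟩ :* (a :* a)) :+ (⟨ 15 ⟩ :* a)
              :^ 2) refl a x)))
    y-lower = large-abs σ²≡1 (proj₂ (sign (f ̂ ξ))) large-ξ
    z-lower = large-abs τ²≡1 (proj₂ (sign (f ̂ η))) large-η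
    t²≡ : t * t ≡ f ̂ (ξ ⊕ η) * f ̂ (ξ ⊕ η)
    t²≡ = trans (solve 3 (λ s t x → (s :* t :* x) :* (s :* t :* x) := (s :* s) :* (t :* t) :* (x :* x))
        refl σ τ (f ̂ (ξ ⊕ η)))
      (trans (cong₂ (λ p q → p * q * (f ̂ (ξ ⊕ η) * f ̂ (ξ ⊕ η))) σ²≡1 τ²≡1)
          (solve 1 (λ x → ⟨ 1 ⟩ :* ⟨ 1 ⟩ :* x := x) refl _))
    expanded : S (λ v → f v * ((1# - σ * χ ξ v) * (1# - τ * χ η v))) ≡ a + - σ * f ̂ ξ + - τ * f ̂ η + t
    expanded = trans (S-cong (λ v → trans
        (solve 5 (λ f s t x y → f :* ((⟨ 1 ⟩ :- s :* x) :* (⟨ 1 ⟩ :- t :* y)) := f :+ :- s :* (f :* x) :+ :- t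
            :* (f :* y) :+ s :* t :* (f :* (x :* y))) refl (f v) σ τ (χ ξ v) (χ η v))
        (cong (λ x → f v + - σ * (f v * χ ξ v) + - τ * (f v * χ η v) + σ * τ * (f v * x)) (sym (χ-⊕ˡ ξ η v)))))
      (trans (S-+ _ _) (cong₂ _+_ (trans (S-+ _ _) (cong₂ _+_ (trans (S-+ _ _) (cong (a +_) (S-*ˡ _ _)))
          (S-*ˡ _ _))) (S-*ˡ _ _)))
    -- The nonnegative sum is a - y - z + t, and y, z ≥ 15a/16, so t ≥ 14a/16. This contradicts 16t²
    -- ≤ a²; the constant 180 is 14² - 16.
    t-excess : 0# ≤ # 16 * t - # 14 * a
    t-excess = subst (0# ≤_)
      (solve 6 (λ a s t x y z → ⟨ 16 ⟩ :* (a :+ :- s :* x :+ :- t :* y :+ z)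
          :+ (⟨ 16 ⟩ :* (s :* x) :- ⟨ 15 ⟩ :* a) :+ (⟨ 16 ⟩ :* (t :* y) :- ⟨ 15 ⟩ :* a)
         := ⟨ 16 ⟩ :* z :- ⟨ 14 ⟩ :* a) refl a σ τ (f ̂ ξ) (f ̂ η) t)
      (#-nonneg 16 ⟨*⟩ subst (0# ≤_) expanded
        (S-nonneg (λ v → 𝟙-nonneg (A v) ⟨*⟩ (1-sgn≥0 (proj₁ (sign (f ̂ ξ))) (dot ξ v) ⟨*⟩ 1-sgn≥0
            (proj₁ (sign (f ̂ η))) (dot η v))))
        ⟨+⟩ diff-nonneg y-lower ⟨+⟩ diff-nonneg z-lower)

  -- The first clause controls the error in the Fourier sum. The second, with a constant free of K,
  -- separates small coefficients from large ones and contradicts `large-⊕`.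
  Small : ∀ {n} → Carrier → (Fin 4 → Subset n) → F₂^ n → Fin 4 → Set
  Small K A ξ i = let a = size (A i) ; c = indicator A i ̂ ξ in
    # 2 * K * (c * c) ≤ a * a × # 16 * (c * c) ≤ a * a

  Large : ∀ {n} → (Fin 4 → Subset n) → F₂^ n → Fin 4 → Set
  Large A ξ i = let a = size (A i) ; c = indicator A i ̂ ξ in # 15 * (a * a) ≤ # 16 * (c * c)

  Flat : ∀ {n} → Carrier → (Fin 4 → Subset n) → F₂^ n → Set
  Flat K A ξ = (∀ i → Small K A ξ i) ⊎ (∀ i → Large A ξ i)

  module FlatStructure {n : ℕ} (A : Fin 4 → Subset n) (K : Carrier) (K≥1 : 1# ≤ K)
    (A>0 : ∀ i → Positive (size (A i)))
    (energy-large : ∏ (λ i → size (A i)) ^ 3 ≤ (E A * K) ^ 4) where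

    a : Fin 4 → Carrier
    a i = size (A i)

    c : Fin 4 → F₂^ n → Carrier
    c i ξ = indicator A i ̂ ξ

    module _ (flat : ∀ ξ → Flat K A ξ) where

      -- Testing index 0 suffices: flatness puts all four sets into the same case at every ξ.
      W : Subset n
      W ξ = does (# 15 * (a zero * a zero) ≤? # 16 * (c zero ξ * c zero ξ))

      K>0 : Positive K
      K>0 = positive-≤ 1≰0 K≥1

      small∧large⇒⊥ : ∀ {ξ i} → Small K A ξ i → Large A ξ i → ⊥
      small∧large⇒⊥ {ξ} {i} (_ , small) large = *-positive (#-positive 13) (*-positive (A>0 i) (A>0 i))
        (≤-of-diff (diff-nonneg small ⟨+⟩ diff-nonneg large)
          (solve 2 (λ a c → ⟨ 0 ⟩ := (a :- c :+ (c :- ⟨ 15 ⟩ :* a)) :+ ⟨ 14 ⟩ :* a) refl (a i * a i)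
              (# 16 * (c i ξ * c i ξ))))

      W⇒Large₀ : ∀ ξ → W ξ ≡ true → Large A ξ zero
      W⇒Large₀ ξ = lemma (# 15 * (a zero * a zero) ≤? # 16 * (c zero ξ * c zero ξ))
        where
        lemma : ∀ {P : Set} (d : Dec P) → does d ≡ true → P
        lemma (yes p) _ = p

      Large₀⇒W : ∀ ξ → Large A ξ zero → W ξ ≡ true
      Large₀⇒W ξ large = lemma (# 15 * (a zero * a zero) ≤? # 16 * (c zero ξ * c zero ξ)) large
        where
        lemma : ∀ {P : Set} (d : Dec P) → P → does d ≡ true
        lemma (yes _) _ = refl
        lemma (no ¬p) p = ⊥-elim (¬p p)

      W⇒Large : ∀ ξ → W ξ ≡ true → ∀ i → Large A ξ i
      W⇒Large ξ Wξ = Sum.[ (λ small → ⊥-elim (small∧large⇒⊥ {ξ} {zero} (small zero) (W⇒Large₀ ξ Wξ))) ,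
          (λ large → large) ] (flat ξ)

      ¬W⇒Small : ∀ ξ → W ξ ≡ false → ∀ i → Small K A ξ i
      ¬W⇒Small ξ ¬Wξ = Sum.[ (λ small → small) ,
          (λ large → ⊥-elim (true≢false (trans (sym (Large₀⇒W ξ (large zero))) ¬Wξ))) ] (flat ξ)
        where
        true≢false : true ≡ false → ⊥
        true≢false ()

      0∈W : W 0v ≡ true
      0∈W = Large₀⇒W 0v (≤-of-diff (square-nonneg (a zero))
        (trans (cong (λ z → # 16 * (z * z)) (S-cong
            (λ v → trans (cong (λ b → 𝟙 (A zero v) * sgn b) (trans (dot-comm 0v v) (dot-zeroʳ v))) (*-identityʳ _))))
          (solve 1 (λ a → ⟨ 16 ⟩ :* a := a :+ ⟨ 15 ⟩ :* a) refl (a zero * a zero))))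

      W-closed : ∀ ξ η → W ξ ≡ true → W η ≡ true → W (ξ ⊕ η) ≡ true
      W-closed ξ η Wξ Wη = Large₀⇒W (ξ ⊕ η)
        (Sum.[ (λ small → ⊥-elim (large-⊕ (A zero) ξ η (A>0 zero) (W⇒Large₀ ξ Wξ) (W⇒Large₀ η Wη)
            (proj₂ (small zero))))
             , (λ large → large zero) ] (flat (ξ ⊕ η)))

      open Annihilator W 0∈W W-closed public

      square-sum : ∀ i → S (λ ξ → c i ξ * c i ξ) ≡ N n * a i
      square-sum i = trans (parseval (indicator A i)) (cong (N n *_) (S-cong (λ v → idempotent (A i v))))
        where
        idempotent : ∀ b → 𝟙 b * 𝟙 b ≡ 𝟙 b
        idempotent true  = *-identityˡ 1#
        idempotent false = zeroˡ 0#

      -- Parseval restricted to W gives |W| · (15/16) aᵢ² ≤ N aᵢ, and N = |W| |H|.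
      H-large : ∀ i → # 15 * a i ≤ # 16 * size H
      H-large i = *-cancelˡ-≤ (*-positive W-positive (A>0 i)) (subst₂ _≤_
          (trans (S-*ʳ (# 15 * (a i * a i)) (λ ξ → 𝟙 (W ξ)))
              (solve 2 (λ w a → w :* (⟨ 15 ⟩ :* (a :* a)) := w :* a :* (⟨ 15 ⟩ :* a)) refl (size W) (a i)))
          (trans (S-*ˡ (# 16) (λ ξ → c i ξ * c i ξ))
              (trans (cong (# 16 *_) (trans (square-sum i) (cong (_* a i) (sym size-duality))))
            (solve 3 (λ w h a → ⟨ 16 ⟩ :* (w :* h :* a) := w :* a :* (⟨ 16 ⟩ :* h)) refl (size W) (size H) (a i))))
          (S-mono (λ ξ → pointwise ξ (W⇒Large ξ))))
        where
        pointwise : ∀ ξ → (W ξ ≡ true → ∀ i → Large A ξ i) → 𝟙 (W ξ) * (# 15 * (a i * a i)) ≤ # 16 * (c i ξ * c i ξ)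
        pointwise ξ h = lemma (W ξ) h
          where
          lemma : ∀ b → (b ≡ true → ∀ i → Large A ξ i) → 𝟙 b * (# 15 * (a i * a i)) ≤ # 16 * (c i ξ * c i ξ)
          lemma true  h = subst (_≤ # 16 * (c i ξ * c i ξ)) (sym (*-identityˡ (# 15 * (a i * a i)))) (h refl i)
          lemma false h = subst (_≤ # 16 * (c i ξ * c i ξ)) (sym (zeroˡ (# 15 * (a i * a i))))
              (#-nonneg 16 ⟨*⟩ square-nonneg (c i ξ))

      main error Q : Carrier
      main  = S (λ ξ → 𝟙 (W ξ) * ∏ (λ i → c i ξ))
      error = S (λ ξ → 𝟙 (not (W ξ)) * ∏ (λ i → c i ξ))
      Q     = T (λ v → 𝟙 (H v)) (indicator A)

      main≡ : size W * Q ≡ main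
      main≡ = T-expansion H-expansion (indicator A)

      main+error : N n * E A ≡ main + error
      main+error = trans (T-expansion zero-expansion (indicator A))
        (trans (S-cong (λ ξ → split (W ξ) (∏ (λ i → c i ξ)))) (S-+ _ _))
        where
        split : ∀ b x → 1# * x ≡ 𝟙 b * x + 𝟙 (not b) * x
        split true  = solve 1 (λ x → ⟨ 1 ⟩ :* x := ⟨ 1 ⟩ :* x :+ ⟨ 0 ⟩ :* x) refl
        split false = solve 1 (λ x → ⟨ 1 ⟩ :* x := ⟨ 0 ⟩ :* x :+ ⟨ 1 ⟩ :* x) refl

      2K≥0 : 0# ≤ # 2 * K
      2K≥0 = #-nonneg 2 ⟨*⟩ positive⇒nonneg K>0

      fourth-moment-error : Fin 4 → Carrier
      fourth-moment-error i = S (λ ξ → 𝟙 (not (W ξ)) * c i ξ ^ 4)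

      -- Outside W one factor c² is at most a²/(2K); the other is summed by Parseval.
      fourth-moment-bound : ∀ i → # 2 * K * fourth-moment-error i ≤ N n * a i ^ 3
      fourth-moment-bound i = subst₂ _≤_ (S-*ˡ (# 2 * K) (λ ξ → 𝟙 (not (W ξ)) * c i ξ ^ 4))
        (trans (S-*ˡ (a i * a i) (λ ξ → c i ξ * c i ξ)) (trans (cong (a i * a i *_) (square-sum i))
          (solve 2 (λ a n → a :* a :* (n :* a) := n :* a :^ 3) refl (a i) (N n))))
        (S-mono (λ ξ → pointwise ξ (W ξ) (λ ¬Wξ → proj₁ (¬W⇒Small ξ ¬Wξ i))))
        where
        pointwise : ∀ ξ b → (b ≡ false → # 2 * K * (c i ξ * c i ξ) ≤ a i * a i) →
                    # 2 * K * (𝟙 (not b) * c i ξ ^ 4) ≤ a i * a i * (c i ξ * c i ξ)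
        pointwise ξ true  h = ≤-of-diff (square-nonneg (a i) ⟨*⟩ square-nonneg (c i ξ))
          (solve 3 (λ k x y → y := y :+ ⟨ 2 ⟩ :* k :* (⟨ 0 ⟩ :* x :^ 4)) refl K (c i ξ) (a i * a i * (c i ξ * c i ξ)))
        pointwise ξ false h = ≤-of-diff (diff-nonneg (h refl) ⟨*⟩ square-nonneg (c i ξ))
          (solve 3 (λ k x a → a :* (x :* x) := (a :- ⟨ 2 ⟩ :* k :* (x :* x)) :* (x :* x) :+ ⟨ 2 ⟩ :* k
              :* (⟨ 1 ⟩ :* x :^ 4)) refl K (c i ξ) (a i * a i))

      -- Hölder and the fourth moments give (2K · error)⁴ ≤ N⁴ (∏ a)³, and the energy hypothesis
      -- bounds this by (N E K)⁴. The 2 in the first clause of `Small` is thus what leaves half of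
      -- the energy to W, and it becomes the 2 in the final 2K.
      error-small : # 2 * error ≤ N n * E A
      error-small = *-cancelˡ-≤ K>0 (subst₂ _≤_
          (solve 2 (λ k e → ⟨ 2 ⟩ :* k :* e := k :* (⟨ 2 ⟩ :* e)) refl K error)
          (solve 3 (λ n e k → n :* (e :* k) := k :* (n :* e)) refl (N n) (E A) K)
          (^-cancel-≤ 3 (S-nonneg {n} (λ _ → #-nonneg 1) ⟨*⟩ (E-nonneg A ⟨*⟩ positive⇒nonneg K>0))
            (≤-trans hölder-bound (≤-trans moments
              (subst (N n ^ 4 * ∏ a ^ 3 ≤_) (sym (^-distrib-* (N n) (E A * K) 4))
                (*-monoˡ-≤ (^-nonneg 4 (S-nonneg {n} (λ _ → #-nonneg 1))) energy-large))))))
        where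
        fourth : ∀ x → x ^ 4 ≡ x * x * x * x
        fourth = solve 1 (λ x → x :^ 4 := x :* x :* x :* x) refl
        hölder-bound : (# 2 * K * error) ^ 4 ≤ ∏ (λ i → # 2 * K * fourth-moment-error i)
        hölder-bound = subst₂ _≤_ (sym (^-distrib-* (# 2 * K) error 4))
          (trans (cong (_* ∏ fourth-moment-error) (fourth (# 2 * K))) (sym (∏-* (λ _ → # 2 * K) fourth-moment-error)))
          (*-monoˡ-≤ (^-nonneg 4 2K≥0) (hölder (λ ξ → 𝟙 (not (W ξ))) c (λ ξ → 𝟙-nonneg (not (W ξ)))))
        moments : ∏ (λ i → # 2 * K * fourth-moment-error i) ≤ N n ^ 4 * ∏ a ^ 3
        moments = subst (∏ (λ i → # 2 * K * fourth-moment-error i) ≤_)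
          (trans (∏-* (λ _ → N n) (λ i → a i ^ 3)) (cong₂ _*_ (sym (fourth (N n))) (∏-^ a 3)))
          (∏-mono (λ i → 2K≥0 ⟨*⟩ S-nonneg (λ ξ → 𝟙-nonneg (not (W ξ)) ⟨*⟩
              subst (0# ≤_) (solve 1 (λ x → (x :* x) :* (x :* x) := x :^ 4) refl (c i ξ))
                  (square-nonneg (c i ξ * c i ξ))))
            fourth-moment-bound)

      -- The part over W is at least N E / 2 and equals |W| Q; inserting N = |W| |H|, the factor |W|
      -- cancels.
      |H|E≤2Q : size H * E A ≤ # 2 * Q
      |H|E≤2Q = *-cancelˡ-≤ W-positive (≤-of-diff (diff-nonneg error-small) (trans
        (trans (solve 2 (λ w q → w :* (⟨ 2 ⟩ :* q) := ⟨ 2 ⟩ :* (w :* q)) refl (size W) Q) (cong (# 2 *_) main≡))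
        (trans (solve 2 (λ m e → ⟨ 2 ⟩ :* m := (m :+ e :- ⟨ 2 ⟩ :* e) :+ (m :+ e)) refl main error)
          (cong₂ (λ x y → (x - # 2 * error) + y) (sym main+error)
            (trans (sym main+error) (trans (cong (_* E A) (sym size-duality)) (*-assoc _ _ _)))))))

      centre : Fin 4 → F₂^ n
      centre i = proj₁ (argmax (λ x → size (interCoset (A i) x H)))

      M : Fin 4 → Carrier
      M i = size (interCoset (A i) (centre i) H)

      Q-bound : Q ^ 4 ≤ ∏ M * ∏ a ^ 3
      Q-bound = T-bound H-expansion (λ v → 𝟙-nonneg (H v)) A M (λ i x →
        subst (_≤ M i)
          (S-cong (λ d → trans (𝟙-∧ (A i d) (H (d ⊕ x))) (cong (λ z → 𝟙 (A i d) * 𝟙 (H z)) (⊕-comm d x))))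
          (proj₂ (argmax (λ x → size (interCoset (A i) x H))) x))

      -- |H|⁴ (∏ a)³ ≤ K⁴ (|H| E)⁴ ≤ (2K)⁴ Q⁴ ≤ (2K)⁴ ∏ M (∏ a)³, and the positive factor (∏ a)³
      -- cancels.
      coset-density : size H ^ 4 ≤ (# 2 * K) ^ 4 * ∏ M
      coset-density = *-cancelˡ-≤ (^-positive 3 (∏-positive A>0)) (≤-trans
        (subst₂ _≤_ (*-comm (size H ^ 4) (∏ a ^ 3)) 
            (solve 3 (λ h e k → h :^ 4 :* (e :* k) :^ 4 := k :^ 4 :* (h :* e) :^ 4) refl (size H) (E A) K)
          (*-monoˡ-≤ (^-nonneg 4 (size-nonneg H)) energy-large))
        (≤-trans (*-monoˡ-≤ K⁴≥0 (^-mono-≤ 4 (size-nonneg H ⟨*⟩ E-nonneg A) |H|E≤2Q))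
          (subst₂ _≤_ (cong (K ^ 4 *_) (sym (^-distrib-* (# 2) Q 4)))
            (solve 3 (λ k m p → k :^ 4 :* (⟨ 2 ⟩ :^ 4 :* (m :* p)) := p :* ((⟨ 2 ⟩ :* k) :^ 4 :* m))
                refl K (∏ M) (∏ a ^ 3))
            (*-monoˡ-≤ K⁴≥0 (*-monoˡ-≤ (^-nonneg 4 (#-nonneg 2)) Q-bound)))))
        where
        K⁴≥0 : 0# ≤ K ^ 4
        K⁴≥0 = ^-nonneg 4 (positive⇒nonneg K>0)

-- Cutting by characters and the energy increment.

slice : ∀ {n} → Subset n → F₂^ n → Bool → Subset n
slice A ξ b v = A v ∧ not (dot ξ v xor b)

anyBool? : ∀ {P : Bool → Set} → (∀ b → Dec (P b)) → Dec (∃ P)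
anyBool? P? with P? false | P? true
... | yes p | _     = yes (false , p)
... | no ¬p | yes q = yes (true , q)
... | no ¬p | no ¬q = no λ { (false , p) → ¬p p ; (true , q) → ¬q q }

anyV? : ∀ {n} {P : F₂^ n → Set} → (∀ v → Dec (P v)) → Dec (∃ P)
anyV? {zero}  P? with P? []
... | yes p = yes ([] , p)
... | no ¬p = no λ { ([] , p) → ¬p p }
anyV? {suc n} P? with anyV? (λ v → P? (false ∷ v)) | anyV? (λ v → P? (true ∷ v))
... | yes (v , p) | _           = yes ((false ∷ v) , p)
... | no ¬p       | yes (v , q) = yes ((true ∷ v) , q)
... | no ¬p       | no ¬q       = no λ { (false ∷ v , p) → ¬p (v , p) ; (true ∷ v , q) → ¬q (v , q) }

module EnergyIncrement (F : OrderedField) where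

  open OrderedFieldProperties F
  open KeyInequality F
  open Dichotomy F using (∏-*; ∏-nonneg; ∏-mono; ∏-positive; part; parts-coherent)
  open Fourier F
  open Structure F

  sum-allVecs : ∀ {n} (g : F₂^ n → ℕ) → # (sum (map g (allVecs n))) ≡ S (λ v → # (g v))
  sum-allVecs {zero}  g = trans (cong # (ℕ.+-identityʳ (g []))) (sym (S-[] _))
  sum-allVecs {suc n} g = begin
    # (sum (map g (map (false ∷_) (allVecs n) ++ map (true ∷_) (allVecs n))))
      ≡⟨ cong (# ∘ sum) (map-++ g (map (false ∷_) (allVecs n)) _) ⟩
    # (sum (map g (map (false ∷_) (allVecs n)) ++ map g (map (true ∷_) (allVecs n))))
      ≡⟨ cong # (sum-++ (map g (map (false ∷_) (allVecs n))) _) ⟩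
    # (sum (map g (map (false ∷_) (allVecs n))) ℕ.+ sum (map g (map (true ∷_) (allVecs n))))
      ≡⟨ #-homo-+ (sum (map g (map (false ∷_) (allVecs n)))) _ ⟩
    # (sum (map g (map (false ∷_) (allVecs n)))) + # (sum (map g (map (true ∷_) (allVecs n))))
      ≡⟨ cong₂ (λ xs ys → # (sum xs) + # (sum ys)) (sym (map-∘ (allVecs n))) (sym (map-∘ (allVecs n))) ⟩
    # (sum (map (λ v → g (false ∷ v)) (allVecs n))) + # (sum (map (λ v → g (true ∷ v)) (allVecs n)))
      ≡⟨ cong₂ _+_ (sum-allVecs (λ v → g (false ∷ v))) (sum-allVecs (λ v → g (true ∷ v))) ⟩
    S (λ v → # (g (false ∷ v))) + S (λ v → # (g (true ∷ v)))
      ≡⟨ sym (S-∷ (λ v → # (g v))) ⟩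
    S (λ v → # (g v)) ∎
    where open ≡-Reasoning

  #-ind : ∀ b → # (ind b) ≡ 𝟙 b
  #-ind true  = refl
  #-ind false = refl

  #-card : ∀ {n} (A : Subset n) → # (card A) ≡ size A
  #-card A = trans (sum-allVecs (λ v → ind (A v))) (S-cong (λ v → #-ind (A v)))

  #-energy : ∀ {n} (A : Fin 4 → Subset n) → # (energy A) ≡ E A
  #-energy A = trans (sum-allVecs _) (S-cong λ a → trans (sum-allVecs _) (S-cong λ b →
    trans (sum-allVecs _) (S-cong λ c → trans (sum-allVecs _) (S-cong λ d →
      trans (#-ind (A zero a ∧ A (suc zero) b ∧ A (suc (suc zero)) c ∧ A (suc (suc (suc zero))) d ∧ isZero
          (a ⊕ b ⊕ c ⊕ d))) (product (A zero a) (A (suc zero) b) (A (suc (suc zero)) c)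
          (A (suc (suc (suc zero))) d) (isZero (a ⊕ b ⊕ c ⊕ d)))))))
    where
    product : ∀ p q r s t → 𝟙 (p ∧ q ∧ r ∧ s ∧ t) ≡ 𝟙 p * 𝟙 q * 𝟙 r * 𝟙 s * 𝟙 t
    product p q r s t = trans (𝟙-∧ p _) (trans
        (cong (𝟙 p *_) (trans (𝟙-∧ q _) (cong (𝟙 q *_) (trans (𝟙-∧ r _) (cong (𝟙 r *_) (𝟙-∧ s t))))))
      (solve 5 (λ p q r s t → p :* (q :* (r :* (s :* t))) := p :* q :* r :* s :* t) refl (𝟙 p) (𝟙 q) (𝟙 r)
          (𝟙 s) (𝟙 t)))

  #-reflects-< : ∀ {m n} → ¬ # n ≤ # m → m ℕ.< n
  #-reflects-< {m} {n} #n≰#m with m ℕ.<? n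
  ... | yes m<n = m<n
  ... | no  m≮n = ⊥-elim (#n≰#m (mono (ℕ.≮⇒≥ m≮n)))
    where
    mono : ∀ {m n} → m ℕ.≤ n → # m ≤ # n
    mono {n = n} ℕ.z≤n = #-nonneg n
    mono {suc m} {suc n} (ℕ.s≤s m≤n) = subst₂ _≤_ (sym (#-homo-+ 1 m)) (sym (#-homo-+ 1 n))
        (+-mono-≤ ≤-refl (mono m≤n))

  slice-sum : ∀ {n} (A : Subset n) ξ → size (slice A ξ false) + size (slice A ξ true) ≡ size A
  slice-sum A ξ = trans (sym (S-+ _ _)) (S-cong (λ v → lemma (A v) (dot ξ v)))
    where
    lemma : ∀ a d → 𝟙 (a ∧ not (d xor false)) + 𝟙 (a ∧ not (d xor true)) ≡ 𝟙 a
    lemma false d     = +-identityʳ 0#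
    lemma true  false = +-identityʳ 1#
    lemma true  true  = +-identityˡ 1#

  slice-difference : ∀ {n} (A : Subset n) ξ → size (slice A ξ false) - size (slice A ξ true) ≡ (λ v → 𝟙 (A v)) ̂ ξ
  slice-difference A ξ = trans
    (solve 2 (λ x y → x :- y := x :+ :- ⟨ 1 ⟩ :* y) refl (size (slice A ξ false)) (size (slice A ξ true)))
    (trans (cong (size (slice A ξ false) +_) (sym (S-*ˡ (- 1#) _)))
      (trans (sym (S-+ _ _)) (S-cong (λ v → lemma (A v) (dot ξ v)))))
    where
    lemma : ∀ a d → 𝟙 (a ∧ not (d xor false)) + - 1# * 𝟙 (a ∧ not (d xor true)) ≡ 𝟙 a * sgn d
    lemma false d     = solve 1 (λ s → ⟨ 0 ⟩ :+ :- ⟨ 1 ⟩ :* ⟨ 0 ⟩ := ⟨ 0 ⟩ :* s) refl (sgn d)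
    lemma true  false = solve 0 (⟨ 1 ⟩ :+ :- ⟨ 1 ⟩ :* ⟨ 0 ⟩ := ⟨ 1 ⟩ :* ⟨ 1 ⟩) refl
    lemma true  true  = solve 0 (⟨ 0 ⟩ :+ :- ⟨ 1 ⟩ :* ⟨ 1 ⟩ := ⟨ 1 ⟩ :* :- ⟨ 1 ⟩) refl

  slices : ∀ {n} → (Fin 4 → Subset n) → F₂^ n → (Fin 4 → Bool) → Fin 4 → Subset n
  slices A ξ β i = slice (A i) ξ (β i)

  S₄-sumBool : ∀ {n} (h : Bool → F₂^ n → F₂^ n → F₂^ n → F₂^ n → Carrier) →
    S₄ (λ a b c d → sumBool (λ β → h β a b c d)) ≡ sumBool (λ β → S₄ (h β))
  S₄-sumBool h = S₄-+ (h false) (h true)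

  -- In a quadruple with sum 0 the values of χ_ξ multiply to 1, so the sides of the first three
  -- entries determine the side of the fourth, and the quadruple is counted in exactly one of the
  -- eight pieces.
  E-slices : ∀ {n} (A : Fin 4 → Subset n) ξ →
    sumBool (λ b₁ → sumBool λ b₂ → sumBool λ b₃ → E (slices A ξ (evenChoice b₁ b₂ b₃))) ≡ E A
  E-slices {n} A ξ = sym (trans (S₄-cong pointwise)
    (trans (S₄-sumBool (λ b₁ a b c d → sumBool λ b₂ → sumBool λ b₃ → term b₁ b₂ b₃ a b c d))
        (cong₂ _+_ (level₂ false) (level₂ true))))
    where
    term : Bool → Bool → Bool → F₂^ n → F₂^ n → F₂^ n → F₂^ n → Carrier
    term b₁ b₂ b₃ a b c d = 𝟙 (slice (A zero) ξ b₁ a) * 𝟙 (slice (A (suc zero)) ξ b₂ b) * 𝟙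
        (slice (A (suc (suc zero))) ξ b₃ c)
      * 𝟙 (slice (A (suc (suc (suc zero)))) ξ (b₁ xor b₂ xor b₃) d) * 𝟙 (isZero (a ⊕ b ⊕ c ⊕ d))
    level₃ : ∀ b₁ b₂ → S₄ (λ a b c d → sumBool λ b₃ → term b₁ b₂ b₃ a b c d) ≡ sumBool λ b₃ → S₄ (term b₁ b₂ b₃)
    level₃ b₁ b₂ = S₄-sumBool (term b₁ b₂)
    level₂ : ∀ b₁ → S₄ (λ a b c d → sumBool λ b₂ → sumBool λ b₃ → term b₁ b₂ b₃ a b c d) ≡ sumBool λ b₂ →
        sumBool λ b₃ → S₄ (term b₁ b₂ b₃)
    level₂ b₁ = trans (S₄-sumBool (λ b₂ a b c d → sumBool λ b₃ → term b₁ b₂ b₃ a b c d))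
        (cong₂ _+_ (level₃ b₁ false) (level₃ b₁ true))
    selected : Bool → Bool → Carrier → Carrier
    selected d b x = x * 𝟙 (not (d xor b))
    sumBool-cong : ∀ {f g : Bool → Carrier} → (∀ b → f b ≡ g b) → sumBool f ≡ sumBool g
    sumBool-cong f≡g = cong₂ _+_ (f≡g false) (f≡g true)
    pick : ∀ d (f : Bool → Carrier) → sumBool (λ b → 𝟙 (not (d xor b)) * f b) ≡ f d
    pick false f = solve 2 (λ x y → ⟨ 1 ⟩ :* x :+ ⟨ 0 ⟩ :* y := x) refl (f false) (f true)
    pick true  f = solve 2 (λ x y → ⟨ 0 ⟩ :* x :+ ⟨ 1 ⟩ :* y := y) refl (f false) (f true)
    select : ∀ p q r s z d₁ d₂ d₃ → p * q * r * s * z ≡ sumBool λ b₁ → sumBool λ b₂ → sumBool λ b₃ →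
      selected d₁ b₁ p * selected d₂ b₂ q * selected d₃ b₃ r * selected (d₁ xor d₂ xor d₃) (b₁ xor b₂ xor b₃) s * z
    select p q r s z d₁ d₂ d₃ = sym (trans (sumBool-cong λ b₁ → trans (sumBool-cong λ b₂ → sum₃ b₁ b₂)
        (sum₂ b₁)) (trans sum₁ last))
      where
      Y : Bool → Bool → Bool → Carrier
      Y b₁ b₂ b₃ = selected (d₁ xor d₂ xor d₃) (b₁ xor b₂ xor b₃) s
      δ : Bool → Bool → Carrier
      δ d b = 𝟙 (not (d xor b))
      sum₃ : ∀ b₁ b₂ → sumBool (λ b₃ → selected d₁ b₁ p * selected d₂ b₂ q * selected d₃ b₃ r * Y b₁ b₂ b₃ * z)
                     ≡ selected d₁ b₁ p * selected d₂ b₂ q * r * Y b₁ b₂ d₃ * z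
      sum₃ b₁ b₂ = trans
        (sumBool-cong λ b₃ → solve 5 (λ x r i y z → x :* (r :* i) :* y :* z := i :* (x :* r :* y :* z)) refl
          (selected d₁ b₁ p * selected d₂ b₂ q) r (δ d₃ b₃) (Y b₁ b₂ b₃) z)
        (pick d₃ (λ b₃ → selected d₁ b₁ p * selected d₂ b₂ q * r * Y b₁ b₂ b₃ * z))
      sum₂ : ∀ b₁ → sumBool (λ b₂ → selected d₁ b₁ p * selected d₂ b₂ q * r * Y b₁ b₂ d₃ * z) ≡ selected d₁ b₁
          p * q * r * Y b₁ d₂ d₃ * z
      sum₂ b₁ = trans
        (sumBool-cong λ b₂ → solve 6 (λ x q i r y z → x :* (q :* i) :* r :* y :* z := i
            :* (x :* q :* r :* y :* z)) refl
          (selected d₁ b₁ p) q (δ d₂ b₂) r (Y b₁ b₂ d₃) z)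
        (pick d₂ (λ b₂ → selected d₁ b₁ p * q * r * Y b₁ b₂ d₃ * z))
      sum₁ : sumBool (λ b₁ → selected d₁ b₁ p * q * r * Y b₁ d₂ d₃ * z) ≡ p * q * r * Y d₁ d₂ d₃ * z
      sum₁ = trans
        (sumBool-cong λ b₁ → solve 6 (λ p i q r y z → (p :* i) :* q :* r :* y :* z := i
            :* (p :* q :* r :* y :* z)) refl
          p (δ d₁ b₁) q r (Y b₁ d₂ d₃) z)
        (pick d₁ (λ b₁ → p * q * r * Y b₁ d₂ d₃ * z))
      δ-diag : ∀ d → δ d d ≡ 1#
      δ-diag false = refl
      δ-diag true  = refl
      last : p * q * r * Y d₁ d₂ d₃ * z ≡ p * q * r * s * z
      last = cong (λ y → p * q * r * y * z) (trans (cong (s *_) (δ-diag (d₁ xor d₂ xor d₃))) (*-identityʳ s))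
    parity : ∀ a b c d → isZero (a ⊕ b ⊕ c ⊕ d) ≡ true → dot ξ d ≡ dot ξ a xor dot ξ b xor dot ξ c
    parity a b c d sum≡0 = xor-solve (dot ξ a) (dot ξ b) (dot ξ c) (dot ξ d) (begin
        ((dot ξ a xor dot ξ b) xor dot ξ c) xor dot ξ d ≡⟨ cong (λ x → (x xor dot ξ c) xor dot ξ d)
            (sym (dot-⊕ʳ ξ a b)) ⟩
        (dot ξ (a ⊕ b) xor dot ξ c) xor dot ξ d         ≡⟨ cong (_xor dot ξ d) (sym (dot-⊕ʳ ξ (a ⊕ b) c)) ⟩
        dot ξ (a ⊕ b ⊕ c) xor dot ξ d                   ≡⟨ sym (dot-⊕ʳ ξ (a ⊕ b ⊕ c) d) ⟩
        dot ξ (a ⊕ b ⊕ c ⊕ d)                           ≡⟨ cong (dot ξ) (isZero⇒≡0v _ sum≡0) ⟩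
        dot ξ 0v                                        ≡⟨ dot-zeroʳ ξ ⟩
        false                                           ∎)
      where
      open ≡-Reasoning
      xor-solve : ∀ p q r s → ((p xor q) xor r) xor s ≡ false → s ≡ p xor q xor r
      xor-solve false false false false eq = refl
      xor-solve false false true  true  eq = refl
      xor-solve false true  false true  eq = refl
      xor-solve false true  true  false eq = refl
      xor-solve true  false false true  eq = refl
      xor-solve true  false true  false eq = refl
      xor-solve true  true  false false eq = refl
      xor-solve true  true  true  true  eq = refl
    𝟙-slice : ∀ i b v → 𝟙 (slice (A i) ξ b v) ≡ selected (dot ξ v) b (𝟙 (A i v))
    𝟙-slice i b v = 𝟙-∧ (A i v) _
    term≡ : ∀ b₁ b₂ b₃ a b c d → term b₁ b₂ b₃ a b c d ≡
      selected (dot ξ a) b₁ (𝟙 (A zero a)) * selected (dot ξ b) b₂ (𝟙 (A (suc zero) b)) * selected (dot ξ c) b₃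
          (𝟙 (A (suc (suc zero)) c))
        * selected (dot ξ d) (b₁ xor b₂ xor b₃) (𝟙 (A (suc (suc (suc zero))) d)) * 𝟙 (isZero (a ⊕ b ⊕ c ⊕ d))
    term≡ b₁ b₂ b₃ a b c d = cong (_* 𝟙 (isZero (a ⊕ b ⊕ c ⊕ d)))
      (cong₂ _*_ (cong₂ _*_ (cong₂ _*_ (𝟙-slice zero b₁ a) (𝟙-slice (suc zero) b₂ b))
          (𝟙-slice (suc (suc zero)) b₃ c)) (𝟙-slice (suc (suc (suc zero))) (b₁ xor b₂ xor b₃) d))
    pointwise : ∀ a b c d → 𝟙 (A zero a) * 𝟙 (A (suc zero) b) * 𝟙 (A (suc (suc zero)) c) * 𝟙
        (A (suc (suc (suc zero))) d) * 𝟙 (isZero (a ⊕ b ⊕ c ⊕ d))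
      ≡ sumBool λ b₁ → sumBool λ b₂ → sumBool λ b₃ → term b₁ b₂ b₃ a b c d
    pointwise a b c d = trans (by-cases (isZero (a ⊕ b ⊕ c ⊕ d)) (parity a b c d))
      (sumBool-cong λ b₁ → sumBool-cong λ b₂ → sumBool-cong λ b₃ → sym (term≡ b₁ b₂ b₃ a b c d))
      where
      p = 𝟙 (A zero a)
      q = 𝟙 (A (suc zero) b)
      r = 𝟙 (A (suc (suc zero)) c)
      s = 𝟙 (A (suc (suc (suc zero))) d)
      by-cases : ∀ z → (z ≡ true → dot ξ d ≡ dot ξ a xor dot ξ b xor dot ξ c) →
        p * q * r * s * 𝟙 z ≡ sumBool λ b₁ → sumBool λ b₂ → sumBool λ b₃ →
          selected (dot ξ a) b₁ p * selected (dot ξ b) b₂ q * selected (dot ξ c) b₃ r * selected (dot ξ d)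
              (b₁ xor b₂ xor b₃) s * 𝟙 z
      by-cases true  even = trans (select p q r s 1# (dot ξ a) (dot ξ b) (dot ξ c))
        (cong (λ δ → sumBool λ b₁ → sumBool λ b₂ → sumBool λ b₃ →
          selected (dot ξ a) b₁ p * selected (dot ξ b) b₂ q * selected (dot ξ c) b₃ r * selected δ
              (b₁ xor b₂ xor b₃) s * 1#) (sym (even refl)))
      by-cases false _ = trans (zeroʳ _) (sym (trans (sumBool-cong λ b₁ → trans (sumBool-cong λ b₂ →
          trans (sumBool-cong λ b₃ → zeroʳ (selected (dot ξ a) b₁ p * selected (dot ξ b) b₂ q * selected
              (dot ξ c) b₃ r * selected (dot ξ d) (b₁ xor b₂ xor b₃) s)) 0+0) 0+0) 0+0))
        where
        0+0 : 0# + 0# ≡ 0#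
        0+0 = +-identityʳ 0#

  slice≤ : ∀ {n} (A : Subset n) ξ b → size (slice A ξ b) ≤ size A
  slice≤ A ξ false = ≤-of-diff (size-nonneg (slice A ξ true)) (trans (sym (slice-sum A ξ)) (+-comm _ _))
  slice≤ A ξ true  = ≤-of-diff (size-nonneg (slice A ξ false)) (sym (slice-sum A ξ))

  slice< : ∀ {n} (A : Subset n) ξ → (∀ b → Positive (size (slice A ξ b))) → ∀ b → ¬ size A ≤ size (slice A ξ b)
  slice< A ξ pieces>0 false A≤ = pieces>0 true (≤-of-diff (diff-nonneg A≤)
    (trans (solve 2 (λ x y → ⟨ 0 ⟩ := x :- (x :+ y) :+ y) refl (size (slice A ξ false)) (size (slice A ξ true)))
      (cong (λ z → size (slice A ξ false) - z + size (slice A ξ true)) (slice-sum A ξ))))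
  slice< A ξ pieces>0 true A≤ = pieces>0 false (≤-of-diff (diff-nonneg A≤)
    (trans (solve 2 (λ x y → ⟨ 0 ⟩ := y :- (x :+ y) :+ x) refl (size (slice A ξ false)) (size (slice A ξ true)))
      (cong (λ z → size (slice A ξ true) - z + size (slice A ξ false)) (slice-sum A ξ))))

  measure : ∀ {n} → (Fin 4 → Subset n) → ℕ
  measure A = card (A zero) ℕ.+ card (A (suc zero)) ℕ.+ card (A (suc (suc zero))) ℕ.+ card (A (suc (suc (suc zero))))

  #-measure : ∀ {n} (A : Fin 4 → Subset n) → # (measure A) ≡ ∑ (λ i → size (A i))
  #-measure A = trans (#-homo-+ (c₀ ℕ.+ c₁ ℕ.+ c₂) c₃)
      (cong₂ _+_ (trans (#-homo-+ (c₀ ℕ.+ c₁) c₂) (cong₂ _+_ (trans (#-homo-+ c₀ c₁)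
      (cong₂ _+_ (#-card (A zero)) (#-card (A (suc zero))))) (#-card (A (suc (suc zero))))))
          (#-card (A (suc (suc (suc zero))))))
    where
    c₀ = card (A zero)
    c₁ = card (A (suc zero))
    c₂ = card (A (suc (suc zero)))
    c₃ = card (A (suc (suc (suc zero))))

  measure-slices< : ∀ {n} (A : Fin 4 → Subset n) ξ i → (∀ b → Positive (size (slice (A i) ξ b))) →
                    ∀ β → measure (slices A ξ β) ℕ.< measure A
  measure-slices< A ξ i pieces>0 β = #-reflects-< λ A≤ → slice< (A i) ξ pieces>0 (β i)
    (≤-of-diff (diff-nonneg (subst₂ _≤_ (#-measure A) (#-measure (slices A ξ β)) A≤) ⟨+⟩ diff-nonneg
        (term≤∑ {rest} (λ j → diff-nonneg (slice≤ (A j) ξ (β j))) i))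
      (trans (solve 4 (λ x y s t → y := (s :- t :+ (t :- s :- (x :- y))) :+ x) refl (size (A i))
          (size (slice (A i) ξ (β i)))
                (∑ (λ j → size (slices A ξ β j))) (∑ (λ j → size (A j))))
        (cong (λ z → (∑ (λ j → size (slices A ξ β j)) - ∑ (λ j → size (A j)) + (z - rest i)) + size (A i))
            (sym ∑-rest))))
    where
    rest : Fin 4 → Carrier
    rest j = size (A j) - size (slice (A j) ξ (β j))
    ∑-rest : ∑ rest ≡ ∑ (λ j → size (A j)) - ∑ (λ j → size (slices A ξ β j))
    ∑-rest = solve 8 (λ a b c d a′ b′ c′ d′ → (a :- a′) :+ (b :- b′) :+ (c :- c′) :+ (d :- d′)
        := (a :+ b :+ c :+ d) :- (a′ :+ b′ :+ c′ :+ d′)) refl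
      (size (A zero)) (size (A (suc zero))) (size (A (suc (suc zero)))) (size (A (suc (suc (suc zero)))))
      (size (slice (A zero) ξ (β zero))) (size (slice (A (suc zero)) ξ (β (suc zero))))
          (size (slice (A (suc (suc zero))) ξ (β (suc (suc zero)))))
          (size (slice (A (suc (suc (suc zero)))) ξ (β (suc (suc (suc zero))))))

  ∏-zero : ∀ {f : Fin 4 → Carrier} i → f i ≡ 0# → ∏ f ≡ 0#
  ∏-zero {f} zero eq = trans (cong (λ x → x * f (suc zero) * f (suc (suc zero)) * f (suc (suc (suc zero)))) eq)
    (solve 3 (λ x y z → ⟨ 0 ⟩ :* x :* y :* z := ⟨ 0 ⟩) refl _ _ _)
  ∏-zero {f} (suc zero) eq = trans (cong (λ x → f zero * x * f (suc (suc zero)) * f (suc (suc (suc zero)))) eq)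
    (solve 3 (λ x y z → x :* ⟨ 0 ⟩ :* y :* z := ⟨ 0 ⟩) refl _ _ _)
  ∏-zero {f} (suc (suc zero)) eq = trans (cong (λ x → f zero * f (suc zero) * x * f (suc (suc (suc zero)))) eq)
    (solve 3 (λ x y z → x :* y :* ⟨ 0 ⟩ :* z := ⟨ 0 ⟩) refl _ _ _)
  ∏-zero {f} (suc (suc (suc zero))) eq = trans (cong (λ x → f zero * f (suc zero) * f (suc (suc zero)) * x) eq)
      (zeroʳ _)

  ∏-positive⁻¹ : ∀ {f : Fin 4 → Carrier} → (∀ i → 0# ≤ f i) → Positive (∏ f) → ∀ i → Positive (f i)
  ∏-positive⁻¹ {f} f≥0 ∏>0 i fi≤0 = ∏>0 (≤-reflexive (∏-zero {f} i (antisym fi≤0 (f≥0 i))))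

  Π : ∀ {n} → (Fin 4 → Subset n) → Carrier
  Π A = ∏ (λ i → size (A i))

  Π-nonneg : ∀ {n} (A : Fin 4 → Subset n) → 0# ≤ Π A
  Π-nonneg A = ∏-nonneg (λ i → size-nonneg (A i))

  -- An empty slice means that χ_ξ is constant on the set, so c² equals a².
  degenerate⇒Large : ∀ {n} (A : Fin 4 → Subset n) ξ i b → size (slice (A i) ξ b) ≤ 0# → Large A ξ i
  degenerate⇒Large A ξ i b slice≤0 = ≤-of-diff (square-nonneg a) (trans (cong (# 16 *_) (c²≡a² b slice≡0))
      (solve 1 (λ a → ⟨ 16 ⟩ :* a := a :+ ⟨ 15 ⟩ :* a) refl (a * a)))
    where
    a = size (A i)
    s = λ b → size (slice (A i) ξ b)
    slice≡0 : s b ≡ 0#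
    slice≡0 = antisym slice≤0 (size-nonneg (slice (A i) ξ b))
    c²≡a² : ∀ b → s b ≡ 0# → indicator A i ̂ ξ * indicator A i ̂ ξ ≡ a * a
    c²≡a² false eq = trans (cong (λ c → c * c) (sym (slice-difference (A i) ξ))) (trans
      (trans (cong (λ x → (x - s true) * (x - s true)) eq)
          (trans (solve 1 (λ y → (⟨ 0 ⟩ :- y) :* (⟨ 0 ⟩ :- y) := (⟨ 0 ⟩ :+ y) :* (⟨ 0 ⟩ :+ y)) refl (s true))
        (cong (λ x → (x + s true) * (x + s true)) (sym eq)))) (cong (λ c → c * c) (slice-sum (A i) ξ)))
    c²≡a² true eq = trans (cong (λ c → c * c) (sym (slice-difference (A i) ξ))) (trans
      (trans (cong (λ x → (s false - x) * (s false - x)) eq)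
          (trans (solve 1 (λ y → (y :- ⟨ 0 ⟩) :* (y :- ⟨ 0 ⟩) := (y :+ ⟨ 0 ⟩) :* (y :+ ⟨ 0 ⟩)) refl (s false))
        (cong (λ x → (s false + x) * (s false + x)) (sym eq)))) (cong (λ c → c * c) (slice-sum (A i) ξ)))

  module Increment {n : ℕ} {K w : Carrier} {m′ : ℕ} (K≥1 : 1# ≤ K) (mw≡1 : # (suc m′) * w ≡ 1#)
                   (w-small : # 40000 * (K * w) ≤ 1#) {Π₀ : Carrier} (Π₀>0 : Positive Π₀) where

    m r : ℕ
    m = suc m′
    r = 2 ℕ.* m ℕ.+ m′

    K>0 : Positive K
    K>0 = positive-≤ 1≰0 K≥1

    -- (E K)⁴ / Π³ ≥ (Π₀ / Π)^(1/m), cleared of roots and denominators.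
    Dense : (Fin 4 → Subset n) → Set
    Dense A = Π₀ * Π A ^ r ≤ ((E A * K) ^ 4) ^ m

    dense-scale : ∀ x → ((x * K) ^ 4) ^ m ≡ (x ^ 4) ^ m * (K ^ 4) ^ m
    dense-scale x = trans (cong (_^ m) (^-distrib-* x K 4)) (^-distrib-* (x ^ 4) (K ^ 4) m)

    zero-power : ∀ {x} → x ≡ 0# → (x ^ 4) ^ m ≡ 0#
    zero-power {x} x≡0 = trans (cong (λ y → (y ^ 4) ^ m) x≡0)
      (trans (cong (_* (0# ^ 4) ^ m′) (solve 0 (⟨ 0 ⟩ :^ 4 := ⟨ 0 ⟩) refl)) (zeroˡ _))

    E-positive : ∀ (A : Fin 4 → Subset n) → Positive (Π A) → Dense A → Positive (E A)
    E-positive A Π>0 dense E≤0 = *-positive Π₀>0 (^-positive r Π>0)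
      (subst (Π₀ * Π A ^ r ≤_) (trans (dense-scale (E A))
          (trans (cong (_* (K ^ 4) ^ m) (zero-power (antisym E≤0 (E-nonneg A)))) (zeroˡ _))) dense)

    Π≤0⇒E≡0 : ∀ (B : Fin 4 → Subset n) → Π B ≤ 0# → E B ≡ 0#
    Π≤0⇒E≡0 B Π≤0 = antisym (^-cancel-≤ 3 ≤-refl (≤-trans (E-bound B) (≤-reflexive
        (trans (cong (_^ 3) (antisym Π≤0 (Π-nonneg B))) (solve 0 (⟨ 0 ⟩ :^ 3 := ⟨ 0 ⟩ :^ 4) refl)))))
      (E-nonneg B)

    -- If Π B vanishes, so does E B. Otherwise B fails the density inequality that A satisfies, and
    -- multiplying the two cancels Π₀ and the power of K.
    relative-bound : ∀ (A B : Fin 4 → Subset n) → Dense A → ¬ (Positive (Π B) × Dense B) →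
                     (E B ^ 4) ^ m * Π A ^ r ≤ (E A ^ 4) ^ m * Π B ^ r
    relative-bound A B dense ¬dense = by-cases (Π B ≤? 0#) (((E B * K) ^ 4) ^ m ≤? Π₀ * Π B ^ r)
      where
      rhs≥0 : 0# ≤ (E A ^ 4) ^ m * Π B ^ r
      rhs≥0 = ^-nonneg m (^-nonneg 4 (E-nonneg A)) ⟨*⟩ ^-nonneg r (Π-nonneg B)
      by-cases : Dec (Π B ≤ 0#) → Dec (((E B * K) ^ 4) ^ m ≤ Π₀ * Π B ^ r) →
                 (E B ^ 4) ^ m * Π A ^ r ≤ (E A ^ 4) ^ m * Π B ^ r
      by-cases (yes Π≤0) _ = subst (_≤ (E A ^ 4) ^ m * Π B ^ r)
        (sym (trans (cong (_* Π A ^ r) (zero-power (Π≤0⇒E≡0 B Π≤0))) (zeroˡ _))) rhs≥0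
      by-cases (no Π>0) (no sparse) = ⊥-elim (¬dense (Π>0 , ≰⇒≥ sparse))
      by-cases (no Π>0) (yes sparse) = *-cancelˡ-≤ (*-positive Π₀>0 (^-positive m (^-positive 4 K>0))) (subst₂ _≤_
        (trans (cong (_* (Π₀ * Π A ^ r)) (dense-scale (E B)))
          (solve 4 (λ e k p a → e :* k :* (p :* a) := p :* k :* (e :* a)) refl ((E B ^ 4) ^ m) ((K ^ 4) ^ m) Π₀
              (Π A ^ r)))
        (trans (cong (Π₀ * Π B ^ r *_) (dense-scale (E A)))
          (solve 4 (λ e k p b → p :* b :* (e :* k) := p :* k :* (e :* b)) refl ((E A ^ 4) ^ m) ((K ^ 4) ^ m) Π₀
              (Π B ^ r)))
        (*-mono-≤ (^-nonneg m (^-nonneg 4 (E-nonneg B ⟨*⟩ positive⇒nonneg K>0)))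
          (^-nonneg m (^-nonneg 4 (E-nonneg A ⟨*⟩ positive⇒nonneg K>0))) sparse dense))

    w≥0 : 0# ≤ w
    w≥0 = *-cancelˡ-≤ (#-positive m′) (subst₂ _≤_ (sym (zeroʳ _)) (sym mw≡1) (#-nonneg 1))

    40000w≤1 : # 40000 * w ≤ 1#
    40000w≤1 = ≤-trans (≤-of-diff (#-nonneg 40000 ⟨*⟩ (diff-nonneg K≥1 ⟨*⟩ w≥0))
      (solve 2 (λ k w → ⟨ 40000 ⟩ :* (k :* w) := ⟨ 40000 ⟩ :* ((k :- ⟨ 1 ⟩) :* w) :+ ⟨ 40000 ⟩ :* w) refl K w))
          w-small

    reciprocal : ∀ {x} → Positive x → ∃ λ y → x * y ≡ 1#
    reciprocal {x} x>0 = inverse x (λ x≡0 → x>0 (≤-reflexive x≡0))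

    reciprocal-nonneg : ∀ {x y} → Positive x → x * y ≡ 1# → 0# ≤ y
    reciprocal-nonneg x>0 xy≡1 = *-cancelˡ-≤ x>0 (subst₂ _≤_ (sym (zeroʳ _)) (sym xy≡1) (#-nonneg 1))

    -- When no piece keeps the potential, `relative-bound` holds for all eight. Divided by the sizes
    -- aᵢ and by E A, these bounds are exactly the hypothesis of `parts-coherent`.
    module AtFrequency (A : Fin 4 → Subset n) (Π>0 : Positive (Π A)) (dense : Dense A) (ξ : F₂^ n)
                       (no-dense-slices : ∀ b₁ b₂ b₃ → ¬ (Positive (Π (slices A ξ (evenChoice b₁ b₂ b₃))) ×
                                                                Dense (slices A ξ (evenChoice b₁ b₂ b₃)))) where

      a c : Fin 4 → Carrier
      a i = size (A i)
      c i = indicator A i ̂ ξ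

      a>0 : ∀ i → Positive (a i)
      a>0 = ∏-positive⁻¹ (λ i → size-nonneg (A i)) Π>0

      s : Fin 4 → Bool → Carrier
      s i b = size (slice (A i) ξ b)

      a⁻¹ : Fin 4 → Carrier
      a⁻¹ i = proj₁ (reciprocal (a>0 i))

      aa⁻¹≡1 : ∀ i → a i * a⁻¹ i ≡ 1#
      aa⁻¹≡1 i = proj₂ (reciprocal (a>0 i))

      a⁻¹≥0 : ∀ i → 0# ≤ a⁻¹ i
      a⁻¹≥0 i = reciprocal-nonneg (a>0 i) (aa⁻¹≡1 i)

      p : Fin 4 → Carrier
      p i = s i false * a⁻¹ i

      1-p≡ : ∀ i → s i true * a⁻¹ i ≡ 1# - p i
      1-p≡ i = trans (solve 3 (λ x y z → y :* z := (x :+ y) :* z :- x :* z) refl (s i false) (s i true) (a⁻¹ i))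
        (cong (_- p i) (trans (cong (_* a⁻¹ i) (slice-sum (A i) ξ)) (aa⁻¹≡1 i)))

      cancel-a : ∀ i x → a i * (x * a⁻¹ i) ≡ x
      cancel-a i x = trans (solve 3 (λ a x y → a :* (x :* y) := x :* (a :* y)) refl (a i) x (a⁻¹ i))
        (trans (cong (x *_) (aa⁻¹≡1 i)) (*-identityʳ x))

      slice≡ : ∀ i b → a i * part (p i) b ≡ s i b
      slice≡ i false = cancel-a i (s i false)
      slice≡ i true  = trans (cong (a i *_) (sym (1-p≡ i))) (cancel-a i (s i true))

      E>0 : Positive (E A)
      E>0 = E-positive A Π>0 dense

      E⁻¹ : Carrier
      E⁻¹ = proj₁ (reciprocal E>0)

      EE⁻¹≡1 : E A * E⁻¹ ≡ 1#
      EE⁻¹≡1 = proj₂ (reciprocal E>0)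

      piece : Bool → Bool → Bool → Fin 4 → Subset n
      piece b₁ b₂ b₃ = slices A ξ (evenChoice b₁ b₂ b₃)

      e : Bool → Bool → Bool → Carrier
      e b₁ b₂ b₃ = E (piece b₁ b₂ b₃) * E⁻¹

      sumBool-*ʳ : ∀ (f : Bool → Carrier) x → sumBool (λ b → f b * x) ≡ sumBool f * x
      sumBool-*ʳ f x = sym (distribʳ x (f false) (f true))

      ∑e≡1 : sumBool (λ b₁ → sumBool λ b₂ → sumBool λ b₃ → e b₁ b₂ b₃) ≡ 1#
      ∑e≡1 = trans (trans (cong₂ _+_ (level₂ false) (level₂ true))
          (sumBool-*ʳ (λ b₁ → sumBool λ b₂ → sumBool λ b₃ → E (piece b₁ b₂ b₃)) E⁻¹))
        (trans (cong (_* E⁻¹) (E-slices A ξ)) EE⁻¹≡1)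
        where
        level₂ : ∀ b₁ → sumBool (λ b₂ → sumBool λ b₃ → e b₁ b₂ b₃) ≡ sumBool
            (λ b₂ → sumBool λ b₃ → E (piece b₁ b₂ b₃)) * E⁻¹
        level₂ b₁ = trans (cong₂ _+_ (sumBool-*ʳ (λ b₃ → E (piece b₁ false b₃)) E⁻¹)
            (sumBool-*ʳ (λ b₃ → E (piece b₁ true b₃)) E⁻¹))
          (sumBool-*ʳ (λ b₂ → sumBool λ b₃ → E (piece b₁ b₂ b₃)) E⁻¹)

      e-bound : ∀ b₁ b₂ b₃ → (e b₁ b₂ b₃ ^ 4) ^ m ≤ ∏ (λ i → part (p i) (evenChoice b₁ b₂ b₃ i)) ^ r
      e-bound b₁ b₂ b₃ = *-cancelˡ-≤ (*-positive (^-positive m (^-positive 4 E>0)) (^-positive r Π>0))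
          (subst₂ _≤_ lhs rhs
          (relative-bound A (piece b₁ b₂ b₃) dense (no-dense-slices b₁ b₂ b₃)))
        where
        P : Carrier
        P = ∏ (λ i → part (p i) (evenChoice b₁ b₂ b₃ i))
        ε : Carrier
        ε = e b₁ b₂ b₃
        E≡ : E (piece b₁ b₂ b₃) ≡ E A * ε
        E≡ = sym (trans (solve 3 (λ x y z → x :* (y :* z) := y :* (x :* z)) refl (E A) (E (piece b₁ b₂ b₃)) E⁻¹)
          (trans (cong (E (piece b₁ b₂ b₃) *_) EE⁻¹≡1) (*-identityʳ _)))
        Π≡ : Π (piece b₁ b₂ b₃) ≡ Π A * P
        Π≡ = sym (trans (sym (∏-* a (λ i → part (p i) (evenChoice b₁ b₂ b₃ i))))
          (cong₂ _*_ (cong₂ _*_ (cong₂ _*_ (slice≡ zero b₁) (slice≡ (suc zero) b₂))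
              (slice≡ (suc (suc zero)) b₃)) (slice≡ (suc (suc (suc zero))) (b₁ xor b₂ xor b₃))))
        lhs : (E (piece b₁ b₂ b₃) ^ 4) ^ m * Π A ^ r ≡ (E A ^ 4) ^ m * Π A ^ r * (ε ^ 4) ^ m
        lhs = trans (cong (λ x → (x ^ 4) ^ m * Π A ^ r) E≡)
            (trans (cong (_* Π A ^ r) (trans (cong (_^ m) (^-distrib-* (E A) ε 4)) (^-distrib-* (E A ^ 4) (ε ^ 4) m)))
          (solve 3 (λ x y z → x :* y :* z := x :* z :* y) refl ((E A ^ 4) ^ m) ((ε ^ 4) ^ m) (Π A ^ r)))
        rhs : (E A ^ 4) ^ m * Π (piece b₁ b₂ b₃) ^ r ≡ (E A ^ 4) ^ m * Π A ^ r * P ^ r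
        rhs = trans (cong ((E A ^ 4) ^ m *_) (trans (cong (_^ r) Π≡) (^-distrib-* (Π A) P r))) (sym (*-assoc _ _ _))

      c²≡ : ∀ i → c i * c i ≡ a i * a i * bias² (p i)
      c²≡ i = trans (cong (λ x → x * x) (trans (sym (slice-difference (A i) ξ))
          (cong₂ _-_ (sym (slice≡ i false)) (sym (slice≡ i true)))))
        (solve 2 (λ a p → (a :* p :- a :* (⟨ 1 ⟩ :- p)) :* (a :* p :- a :* (⟨ 1 ⟩ :- p)) := a :* a
            :* ((p :- (⟨ 1 ⟩ :- p)) :* (p :- (⟨ 1 ⟩ :- p)))) refl (a i) (p i))

      scaled : ∀ i x → 0# ≤ 1# - x * bias² (p i) → x * (c i * c i) ≤ a i * a i
      scaled i x h = ≤-of-diff (square-nonneg (a i) ⟨*⟩ h) (trans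
        (solve 3 (λ a x t → a := a :* (⟨ 1 ⟩ :- x :* t) :+ x :* (a :* t)) refl (a i * a i) x (bias² (p i)))
        (cong (λ z → a i * a i * (1# - x * bias² (p i)) + x * z) (sym (c²≡ i))))

      small : ∀ i → # 3 * bias² (p i) ≤ # 1024 * w → Small K A ξ i
      -- The clause with 2K asks for 2048 K w ≤ 3, which is why w must be O(1/K). The slack
      -- constants are 37952 = 40000 - 2048 and 23616 = 40000 - 16 · 1024.
      small i h = scaled i (# 2 * K) (*-cancelˡ-≤ (#-positive 2) (≤-of-diff
            (#-nonneg 2 ⟨*⟩ K≥0 ⟨*⟩ diff-nonneg h ⟨+⟩ #-nonneg 2 ⟨+⟩ diff-nonneg w-small ⟨+⟩ #-nonneg 37952
                ⟨*⟩ (K≥0 ⟨*⟩ w≥0))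
            (solve 3 (λ k w t → ⟨ 3 ⟩ :* (⟨ 1 ⟩ :- ⟨ 2 ⟩ :* k :* t) :=
                (⟨ 2 ⟩ :* k :* (⟨ 1024 ⟩ :* w :- ⟨ 3 ⟩ :* t) :+ ⟨ 2 ⟩ :+ (⟨ 1 ⟩ :- ⟨ 40000 ⟩ :* (k :* w))
                    :+ ⟨ 37952 ⟩ :* (k :* w)) :+ ⟨ 3 ⟩ :* ⟨ 0 ⟩)
              refl K w (bias² (p i)))))
        , scaled i (# 16) (*-cancelˡ-≤ (#-positive 2) (≤-of-diff
            (#-nonneg 16 ⟨*⟩ diff-nonneg h ⟨+⟩ #-nonneg 2 ⟨+⟩ diff-nonneg 40000w≤1 ⟨+⟩ #-nonneg 23616 ⟨*⟩ w≥0)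
            (solve 2 (λ w t → ⟨ 3 ⟩ :* (⟨ 1 ⟩ :- ⟨ 16 ⟩ :* t) :=
                (⟨ 16 ⟩ :* (⟨ 1024 ⟩ :* w :- ⟨ 3 ⟩ :* t) :+ ⟨ 2 ⟩ :+ (⟨ 1 ⟩ :- ⟨ 40000 ⟩ :* w) :+ ⟨ 23616 ⟩
                    :* w) :+ ⟨ 3 ⟩ :* ⟨ 0 ⟩)
              refl w (bias² (p i)))))
        where
        K≥0 : 0# ≤ K
        K≥0 = positive⇒nonneg K>0

      large : ∀ i → # 3 * (1# - bias² (p i)) ≤ # 1024 * w → Large A ξ i
      large i h = subst (λ z → # 15 * (a i * a i) ≤ # 16 * z) (sym (c²≡ i))
          (≤-of-diff (square-nonneg (a i) ⟨*⟩ 16t≥15)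
        (solve 2 (λ a t → ⟨ 16 ⟩ :* (a :* t) := a :* (⟨ 16 ⟩ :* t :- ⟨ 15 ⟩) :+ ⟨ 15 ⟩ :* a) refl (a i * a i)
            (bias² (p i))))
        where
        16t≥15 : 0# ≤ # 16 * bias² (p i) - # 15
        16t≥15 = *-cancelˡ-≤ (#-positive 2) (≤-of-diff
            (#-nonneg 16 ⟨*⟩ diff-nonneg h ⟨+⟩ #-nonneg 2 ⟨+⟩ diff-nonneg 40000w≤1 ⟨+⟩ #-nonneg 23616 ⟨*⟩ w≥0)
            (solve 2 (λ w t → ⟨ 3 ⟩ :* (⟨ 16 ⟩ :* t :- ⟨ 15 ⟩) :=
                (⟨ 16 ⟩ :* (⟨ 1024 ⟩ :* w :- ⟨ 3 ⟩ :* (⟨ 1 ⟩ :- t)) :+ ⟨ 2 ⟩ :+ (⟨ 1 ⟩ :- ⟨ 40000 ⟩ :* w)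
                    :+ ⟨ 23616 ⟩ :* w) :+ ⟨ 3 ⟩ :* ⟨ 0 ⟩)
              refl w (bias² (p i))))

      flat : Flat K A ξ
      flat = Sum.map (λ h i → small i (h i)) (λ h i → large i (h i))
        (parts-coherent {w} {m′} mw≡1 {p} (λ i → size-nonneg (slice (A i) ξ false) ⟨*⟩ a⁻¹≥0 i)
          (λ i → subst (0# ≤_) (1-p≡ i) (size-nonneg (slice (A i) ξ true) ⟨*⟩ a⁻¹≥0 i))
          40000w≤1 e ∑e≡1 e-bound)

    -- The decrease of `measure` rules out the trivial cut: if χ_ξ is constant on every set, one of
    -- the pieces can be the quadruple itself.
    ImprovingSlices : (Fin 4 → Subset n) → F₂^ n → Bool → Bool → Bool → Set
    ImprovingSlices A ξ b₁ b₂ b₃ = let B = slices A ξ (evenChoice b₁ b₂ b₃) in measure B ℕ.< measure A × Positive (Π B) × Dense B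

    improvingSlices? : ∀ (A : Fin 4 → Subset n) → Dec
        (∃ λ ξ → ∃ λ b₁ → ∃ λ b₂ → ∃ λ b₃ → ImprovingSlices A ξ b₁ b₂ b₃)
    improvingSlices? A = anyV? λ ξ → anyBool? λ b₁ → anyBool? λ b₂ → anyBool? λ b₃ →
      let B = slices A ξ (evenChoice b₁ b₂ b₃) in
      (measure B ℕ.<? measure A) ×-dec (¬? (Π B ≤? 0#) ×-dec (Π₀ * Π B ^ r ≤? ((E B * K) ^ 4) ^ m))

    -- If χ_ξ splits some set, all eight pieces have smaller measure, so none is both nonempty and
    -- dense, and `AtFrequency` applies. If it splits none, all four coefficients are maximal.
    unimprovable⇒flat : ∀ A → Positive (Π A) → Dense A → (∀ ξ b₁ b₂ b₃ → ¬ ImprovingSlices A ξ b₁ b₂ b₃) →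
        ∀ ξ → Flat K A ξ
    unimprovable⇒flat A Π>0 dense unimprovable ξ = by-cases
        (Fin.any? λ i → ¬? (size (slice (A i) ξ false) ≤? 0#) ×-dec ¬? (size (slice (A i) ξ true) ≤? 0#))
      where
      Split : Fin 4 → Set
      Split i = Positive (size (slice (A i) ξ false)) × Positive (size (slice (A i) ξ true))
      by-cases : Dec (∃ Split) → Flat K A ξ
      by-cases (yes (i , pos₀ , pos₁)) = AtFrequency.flat A Π>0 dense ξ λ b₁ b₂ b₃ (pieces>0 , dense′) →
          unimprovable ξ b₁ b₂ b₃ (measure-slices< A ξ i both (evenChoice b₁ b₂ b₃) , pieces>0 , dense′)
        where
        both : ∀ b → Positive (size (slice (A i) ξ b))
        both false = pos₀
        both true  = pos₁
      by-cases (no unsplit) = inj₂ λ i → degenerate i (size (slice (A i) ξ false) ≤? 0#)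
          (size (slice (A i) ξ true) ≤? 0#)
        where
        degenerate : ∀ i → Dec (size (slice (A i) ξ false) ≤ 0#) → Dec (size (slice (A i) ξ true) ≤ 0#) → Large A ξ i
        degenerate i (yes ≤0) _        = degenerate⇒Large A ξ i false ≤0
        degenerate i (no _)   (yes ≤0) = degenerate⇒Large A ξ i true ≤0
        degenerate i (no >0)  (no >0′) = ⊥-elim (unsplit (i , >0 , >0′))

    FlatRefinement : (Fin 4 → Subset n) → Set
    FlatRefinement A = ∃ λ (B : Fin 4 → Subset n) → (∀ i v → B i v ≡ true → A i v ≡ true) × Positive
        (Π B) × Dense B × (∀ ξ → Flat K B ξ)

    -- The strict bound k on the measure serves as fuel, which makes the recursion structural.
    flatRefinement : ∀ k A → measure A ℕ.< k → Positive (Π A) → Dense A → FlatRefinement A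
    flatRefinement (suc k) A (ℕ.s≤s measure≤k) Π>0 dense = by-cases (improvingSlices? A)
      where
      by-cases : Dec (∃ λ ξ → ∃ λ b₁ → ∃ λ b₂ → ∃ λ b₃ → ImprovingSlices A ξ b₁ b₂ b₃) → FlatRefinement A
      by-cases (yes (ξ , b₁ , b₂ , b₃ , measure< , Π>0′ , dense′)) =
        let B , B⊆ , rest = flatRefinement k (slices A ξ (evenChoice b₁ b₂ b₃)) (ℕ.≤-trans measure< measure≤k) Π>0′ dense′
        in B , (λ i v Bv → proj₁ (∧-true (B⊆ i v Bv))) , rest
      by-cases (no unimprovable) = A , (λ _ _ Av → Av) , Π>0 , dense ,
        unimprovable⇒flat A Π>0 dense (λ ξ b₁ b₂ b₃ improving → unimprovable (ξ , b₁ , b₂ , b₃ , improving))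

    cube-power : ∀ x → x * x ^ r ≡ (x ^ 3) ^ m
    cube-power x = trans (cong (x ^_) (trans (sym (ℕ.+-suc (2 ℕ.* m) m′)) (ℕ.+-comm (2 ℕ.* m) m)))
        (sym (^-assocʳ x 3 m))

    -- Replacing Π₀ by the smaller Π B in `Dense` gives the m-th power of the energy hypothesis, so
    -- the refined quadruple satisfies it with the same K.
    dense⇒energy-large : ∀ (B : Fin 4 → Subset n) → Dense B → Π B ≤ Π₀ → Π B ^ 3 ≤ (E B * K) ^ 4
    dense⇒energy-large B dense Π≤ = ^-cancel-≤ m′ (^-nonneg 4 (E-nonneg B ⟨*⟩ positive⇒nonneg K>0))
      (≤-trans (≤-trans (≤-reflexive (sym (cube-power (Π B))))
        (*-mono-≤ (Π-nonneg B) (^-nonneg r (Π-nonneg B)) Π≤ ≤-refl)) dense)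

    -- Inserting E⁴ ≤ Π³ into `Dense` and cancelling Π^(3m - 1) leaves the factor K^(4m). This is
    -- the only source of the loss K^(O(K)).
    dense⇒Π₀≤ : ∀ (B : Fin 4 → Subset n) → Positive (Π B) → Dense B → Π₀ ≤ Π B * (K ^ 4) ^ m
    dense⇒Π₀≤ B Π>0 dense = *-cancelˡ-≤ (^-positive r Π>0) (subst₂ _≤_ (*-comm _ _) reorder
      (≤-trans dense (≤-trans (≤-reflexive (dense-scale (E B)))
        (*-mono-≤ (^-nonneg m (^-nonneg 4 (E-nonneg B))) (^-nonneg m (^-nonneg 4 (positive⇒nonneg K>0)))
          (^-mono-≤ m (^-nonneg 4 (E-nonneg B)) (E-bound B)) ≤-refl))))
      where
      reorder : (Π B ^ 3) ^ m * (K ^ 4) ^ m ≡ Π B ^ r * (Π B * (K ^ 4) ^ m)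
      reorder = trans (cong (_* (K ^ 4) ^ m) (sym (cube-power (Π B))))
        (solve 3 (λ p q k → p :* q :* k := q :* (p :* k)) refl (Π B) (Π B ^ r) ((K ^ 4) ^ m))

  factor≤ : ∀ {x y R S X} → 0# ≤ y → 0# ≤ X → 0# ≤ S → S ≤ R → Positive R → x * R ≤ y * S * X → x ≤ y * X
  factor≤ {x} {y} {R} {S} {X} y≥0 X≥0 S≥0 S≤R R>0 h = *-cancelˡ-≤ R>0
    (≤-of-diff (diff-nonneg h ⟨+⟩ y≥0 ⟨*⟩ X≥0 ⟨*⟩ diff-nonneg S≤R)
      (solve 5 (λ x y R S X → R :* (y :* X) := (y :* S :* X :- x :* R :+ y :* X :* (R :- S)) :+ R :* x)
          refl x y R S X))

  -- The other three factors of g are bounded by those of f, so cancelling them charges the whole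
  -- loss X to a single index.
  ∏≤⇒factors≤ : ∀ {f g : Fin 4 → Carrier} {X} → 0# ≤ X → (∀ i → 0# ≤ g i) → (∀ i → g i ≤ f i) →
      (∀ i → Positive (f i)) →
                ∏ f ≤ ∏ g * X → ∀ i → f i ≤ g i * X
  ∏≤⇒factors≤ {f} {g} {X} X≥0 g≥0 g≤f f>0 h i =
    factor≤ (g≥0 i) X≥0 (rest-nonneg g g≥0 i) (rest-mono i) (rest-positive i)
      (subst₂ _≤_ (∏-rest f i) (cong (_* X) (∏-rest g i)) h)
    where
    rest : (Fin 4 → Carrier) → Fin 4 → Carrier
    rest f zero                   = f (suc zero) * f (suc (suc zero)) * f (suc (suc (suc zero)))
    rest f (suc zero)             = f zero * f (suc (suc zero)) * f (suc (suc (suc zero)))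
    rest f (suc (suc zero))       = f zero * f (suc zero) * f (suc (suc (suc zero)))
    rest f (suc (suc (suc zero))) = f zero * f (suc zero) * f (suc (suc zero))
    ∏-rest : ∀ f i → ∏ f ≡ f i * rest f i
    ∏-rest f zero                   = solve 4 (λ a b c d → a :* b :* c :* d := a :* (b :* c :* d))
        refl (f zero) (f (suc zero)) (f (suc (suc zero))) (f (suc (suc (suc zero))))
    ∏-rest f (suc zero)             = solve 4 (λ a b c d → a :* b :* c :* d := b :* (a :* c :* d))
        refl (f zero) (f (suc zero)) (f (suc (suc zero))) (f (suc (suc (suc zero))))
    ∏-rest f (suc (suc zero))       = solve 4 (λ a b c d → a :* b :* c :* d := c :* (a :* b :* d))
        refl (f zero) (f (suc zero)) (f (suc (suc zero))) (f (suc (suc (suc zero))))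
    ∏-rest f (suc (suc (suc zero))) = *-comm _ _
    triple-mono : ∀ i j k → g i * g j * g k ≤ f i * f j * f k
    triple-mono i j k = *-mono-≤ (g≥0 i ⟨*⟩ g≥0 j) (positive⇒nonneg (f>0 k))
        (*-mono-≤ (g≥0 i) (positive⇒nonneg (f>0 j)) (g≤f i) (g≤f j)) (g≤f k)
    rest-mono : ∀ i → rest g i ≤ rest f i
    rest-mono zero                   = triple-mono _ _ _
    rest-mono (suc zero)             = triple-mono _ _ _
    rest-mono (suc (suc zero))       = triple-mono _ _ _
    rest-mono (suc (suc (suc zero))) = triple-mono _ _ _
    rest-nonneg : ∀ f → (∀ i → 0# ≤ f i) → ∀ i → 0# ≤ rest f i
    rest-nonneg f f≥0 zero                   = f≥0 _ ⟨*⟩ f≥0 _ ⟨*⟩ f≥0 _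
    rest-nonneg f f≥0 (suc zero)             = f≥0 _ ⟨*⟩ f≥0 _ ⟨*⟩ f≥0 _
    rest-nonneg f f≥0 (suc (suc zero))       = f≥0 _ ⟨*⟩ f≥0 _ ⟨*⟩ f≥0 _
    rest-nonneg f f≥0 (suc (suc (suc zero))) = f≥0 _ ⟨*⟩ f≥0 _ ⟨*⟩ f≥0 _
    rest-positive : ∀ i → Positive (rest f i)
    rest-positive zero                   = *-positive (*-positive (f>0 _) (f>0 _)) (f>0 _)
    rest-positive (suc zero)             = *-positive (*-positive (f>0 _) (f>0 _)) (f>0 _)
    rest-positive (suc (suc zero))       = *-positive (*-positive (f>0 _) (f>0 _)) (f>0 _)
    rest-positive (suc (suc (suc zero))) = *-positive (*-positive (f>0 _) (f>0 _)) (f>0 _)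

  size-mono : ∀ {n} {A B : Subset n} → (∀ v → A v ≡ true → B v ≡ true) → size A ≤ size B
  size-mono {A = A} {B} A⊆B = S-mono (λ v → lemma (A v) (B v) (A⊆B v))
    where
    lemma : ∀ a b → (a ≡ true → b ≡ true) → 𝟙 a ≤ 𝟙 b
    lemma false b h = 𝟙-nonneg b
    lemma true  b h = ≤-reflexive (cong 𝟙 (sym (h refl)))

  structure-theorem : ∀ {n} (A : Fin 4 → Subset n) (K : Carrier) (k : ℕ) → 1# ≤ K → K ≤ # k →
    (∀ i → Positive (size (A i))) → Π A ^ 3 ≤ (E A * K) ^ 4 →
    Σ (Subset n) λ H → IsSubspace H × Σ (Fin 4 → F₂^ n) λ x →
      (∀ i → # 15 * size (A i) ≤ # 16 * (size H * K ^ (160000 ℕ.* k))) ×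
      size H ^ 4 ≤ (# 2 * K) ^ 4 * ∏ (λ i → size (interCoset (A i) (x i) H))
  structure-theorem A K zero    K≥1 K≤k A>0 energy-large = ⊥-elim (1≰0 (≤-trans K≥1 K≤k))
  structure-theorem {n} A K (suc k′) K≥1 K≤k A>0 energy-large =
    Coset.H flat , annihilator-isSubspace (Coset.W flat) , Coset.centre flat , size-bound , density-bound
    where
    m′ : ℕ
    -- Written so that `suc m′` is `40000 ℕ.* suc k′` by computation.
    m′ = k′ ℕ.+ 39999 ℕ.* suc k′
    #m≡ : # (suc m′) ≡ # 40000 * # (suc k′)
    #m≡ = #-homo-* 40000 (suc k′)
    reciprocal : ∃ λ w → # (suc m′) * w ≡ 1#
    reciprocal = inverse (# (suc m′)) (λ m≡0 → #-positive m′ (≤-reflexive m≡0))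
    w : Carrier
    w = proj₁ reciprocal
    mw≡1 : # (suc m′) * w ≡ 1#
    mw≡1 = proj₂ reciprocal
    w≥0 : 0# ≤ w
    w≥0 = *-cancelˡ-≤ (#-positive m′) (subst₂ _≤_ (sym (zeroʳ _)) (sym mw≡1) (#-nonneg 1))
    w-small : # 40000 * (K * w) ≤ 1#
    w-small = subst (# 40000 * (K * w) ≤_) (trans (sym (*-assoc (# 40000) (# (suc k′)) w))
        (trans (cong (_* w) (sym #m≡)) mw≡1))
      (*-monoˡ-≤ (#-nonneg 40000) (*-mono-≤ (≤-trans (#-nonneg 1) K≥1) w≥0 K≤k ≤-refl))
    Π>0 : Positive (Π A)
    Π>0 = ∏-positive A>0
    module I = Increment {n} {K} {w} {m′} K≥1 mw≡1 w-small {Π A} Π>0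
    refinement : I.FlatRefinement A
    refinement = I.flatRefinement (suc (measure A)) A (ℕ.n<1+n (measure A)) Π>0
      (≤-trans (≤-reflexive (I.cube-power (Π A))) (^-mono-≤ (suc m′) (^-nonneg 3 (Π-nonneg A)) energy-large))
    B : Fin 4 → Subset n
    B = proj₁ refinement
    B⊆A : ∀ i v → B i v ≡ true → A i v ≡ true
    B⊆A = proj₁ (proj₂ refinement)
    ΠB>0 : Positive (Π B)
    ΠB>0 = proj₁ (proj₂ (proj₂ refinement))
    dense : I.Dense B
    dense = proj₁ (proj₂ (proj₂ (proj₂ refinement)))
    flat : ∀ ξ → Flat K B ξ
    flat = proj₂ (proj₂ (proj₂ (proj₂ refinement)))
    B≤A : ∀ i → size (B i) ≤ size (A i)
    B≤A i = size-mono (B⊆A i)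
    module Coset = FlatStructure B K K≥1 (∏-positive⁻¹ (λ i → size-nonneg (B i)) ΠB>0)
      (I.dense⇒energy-large B dense (∏-mono (λ i → size-nonneg (B i)) B≤A))
    X : Carrier
    X = (K ^ 4) ^ suc m′
    X≥0 : 0# ≤ X
    X≥0 = ^-nonneg (suc m′) (^-nonneg 4 (≤-trans (#-nonneg 1) K≥1))
    X≡ : X ≡ K ^ (160000 ℕ.* suc k′)
    -- 160000 = 4 · 40000: the loss is K^(4m) with m = 40000 k.
    X≡ = trans (^-assocʳ K 4 (suc m′)) (cong (K ^_) (sym (ℕ.*-assoc 4 40000 (suc k′))))
    size-bound : ∀ i → # 15 * size (A i) ≤ # 16 * (size (Coset.H flat) * K ^ (160000 ℕ.* suc k′))
    size-bound i = subst (λ Y → # 15 * size (A i) ≤ # 16 * (size (Coset.H flat) * Y)) X≡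
      (≤-trans (*-monoˡ-≤ (#-nonneg 15) (∏≤⇒factors≤ X≥0 (λ i → size-nonneg (B i)) B≤A A>0
          (I.dense⇒Π₀≤ B ΠB>0 dense) i))
        (subst₂ _≤_ (trans (*-comm X _) (*-assoc _ _ _)) (trans (*-comm X _) (*-assoc _ _ _))
            (*-monoˡ-≤ X≥0 (Coset.H-large flat i))))
    density-bound : size (Coset.H flat) ^ 4 ≤ (# 2 * K) ^ 4 * ∏
        (λ i → size (interCoset (A i) (Coset.centre flat i) (Coset.H flat)))
    density-bound = ≤-trans (Coset.coset-density flat)
        (*-monoˡ-≤ (^-nonneg 4 (#-nonneg 2 ⟨*⟩ ≤-trans (#-nonneg 1) K≥1))
      (∏-mono (λ i → size-nonneg (interCoset (B i) (Coset.centre flat i) (Coset.H flat)))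
        (λ i → size-mono {A = interCoset (B i) (Coset.centre flat i) (Coset.H flat)}
            {B = interCoset (A i) (Coset.centre flat i) (Coset.H flat)}
          (λ v Bv → let B∧H = ∧-true {B i v} Bv in cong₂ _∧_ (B⊆A i v (proj₁ B∧H)) (proj₂ B∧H)))))

-- The rational numbers as an ordered field, and their ceiling.

ℚ-orderedField : OrderedField
ℚ-orderedField = record
  { Carrier           = ℚ.ℚ
  ; _+_               = ℚ._+_
  ; _*_               = ℚ._*_
  ; -_                = ℚ.-_
  ; 0#                = ℚ.0ℚ
  ; 1#                = ℚ.1ℚ
  ; isCommutativeRing = ℚ.+-*-isCommutativeRing
  ; _≤_               = ℚ._≤_
  ; isDecTotalOrder   = ℚ.≤-isDecTotalOrder
  ; +-monoˡ-≤         = λ z {x} {y} → ℚ.+-monoˡ-≤ z {x} {y}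
  ; *-nonneg          = λ {x} {y} x≥0 y≥0 → subst (ℚ._≤ x ℚ.* y) (ℚ.*-zeroʳ x)
                          (ℚ.*-monoˡ-≤-nonNeg x {{ℚ.nonNegative x≥0}} y≥0)
  ; 1≰0               = λ { (ℚ.*≤* (ℤ.+≤+ ())) }
  ; inverse           = λ x x≢0 → ℚ.1/_ x {{ℚ.≢-nonZero x≢0}} , ℚ.*-inverseʳ x {{ℚ.≢-nonZero x≢0}}
  }

i/1≃ : ∀ i → ℚ.toℚᵘ (i ℚ./ 1) ℚᵘ.≃ mkℚᵘ i 0
i/1≃ i = ℚ.toℚᵘ-fromℚᵘ (mkℚᵘ i 0)

≤-+∣∣ : ∀ i → i ℤ.≤ pos ℤ.∣ i ∣
≤-+∣∣ (pos n)  = ℤ.≤-refl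
≤-+∣∣ -[1+ n ] = ℤ.-≤+

-- From ⌊q⌋ ≤ q at q = -p, as the ceiling is -⌊-p⌋; passing to the absolute value can only increase
-- it.
≤-∣ceiling∣ : ∀ p → p ℚ.≤ pos ℤ.∣ ℚ.ceiling p ∣ ℚ./ 1
≤-∣ceiling∣ p@(ℚ.mkℚ n d-1 _) = ℚ.toℚᵘ-cancel-≤ (ℚᵘ.≤-respʳ-≃ (ℚᵘ.≃-sym (i/1≃ (pos ℤ.∣ ℚ.ceiling p ∣)))
  (ℚᵘ.*≤* (subst (ℤ._≤ pos ℤ.∣ ℚ.ceiling p ∣ ℤ.* d) (sym (ℤ.*-identityʳ n))
    (ℤ.≤-trans n≤ (ℤ.*-monoʳ-≤-nonNeg d (≤-+∣∣ (ℚ.ceiling p)))))))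
  where
  d : ℤ
  d = pos (ℕ.suc d-1)
  floor*d≤ : ∀ q → ℚ.floor q ℤ.* ℚ.↧ q ℤ.≤ ℚ.↥ q
  floor*d≤ (ℚ.mkℚ n d-1 _) = subst (λ z → z ℤ.* pos (ℕ.suc d-1) ℤ.≤ n) (sym (ℤ.div-pos-is-/ℕ n (ℕ.suc d-1)))
      (ℤ.[n/ℕd]*d≤n n (ℕ.suc d-1))
  n≤ : n ℤ.≤ ℚ.ceiling p ℤ.* d
  n≤ = ℤ.neg-cancel-≤ (subst₂ ℤ._≤_
    (trans (cong (ℚ.floor (ℚ.- p) ℤ.*_) (ℚ.↧-neg p))
        (trans (cong (ℤ._* d) (sym (ℤ.neg-involutive (ℚ.floor (ℚ.- p))))) (sym (ℤ.neg-distribˡ-* (ℚ.ceiling p) d))))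
    (ℚ.↥-neg p)
    (floor*d≤ (ℚ.- p)))

-- Transfer to cardinalities in ℚ.

open import Defs
open import Data.Nat using (ℕ; _*_)
open import Data.Fin using (Fin)
open import Data.Vec using (Vec)
open import Data.Bool using (Bool)
open import Data.Product using (Σ; _×_)
open import Data.Integer using (∣_∣; +_)
open import Data.Rational using (ℚ; 0ℚ; 1ℚ; _≤_; _<_; _/_; ceiling) renaming (_*_ to _*ℚ_)

private
  module R = OrderedFieldProperties ℚ-orderedField
  module Q = EnergyIncrement ℚ-orderedField
  open Structure ℚ-orderedField using (size; size-positive; E)
  open KeyInequality ℚ-orderedField using (∏)

ℕ→ℚ≡# : ∀ m → ℕ→ℚ m ≡ R.# m
ℕ→ℚ≡# ℕ.zero    = refl
ℕ→ℚ≡# (ℕ.suc m) = trans (ℚ.toℚᵘ-injective 1+m≃) (trans (cong (1ℚ ℚ.+_) (ℕ→ℚ≡# m)) (sym (R.#-homo-+ 1 m)))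
  where
  1+m≃ : ℚ.toℚᵘ (ℕ→ℚ (ℕ.suc m)) ℚᵘ.≃ ℚ.toℚᵘ (1ℚ ℚ.+ ℕ→ℚ m)
  1+m≃ = ℚᵘ.≃-trans (i/1≃ (pos (ℕ.suc m))) (ℚᵘ.≃-trans
    (ℚᵘ.*≡* (cong (λ z → (pos 1 ℤ.+ z) ℤ.* pos 1) (sym (ℤ.*-identityʳ (pos m)))))
    (ℚᵘ.≃-sym (ℚᵘ.≃-trans (ℚ.toℚᵘ-homo-+ 1ℚ (ℕ→ℚ m)) (ℚᵘ.+-congʳ (ℚ.toℚᵘ 1ℚ) (i/1≃ (pos m))))))

^ℚ≡^ : ∀ q k → q ^ℚ k ≡ q R.^ k
^ℚ≡^ q ℕ.zero    = refl
^ℚ≡^ q (ℕ.suc k) = cong (q *ℚ_) (^ℚ≡^ q k)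

ℕ→ℚ-card : ∀ {n} (A : Subset n) → ℕ→ℚ (card A) ≡ size A
ℕ→ℚ-card A = trans (ℕ→ℚ≡# (card A)) (Q.#-card A)

ℕ→ℚ-energy : ∀ {n} (A : Fin 4 → Subset n) → ℕ→ℚ (energy A) ≡ E A
ℕ→ℚ-energy A = trans (ℕ→ℚ≡# (energy A)) (Q.#-energy A)

ℕ→ℚ-* : ∀ a b → ℕ→ℚ (a * b) ≡ ℕ→ℚ a *ℚ ℕ→ℚ b
ℕ→ℚ-* a b = trans (ℕ→ℚ≡# (a * b)) (trans (R.#-homo-* a b) (cong₂ _*ℚ_ (sym (ℕ→ℚ≡# a)) (sym (ℕ→ℚ≡# b))))

ℕ→ℚ-prod4 : ∀ {n} (A : Fin 4 → Subset n) → ℕ→ℚ (prod4 (λ i → card (A i))) ≡ ∏ (λ i → size (A i))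
ℕ→ℚ-prod4 A = trans (ℕ→ℚ-* (a₀ * a₁ * a₂) a₃) (cong₂ _*ℚ_ (trans (ℕ→ℚ-* (a₀ * a₁) a₂) (cong₂ _*ℚ_ (trans (ℕ→ℚ-* a₀ a₁)
  (cong₂ _*ℚ_ (ℕ→ℚ-card (A i₀)) (ℕ→ℚ-card (A i₁)))) (ℕ→ℚ-card (A i₂)))) (ℕ→ℚ-card (A i₃)))
  where
  i₀ i₁ i₂ i₃ : Fin 4
  i₀ = Fin.zero
  i₁ = Fin.suc Fin.zero
  i₂ = Fin.suc (Fin.suc Fin.zero)
  i₃ = Fin.suc (Fin.suc (Fin.suc Fin.zero))
  a₀ = card (A i₀)
  a₁ = card (A i₁)
  a₂ = card (A i₂)
  a₃ = card (A i₃)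

theorem1p10 : Σ ℚ λ c → Σ ℕ λ C → (0ℚ < c) ×
    ((K : ℚ) (n : ℕ) (A : Fin 4 → Subset n) →
    1ℚ ≤ K →
    ((i : Fin 4) → NonEmpty (A i)) →
    ℕ→ℚ (prod4 (λ i → card (A i))) ^ℚ 3 ≤ (ℕ→ℚ (energy A) *ℚ K) ^ℚ 4 →
    Σ (Subset n) λ H → IsSubspace H × Σ (Fin 4 → F₂^ n) λ x →
    ((i : Fin 4) → c *ℚ ℕ→ℚ (card (A i)) ≤ ℕ→ℚ (card H) *ℚ (K ^ℚ (C * ∣ ceiling K ∣))) ×
    (ℕ→ℚ (card H) ^ℚ 4 ≤ ((+ 2 / 1) *ℚ K) ^ℚ 4 *ℚ ℕ→ℚ (prod4 (λ i → card (interCoset (A i) (x i) H)))))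
theorem1p10 = c , 160000 , ℚ.positive⁻¹ c , λ K n A K≥1 A≢∅ energy-large →
  let k = ∣ ceiling K ∣
      H , subspace , x , size-bound , density-bound = Q.structure-theorem A K k K≥1
        (subst (K ≤_) (ℕ→ℚ≡# k) (≤-∣ceiling∣ K))
        (λ i → size-positive (A i) (proj₁ (A≢∅ i)) (proj₂ (A≢∅ i)))
        (subst₂ _≤_ (trans (^ℚ≡^ (ℕ→ℚ (prod4 (λ i → card (A i)))) 3) (cong (R._^ 3) (ℕ→ℚ-prod4 A)))
          (trans (^ℚ≡^ (ℕ→ℚ (energy A) *ℚ K) 4) (cong (λ e → (e *ℚ K) R.^ 4) (ℕ→ℚ-energy A))) energy-large)
  in H , subspace , x ,
    (λ i → subst₂ _≤_ (cong (c *ℚ_) (sym (ℕ→ℚ-card (A i))))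
      (cong₂ _*ℚ_ (sym (ℕ→ℚ-card H)) (sym (^ℚ≡^ K (160000 * k))))
      (divide-by-16 {size (A i)} {size H *ℚ (K R.^ (160000 * k))} (size-bound i))) ,
    subst₂ _≤_ (sym (trans (^ℚ≡^ (ℕ→ℚ (card H)) 4) (cong (R._^ 4) (ℕ→ℚ-card H))))
      (cong₂ _*ℚ_ (sym (^ℚ≡^ ((+ 2 / 1) *ℚ K) 4)) (sym (ℕ→ℚ-prod4 (λ i → interCoset (A i) (x i) H))))
      density-bound
  where
  c : ℚ
  -- The threshold for c²/a² in `Large`, which reaches the size bound through `H-large`.
  c = + 15 / 16
  divide-by-16 : ∀ {a b} → R.# 15 *ℚ a ≤ R.# 16 *ℚ b → c *ℚ a ≤ b
  -- `R.# 16 *ℚ c` evaluates to `R.# 15`, so reassociating the product is the only rewriting.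
  divide-by-16 {a} {b} 15a≤16b = R.*-cancelˡ-≤ {R.# 16} (R.#-positive 15)
      (subst (_≤ R.# 16 *ℚ b) (ℚ.*-assoc (R.# 16) c a) 15a≤16b)
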